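{- Let $\boldsymbol a=(a_1,\dots,a_m)\in\mathbb{Z}_{>0}^m$ with $a_i\geq2$ for all $i\in[m]$ and $d:=\sum_{i=1}^m a_i\geq3$. Let $\Delta$ be an $\boldsymbol a$-balanced minimal $(d-1)$-cycle complex with an $\boldsymbol a$-coloring $\kappa$. Then $G(\Delta)$ is $(\kappa,\boldsymbol a)$-sparse rigid.
   Context: Simplicial complexes are finite; $[m]=\{1,\dots,m\}$. $V(\Delta)$ is the vertex set and $G(\Delta)$ the graph (1-skeleton) of $\Delta$. For a collection $\mathcal S$ of finite sets, $\langle\mathcal S\rangle=\{G: G\subseteq F \text{ for some } F\in\mathcal S\}$. Minimal cycle complexes. Let $\Gamma$ be an abelian group. On a totally ordered vertex set, an $i$-chain is a formal sum $c=\sum_F a_F F$ of $i$-faces with $a_F\in\Gamma$; $\partial c=\sum_F a_F\,\partial F$, where for $F=\{x_1<\dots<x_{i+1}\}$, $\partial F=\sum_{j=1}^{i+1}(-1)^jF\setminus\{x_j\}$. An $i$-cycle is an $i$-chain $c$ with $\partial c=0$. A chain $c'=\sum b_FF$ is a subchain of $c=\sum a_FF$ if $b_F\in\{0,a_F\}$ for every $F$. An $i$-cycle $c$ is minimal if its only subchains that are $i$-cycles are $c$ and $0$. $\operatorname{supp} c=\{F:a_F\neq0\}$. A $(d-1)$-dimensional simplicial complex $\Delta$ is a minimal $(d-1)$-cycle complex (over $\Gamma$) if either (i) $\Delta=\langle\{F\}\rangle$ for a $d$-set $F$, or (ii) $\Delta=\langle\operatorname{supp}c\rangle$ for some nonzero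 minimal $(d-1)$-cycle $c$ with coefficients in $\Gamma$. Here $\Gamma$ is an arbitrary abelian group. For $\boldsymbol a\in\mathbb{Z}_{>0}^m$ with $\sum_i a_i=d$, a $(d-1)$-dimensional complex $\Delta$ is $\boldsymbol a$-balanced if there is a map $\kappa:V(\Delta)\to[m]$, called an $\boldsymbol a$-coloring, with $|F\cap\kappa^{ -1}(i)|\leq a_i$ for all $F\in\Delta$ and $i\in[m]$. Rigidity. A framework $(G,p)$ in $\mathbb{R}^d$ is a finite simple graph $G$ with a map (point configuration) $p:V(G)\to\mathbb{R}^d$. An infinitesimal motion is a map $\dot p:V(G)\to\mathbb{R}^d$ with $(p(i)-p(j))\cdot(\dot p(i)-\dot p(j))=0$ for all $ij\in E(G)$; it is trivial if $\dot p(i)=Sp(i)+t$ for all $i$, for some skew-symmetric $S$ and some $t\in\mathbb{R}^d$. $(G,p)$ is infinitesimally rigid if all its infinitesimal motions are trivial. Sparse rigidity. Write $\mathbb{R}^d=\prod_{i=1}^m\mathbb{R}^{a_i}$ and $H_i=\{(x_1,\dots,x_m): x_j=0 \text{ for } j\neq i\}$, where $x_j\in\mathbb{R}^{a_j}$. For a graph $G$ and $\kappa:V(G)\to[m]$, a point configuration $p:V(G)\to\mathbb{R}^d$ is $(\kappa,\boldsymbol a)$-sparse if $p(v)\in H_{\kappa(v)}$ for all $v\in V(G)$. $G$ is $(\kappa,\boldsymbol a)$-sparse rigid if $(G,p)$ is infinitesimally rigid in $\mathbb{R}^d$ for some $(\kappa,\boldsymbol a)$-sparse $p$. -}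

module Defs where

open import Algebra.Bundles using (AbelianGroup; CommutativeMonoid)
import Algebra.Bundles.Raw as Raw
import Algebra.Definitions.RawMonoid as RawMonoidDefs
import Algebra.Properties.CommutativeSemigroup as CommutativeSemigroupProperties
open import Data.Fin.Base as Fin using (Fin; zero; suc; splitAt)
import Data.Fin.Properties as Fin
open import Data.Fin.Subset using (Subset; _⊆_; _∩_; _∪_; ⁅_⁆; ∣_∣)
open import Data.Fin.Subset.Properties using (_∈?_; ∪-comm)
open import Data.Nat.Base as ℕ using (ℕ; zero; suc)
import Data.Nat.Properties as ℕ
open import Data.Product.Base using (Σ; ∃-syntax; _×_; _,_)
open import Data.Rational.Base as ℚ using (ℚ; 0ℚ; 1ℚ; ½; Positive)
import Data.Rational.Properties as ℚ
open import Data.Sum.Base using (_⊎_; inj₁; inj₂)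
open import Data.Vec.Base as Vec using (Vec; []; _∷_; lookup)
open import Function.Base using (_∘_)
open import Function.Bundles using (_⇔_)
open import Level using (0ℓ; _⊔_)
open import Relation.Binary.Definitions using (Symmetric; Irreflexive)
open import Relation.Binary.PropositionalEquality
open import Relation.Nullary using (¬_; yes; no)
open import Relation.Nullary.Decidable using (does)
open import Relation.Unary using (Pred; Decidable)

------------------------------------------------------------------------
-- Real numbers: Cauchy sequences of rationals, with equality "the
-- difference tends to zero" (a setoid, as there are no quotients).

IsCauchy : (ℕ → ℚ) → Set
IsCauchy x = ∀ ε → .{{Positive ε}} →
  ∃[ N ] ∀ {m n} → N ℕ.≤ m → N ℕ.≤ n → ℚ.∣ x m ℚ.- x n ∣ ℚ.< ε

record ℝ : Set where
  constructor mkℝ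
  field
    approx : ℕ → ℚ
    cauchy : IsCauchy approx
open ℝ public

infix 4 _≈ℝ_
_≈ℝ_ : ℝ → ℝ → Set
x ≈ℝ y = ∀ ε → .{{Positive ε}} →
  ∃[ N ] ∀ {n} → N ℕ.≤ n → ℚ.∣ approx x n ℚ.- approx y n ∣ ℚ.< ε

private
  open CommutativeSemigroupProperties
    (CommutativeMonoid.commutativeSemigroup ℚ.+-0-commutativeMonoid) using (interchange)

  cancel : ∀ p q → (p ℚ.- q) ℚ.+ q ≡ p
  cancel p q = trans (ℚ.+-assoc p (ℚ.- q) q)
    (trans (cong (p ℚ.+_) (ℚ.+-inverseˡ q)) (ℚ.+-identityʳ p))

  telescope : ∀ p q r → p ℚ.- r ≡ (p ℚ.- q) ℚ.+ (q ℚ.- r)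
  telescope p q r = trans (cong (ℚ._- r) (sym (cancel p q))) (ℚ.+-assoc (p ℚ.- q) q (ℚ.- r))

  const-cauchy : ∀ q → IsCauchy (λ _ → q)
  const-cauchy q ε = 0 , λ _ _ →
    subst (ℚ._< ε) (sym (cong ℚ.∣_∣ (ℚ.+-inverseʳ q))) (ℚ.positive⁻¹ ε)

  half-pos : ∀ ε → .{{Positive ε}} → Positive (½ ℚ.* ε)
  half-pos ε = ℚ.pos*pos⇒pos ½ ε

  halves : ∀ ε → ½ ℚ.* ε ℚ.+ ½ ℚ.* ε ≡ ε
  halves ε = trans (sym (ℚ.*-distribʳ-+ ε ½ ½)) (ℚ.*-identityˡ ε)

  +-close : ∀ {ε} a b c d → ℚ.∣ a ℚ.- c ∣ ℚ.< ½ ℚ.* ε → ℚ.∣ b ℚ.- d ∣ ℚ.< ½ ℚ.* ε →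
            ℚ.∣ (a ℚ.+ b) ℚ.- (c ℚ.+ d) ∣ ℚ.< ε
  +-close {ε} a b c d ac bd = begin-strict
    ℚ.∣ (a ℚ.+ b) ℚ.- (c ℚ.+ d) ∣        ≡⟨ cong ℚ.∣_∣ rearrange ⟩
    ℚ.∣ (a ℚ.- c) ℚ.+ (b ℚ.- d) ∣        ≤⟨ ℚ.∣p+q∣≤∣p∣+∣q∣ (a ℚ.- c) (b ℚ.- d) ⟩
    ℚ.∣ a ℚ.- c ∣ ℚ.+ ℚ.∣ b ℚ.- d ∣      <⟨ ℚ.+-mono-< ac bd ⟩
    ½ ℚ.* ε ℚ.+ ½ ℚ.* ε                  ≡⟨ halves ε ⟩
    ε                                    ∎
    where
    open ℚ.≤-Reasoning
    rearrange : (a ℚ.+ b) ℚ.- (c ℚ.+ d) ≡ (a ℚ.- c) ℚ.+ (b ℚ.- d)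
    rearrange = trans (cong ((a ℚ.+ b) ℚ.+_) (ℚ.neg-distrib-+ c d))
                      (interchange a b (ℚ.- c) (ℚ.- d))

  +-cauchy : ∀ {x y} → IsCauchy x → IsCauchy y → IsCauchy (λ n → x n ℚ.+ y n)
  +-cauchy {x} {y} cx cy ε =
    let N , hx = cx (½ ℚ.* ε) {{half-pos ε}}
        M , hy = cy (½ ℚ.* ε) {{half-pos ε}}
    in N ℕ.⊔ M , λ {m} {n} p q → +-close (x m) (y m) (x n) (y n)
         (hx (ℕ.m⊔n≤o⇒m≤o N M p) (ℕ.m⊔n≤o⇒m≤o N M q))
         (hy (ℕ.m⊔n≤o⇒n≤o N M p) (ℕ.m⊔n≤o⇒n≤o N M q))

  neg-cauchy : ∀ {x} → IsCauchy x → IsCauchy (λ n → ℚ.- x n)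
  neg-cauchy {x} cx ε with N , hx ← cx ε
    = N , λ {m} {n} p q → subst (ℚ._< ε) (eq (x m) (x n)) (hx p q)
    where
    eq : ∀ a b → ℚ.∣ a ℚ.- b ∣ ≡ ℚ.∣ ℚ.- a ℚ.- (ℚ.- b) ∣
    eq a b = trans (sym (ℚ.∣-p∣≡∣p∣ (a ℚ.- b))) (cong ℚ.∣_∣ (ℚ.neg-distrib-+ a (ℚ.- b)))

  Bound : (ℕ → ℚ) → Set
  Bound x = ∃[ B ] Positive B × ∃[ N ] ∀ {n} → N ℕ.≤ n → ℚ.∣ x n ∣ ℚ.≤ B

  eventually-bounded : ∀ {x} → IsCauchy x → Bound x
  eventually-bounded {x} cx with N , hx ← cx 1ℚ
    = 1ℚ ℚ.+ ℚ.∣ x N ∣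
    , ℚ.pos+nonNeg⇒pos 1ℚ ℚ.∣ x N ∣ {{ℚ.∣-∣-nonNeg (x N)}}
    , N , λ {n} p → begin
      ℚ.∣ x n ∣                              ≡⟨ cong ℚ.∣_∣ (split (x n) (x N)) ⟩
      ℚ.∣ (x n ℚ.- x N) ℚ.+ x N ∣            ≤⟨ ℚ.∣p+q∣≤∣p∣+∣q∣ (x n ℚ.- x N) (x N) ⟩
      ℚ.∣ x n ℚ.- x N ∣ ℚ.+ ℚ.∣ x N ∣        ≤⟨ ℚ.+-monoˡ-≤ ℚ.∣ x N ∣ (ℚ.<⇒≤ (hx p ℕ.≤-refl)) ⟩
      1ℚ ℚ.+ ℚ.∣ x N ∣                       ∎
    where
    open ℚ.≤-Reasoning
    split : ∀ a b → a ≡ (a ℚ.- b) ℚ.+ b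
    split a b = sym (cancel a b)

  -- δ = ε / 2B
  shrink : ∀ ε B → .{{Positive ε}} → Positive B →
           ∃[ δ ] Positive δ × B ℚ.* δ ≡ ½ ℚ.* ε
  shrink ε B posB = r ℚ.* (½ ℚ.* ε)
    , ℚ.pos*pos⇒pos r {{r-pos}} (½ ℚ.* ε) {{half-pos ε}}
    , trans (sym (ℚ.*-assoc B r (½ ℚ.* ε)))
        (trans (cong (ℚ._* (½ ℚ.* ε)) (ℚ.*-inverseʳ B {{nz}})) (ℚ.*-identityˡ (½ ℚ.* ε)))
    where
    nz = ℚ.pos⇒nonZero B {{posB}}
    r = ℚ.1/_ B {{nz}}
    r-pos = ℚ.1/pos⇒pos B {{posB}}

  *-bound : ∀ {B δ} a b → Positive B → ℚ.∣ a ∣ ℚ.≤ B → ℚ.∣ b ∣ ℚ.< δ →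
            ℚ.∣ a ℚ.* b ∣ ℚ.< B ℚ.* δ
  *-bound {B} {δ} a b posB ha hb = begin-strict
    ℚ.∣ a ℚ.* b ∣          ≡⟨ ℚ.∣p*q∣≡∣p∣*∣q∣ a b ⟩
    ℚ.∣ a ∣ ℚ.* ℚ.∣ b ∣    ≤⟨ ℚ.*-monoʳ-≤-nonNeg ℚ.∣ b ∣ {{ℚ.∣-∣-nonNeg b}} ha ⟩
    B ℚ.* ℚ.∣ b ∣          <⟨ ℚ.*-monoʳ-<-pos B {{posB}} hb ⟩
    B ℚ.* δ                ∎
    where open ℚ.≤-Reasoning

  *-close : ∀ {ε B C δ η} a b c d → Positive B → Positive C →
            B ℚ.* δ ≡ ½ ℚ.* ε → C ℚ.* η ≡ ½ ℚ.* ε →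
            ℚ.∣ a ∣ ℚ.≤ B → ℚ.∣ d ∣ ℚ.≤ C →
            ℚ.∣ b ℚ.- d ∣ ℚ.< δ → ℚ.∣ a ℚ.- c ∣ ℚ.< η →
            ℚ.∣ a ℚ.* b ℚ.- c ℚ.* d ∣ ℚ.< ε
  *-close {ε} {B} {C} {δ} {η} a b c d posB posC Bδ Cη ha hd bd ac = begin-strict
    ℚ.∣ a ℚ.* b ℚ.- c ℚ.* d ∣
      ≡⟨ cong ℚ.∣_∣ rearrange ⟩
    ℚ.∣ a ℚ.* (b ℚ.- d) ℚ.+ d ℚ.* (a ℚ.- c) ∣
      ≤⟨ ℚ.∣p+q∣≤∣p∣+∣q∣ (a ℚ.* (b ℚ.- d)) (d ℚ.* (a ℚ.- c)) ⟩
    ℚ.∣ a ℚ.* (b ℚ.- d) ∣ ℚ.+ ℚ.∣ d ℚ.* (a ℚ.- c) ∣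
      <⟨ ℚ.+-mono-< (*-bound a (b ℚ.- d) posB ha bd) (*-bound d (a ℚ.- c) posC hd ac) ⟩
    B ℚ.* δ ℚ.+ C ℚ.* η
      ≡⟨ cong₂ ℚ._+_ Bδ Cη ⟩
    ½ ℚ.* ε ℚ.+ ½ ℚ.* ε
      ≡⟨ halves ε ⟩
    ε ∎
    where
    open ℚ.≤-Reasoning
    distrib : ∀ p q r → p ℚ.* q ℚ.- p ℚ.* r ≡ p ℚ.* (q ℚ.- r)
    distrib p q r = trans (cong (p ℚ.* q ℚ.+_) (ℚ.neg-distribʳ-* p r))
                          (sym (ℚ.*-distribˡ-+ p q (ℚ.- r)))
    rearrange : a ℚ.* b ℚ.- c ℚ.* d ≡ a ℚ.* (b ℚ.- d) ℚ.+ d ℚ.* (a ℚ.- c)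
    rearrange = trans
      (telescope (a ℚ.* b) (a ℚ.* d) (c ℚ.* d))
      (cong₂ ℚ._+_ (distrib a b d)
        (trans (cong₂ ℚ._-_ (ℚ.*-comm a d) (ℚ.*-comm c d)) (distrib d a c)))

  *-cauchy : ∀ {x y} → IsCauchy x → IsCauchy y → IsCauchy (λ n → x n ℚ.* y n)
  *-cauchy {x} {y} cx cy ε =
    let B , posB , N₁ , bx = eventually-bounded cx
        C , posC , N₂ , by = eventually-bounded cy
        δ , posδ , Bδ = shrink ε B posB
        η , posη , Cη = shrink ε C posC
        N₃ , hy = cy δ {{posδ}}
        N₄ , hx = cx η {{posη}}
        L = N₁ ℕ.⊔ N₂
        R = N₃ ℕ.⊔ N₄
    in L ℕ.⊔ R , λ {m} {n} p q →
      let pL = ℕ.m⊔n≤o⇒m≤o L R p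
          pR = ℕ.m⊔n≤o⇒n≤o L R p
          qL = ℕ.m⊔n≤o⇒m≤o L R q
          qR = ℕ.m⊔n≤o⇒n≤o L R q
      in *-close (x m) (y m) (x n) (y n) posB posC Bδ Cη
           (bx (ℕ.m⊔n≤o⇒m≤o N₁ N₂ pL)) (by (ℕ.m⊔n≤o⇒n≤o N₁ N₂ qL))
           (hy (ℕ.m⊔n≤o⇒m≤o N₃ N₄ pR) (ℕ.m⊔n≤o⇒m≤o N₃ N₄ qR))
           (hx (ℕ.m⊔n≤o⇒n≤o N₃ N₄ pR) (ℕ.m⊔n≤o⇒n≤o N₃ N₄ qR))

infixl 6 _+ℝ_ _-ℝ_
infixl 7 _*ℝ_
infix  8 -ℝ_

_+ℝ_ _*ℝ_ : ℝ → ℝ → ℝ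
x +ℝ y = mkℝ (λ n → approx x n ℚ.+ approx y n) (+-cauchy {approx x} {approx y} (cauchy x) (cauchy y))
x *ℝ y = mkℝ (λ n → approx x n ℚ.* approx y n) (*-cauchy {approx x} {approx y} (cauchy x) (cauchy y))

-ℝ_ : ℝ → ℝ
-ℝ x = mkℝ (λ n → ℚ.- approx x n) (neg-cauchy {approx x} (cauchy x))

_-ℝ_ : ℝ → ℝ → ℝ
x -ℝ y = x +ℝ (-ℝ y)

fromℚ : ℚ → ℝ
fromℚ q = mkℝ (λ _ → q) (const-cauchy q)

0ℝ 1ℝ : ℝ
0ℝ = fromℚ 0ℚ
1ℝ = fromℚ 1ℚ

ℝ-rawRing : Raw.RawRing 0ℓ 0ℓ
ℝ-rawRing = record
  { Carrier = ℝ ; _≈_ = _≈ℝ_ ; _+_ = _+ℝ_ ; _*_ = _*ℝ_ ; -_ = -ℝ_ ; 0# = 0ℝ ; 1# = 1ℝ }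

open RawMonoidDefs (Raw.RawRing.+-rawMonoid ℝ-rawRing) public
  using () renaming (sum to sumℝ)

------------------------------------------------------------------------
-- V(Δ) is exactly Fin n, which is why every singleton must be a face;
-- chains are oriented by the usual order of Fin n.  The faces form a
-- finite set, so membership is required to be decidable.

record SimplicialComplex (n : ℕ) : Set₁ where
  field
    Face        : Pred (Subset n) 0ℓ
    face?       : Decidable Face
    down-closed : ∀ {F G} → G ⊆ F → Face F → Face G
    vertices    : ∀ v → Face ⁅ v ⁆
open SimplicialComplex public

-- Δ = ⟨ S ⟩
GeneratedBy : ∀ {n ℓ} → SimplicialComplex n → Pred (Subset n) ℓ → Set ℓ
GeneratedBy Δ S = ∀ G → Face Δ G ⇔ (∃[ F ] (S F × G ⊆ F))

-- dim Δ = d - 1, in terms of the cardinality d of a largest face.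
HasFacetSize : ∀ {n} → SimplicialComplex n → ℕ → Set
HasFacetSize Δ d = (∃[ F ] (Face Δ F × ∣ F ∣ ≡ d)) × (∀ F → Face Δ F → ∣ F ∣ ℕ.≤ d)

record Graph (n : ℕ) : Set₁ where
  field
    Adj        : Fin n → Fin n → Set
    adj-sym    : Symmetric Adj
    adj-irrefl : Irreflexive _≡_ Adj
open Graph public using (Adj)

skeleton : ∀ {n} → SimplicialComplex n → Graph n
skeleton Δ = record
  { Adj        = λ u v → u ≢ v × Face Δ (⁅ u ⁆ ∪ ⁅ v ⁆)
  ; adj-sym    = λ {u} {v} (u≢v , f) → u≢v ∘ sym , subst (Face Δ) (∪-comm ⁅ u ⁆ ⁅ v ⁆) f
  ; adj-irrefl = λ u≡v (u≢v , _) → u≢v u≡v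
  }

module Chains {c ℓ} (Γ : AbelianGroup c ℓ) where
  open AbelianGroup Γ
  open RawMonoidDefs rawMonoid using (sum)

  -- A (k - 1)-chain: Γ-coefficients on the k-element subsets, extended
  -- by zero to all subsets.
  record Chain (n k : ℕ) : Set (c ⊔ ℓ) where
    field
      coeff       : Subset n → Carrier
      homogeneous : ∀ F → ∣ F ∣ ≢ k → coeff F ≈ ε
  open Chain public

  -- The j with x = x_j in F = {x₁ < x₂ < …}, for x ∈ F; counted from 1.
  position : ∀ {n} → Subset n → Fin n → ℕ
  position F x = ∣ F ∩ Vec.tabulate (λ y → does (y Fin.≤? x)) ∣

  -- (-1)^j · g
  signed : ℕ → Carrier → Carrier
  signed zero    g = g
  signed (suc j) g = signed j g ⁻¹

  -- The coefficient of G in Σ_F a_F ∂F.  A face F contributes through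
  -- its vertex x when F ∖ {x} = G, that is, x ∉ G and F = G ∪ {x}.
  ∂ : ∀ {n k} → Chain n k → Subset n → Carrier
  ∂ {n} a G = sum contribution
    where
    contribution : Fin n → Carrier
    contribution x with x ∈? G
    ... | yes _ = ε
    ... | no  _ = signed (position (G ∪ ⁅ x ⁆) x) (coeff a (G ∪ ⁅ x ⁆))

  IsCycle : ∀ {n k} → Chain n k → Set ℓ
  IsCycle a = ∀ G → ∂ a G ≈ ε

  infix 4 _≋_
  _≋_ : ∀ {n k} → Chain n k → Chain n k → Set ℓ
  a ≋ b = ∀ F → coeff a F ≈ coeff b F

  IsZero : ∀ {n k} → Chain n k → Set ℓ
  IsZero a = ∀ F → coeff a F ≈ ε

  Subchain : ∀ {n k} → Chain n k → Chain n k → Set ℓ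
  Subchain b a = ∀ F → coeff b F ≈ ε ⊎ coeff b F ≈ coeff a F

  IsMinimalCycle : ∀ {n k} → Chain n k → Set (c ⊔ ℓ)
  IsMinimalCycle a =
    IsCycle a × (∀ b → Subchain b a → IsCycle b → b ≋ a ⊎ IsZero b)

  supp : ∀ {n k} → Chain n k → Pred (Subset n) ℓ
  supp a F = ¬ coeff a F ≈ ε

  IsMinimalCycleComplex : ∀ {n} → ℕ → SimplicialComplex n → Set (c ⊔ ℓ)
  IsMinimalCycleComplex {n} d Δ = HasFacetSize Δ d ×
    ( (∃[ F ] (∣ F ∣ ≡ d × GeneratedBy Δ (_≡ F)))
    ⊎ (Σ (Chain n d) λ a → ¬ IsZero a × IsMinimalCycle a × GeneratedBy Δ (supp a)) )

open Chains public using (IsMinimalCycleComplex)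

-- κ⁻¹(i)
fibre : ∀ {n m} → (Fin n → Fin m) → Fin m → Subset n
fibre κ i = Vec.tabulate (λ v → does (κ v Fin.≟ i))

IsColoring : ∀ {n m} → Vec ℕ m → SimplicialComplex n → (Fin n → Fin m) → Set
IsColoring a Δ κ = ∀ F → Face Δ F → ∀ i → ∣ F ∩ fibre κ i ∣ ℕ.≤ lookup a i

Point : ℕ → Set
Point d = Fin d → ℝ

Configuration : ℕ → ℕ → Set
Configuration n d = Fin n → Point d

_-ᵖ_ : ∀ {d} → Point d → Point d → Point d
(x -ᵖ y) k = x k -ℝ y k

_·_ : ∀ {d} → Point d → Point d → ℝ
x · y = sumℝ (λ k → x k *ℝ y k)

IsMotion : ∀ {n d} → Graph n → Configuration n d → Configuration n d → Set
IsMotion G p ṗ = ∀ i j → Adj G i j → (p i -ᵖ p j) · (ṗ i -ᵖ ṗ j) ≈ℝ 0ℝ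

IsSkew : ∀ {d} → (Fin d → Fin d → ℝ) → Set
IsSkew S = ∀ k l → S k l ≈ℝ -ℝ (S l k)

IsTrivial : ∀ {n d} → Configuration n d → Configuration n d → Set
IsTrivial {n} {d} p ṗ =
  Σ (Fin d → Fin d → ℝ) λ S → Σ (Point d) λ t →
    IsSkew S × (∀ i k → ṗ i k ≈ℝ (S k · p i) +ℝ t k)

InfinitesimallyRigid : ∀ {n d} → Graph n → Configuration n d → Set
InfinitesimallyRigid G p = ∀ ṗ → IsMotion G p ṗ → IsTrivial p ṗ

-- ℝ^d = ∏ᵢ ℝ^{aᵢ}: coordinate j of ℝ^d lies in the factor ℝ^{aᵢ} with
-- i = block a j (the factors are consecutive runs of coordinates).
block : ∀ {m} (a : Vec ℕ m) → Fin (Vec.sum a) → Fin m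
block (k ∷ a) j with splitAt k j
... | inj₁ _  = zero
... | inj₂ j′ = suc (block a j′)

-- x ∈ Hᵢ: the coordinates outside the i-th factor vanish.
InH : ∀ {m} (a : Vec ℕ m) → Fin m → Point (Vec.sum a) → Set
InH a i x = ∀ j → block a j ≢ i → x j ≈ℝ 0ℝ

IsSparse : ∀ {n m} → (Fin n → Fin m) → (a : Vec ℕ m) → Configuration n (Vec.sum a) → Set
IsSparse κ a p = ∀ v → InH a (κ v) (p v)

SparseRigid : ∀ {n m} → (Fin n → Fin m) → Vec ℕ m → Graph n → Set
SparseRigid {n} κ a G =
  Σ (Configuration n (Vec.sum a)) λ p → IsSparse κ a p × InfinitesimallyRigid G p

{-# OPTIONS --safe #-}
-- The vertex v is placed on the moment curve (s, s², …) of its factor H_κ(v).  The parameters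
-- are chosen one vertex at a time, and so large that a framework whose last vertex y would be
-- rigid in the limit where y slides onto an earlier vertex x of the same colour is rigid.
--
-- At such a placement, the skeleton of a minimal cycle c is rigid by induction on its largest
-- vertex y, following Fogelsanger.  Since every aᵢ ≥ 2, some facet contains an edge xy with
-- κ x = κ y.  The minimal subcycles of the contraction of c along xy are rigid by induction, and
-- each of them lifts to a rigid subgraph by a vertex split: the link of xy in the lifted piece
-- is a cycle, which provides d - 1 common neighbours of x and y in sufficiently general position.
-- An infinitesimal motion is thus trivial on each piece.  The pieces on which it agrees with one
-- given trivial motion form a chain, completed by faces K ∪ {x, y} to a subcycle of c
-- because pieces meeting in K ∪ {x, y} carry the same trivial motion; by minimality it is c.
--
-- The argument runs over ℚ and under double negation, which makes equality in Γ stable.  Its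
-- conclusion, that a linear system over ℚ has only the zero solution, is stable, and elimination
-- carries it over to ℝ: a real motion is a sequence of rational fields that solve the system up
-- to null sequences.
module Submission where

open import Algebra.Bundles using (AbelianGroup; CommutativeRing)
import Algebra.Properties.AbelianGroup as AbelianGroupProperties
import Algebra.Properties.CommutativeSemigroup as CommutativeSemigroupProperties
import Algebra.Properties.Semiring.Sum as SemiringSum
open import Data.Bool.Base using (Bool; true; false; if_then_else_; not; _∧_)
import Data.Bool.Properties as Bool
open import Data.Empty using (⊥; ⊥-elim)
open import Data.Fin.Base as Fin using (Fin; zero; suc; toℕ; splitAt; _↑ˡ_; _↑ʳ_; combine; remQuot)
import Data.Fin.Properties as Fin
open import Data.Fin.Subset using (Subset; _⊆_; _∩_; _∪_; ⁅_⁆; ∣_∣)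
import Data.Fin.Subset as Subset
import Data.Fin.Subset.Properties as Subset
open import Data.List.Base as List using (List; []; _∷_)
open import Data.List.Membership.Propositional using (_∈_; find; lose)
import Data.List.Membership.Propositional.Properties as List
open import Data.List.Relation.Unary.All as All using (All; []; _∷_)
import Data.List.Relation.Unary.All.Properties as All
open import Data.List.Relation.Unary.Any as Any using (Any; here; there)
import Data.List.Properties as List
import Data.List.Relation.Unary.Any.Properties as Any
open import Data.Maybe.Base using (Maybe; just; nothing)
open import Data.Nat.Base as ℕ using (ℕ; zero; suc; _≤_)
import Data.Nat.Properties as ℕ
open import Data.Nat.Coprimality using (1-coprimeTo)
import Data.Nat.Coprimality as Coprime
import Data.Integer.Base as ℤ
import Data.Integer.Properties as ℤ
open import Data.Product.Base using (Σ; ∃-syntax; _×_; _,_; proj₁; proj₂)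
open import Data.Rational.Base as ℚ using (ℚ; mkℚ; Positive; ½; 0ℚ; 1ℚ; _+_; _*_; -_; _-_)
import Data.Rational.Properties as ℚ
open import Data.Sum.Base using (_⊎_; inj₁; inj₂)
open import Data.Unit.Base using (⊤; tt)
open import Data.Vec.Base as Vec using (Vec; []; _∷_; lookup; sum; _[_]≔_)
import Data.Vec.Properties as Vec
open import Relation.Binary.Definitions using (tri<; tri≈; tri>)
open import Function.Base using (_∘_; case_of_)
open import Function.Bundles using (Equivalence)
open import Level using (Level; _⊔_)
open import Relation.Binary.PropositionalEquality
open import Relation.Nullary using (¬_; Dec; yes; no; does; contradiction)
open import Relation.Nullary.Decidable using (decidable-stable; ¬?; _×-dec_; dec-true; dec-false)
open import Tactic.RingSolver using (solve-∀)
open import Tactic.RingSolver.Core.AlmostCommutativeRing using (AlmostCommutativeRing; fromCommutativeRing)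
open import Defs

-- One placement has to serve every cycle met in the induction. This is possible because contraction
-- onto an earlier vertex removes the largest vertex y: the induction hypothesis speaks only of
-- vertices placed before y, and "large enough" for y means avoiding the zeros of finitely many
-- pivot polynomials, for each graph, vertex set, pin set and x. When y lies on x, the edge xy
-- degenerates. What survives of it is one equation along the tangent of the curve, and each common
-- neighbour w makes u y - u x orthogonal to p w - p x. As p w is confined to its factor, d
-- equations of this kind need not be independent: the colours of the neighbours matter, and
-- arranging them uses a_i ≥ 2 a second time. Contraction may also cancel two faces of c against
-- each other. No piece of the contracted cycle sees such a pair; its vertices form a split simplex,
-- which is rigid by itself.

private variable
  ℓ₁ ℓ₂ : Level
  A : Set ℓ₁
  B : Set ℓ₂

-- Double negation as a monad, and finite choice under it

infixl 1 _>>=_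
_>>=_ : ¬ ¬ A → (A → ¬ ¬ B) → ¬ ¬ B
(ma >>= f) k = ma λ a → f a k

return : A → ¬ ¬ A
return a k = k a

em : (A : Set ℓ₁) → ¬ ¬ (Dec A)
em A k = k (no λ a → k (yes a))

¬¬-Π-Fin : ∀ {n} {P : Fin n → Set ℓ₁} → (∀ i → ¬ ¬ P i) → ¬ ¬ (∀ i → P i)
¬¬-Π-Fin {n = zero} h = return λ ()
¬¬-Π-Fin {n = suc n} h = do
  p ← h zero
  q ← ¬¬-Π-Fin (h ∘ suc)
  return λ { zero → p ; (suc i) → q i }

¬¬-Π-Subset : ∀ {n} {P : Subset n → Set ℓ₁} → (∀ F → ¬ ¬ P F) → ¬ ¬ (∀ F → P F)
¬¬-Π-Subset {n = zero} h = do
  p ← h []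
  return λ { [] → p }
¬¬-Π-Subset {n = suc n} h = do
  p ← ¬¬-Π-Subset (h ∘ (true ∷_))
  q ← ¬¬-Π-Subset (h ∘ (false ∷_))
  return λ { (true ∷ F) → p F ; (false ∷ F) → q F }

Reflects : Bool → Set ℓ₁ → Set ℓ₁
Reflects b P = (b ≡ true → P) × (P → b ≡ true)

¬¬-reflects : (P : Set ℓ₁) → ¬ ¬ (∃[ b ] Reflects b P)
¬¬-reflects P = do
  yes p ← em P
    where no ¬p → return (false , (λ ()) , λ p → contradiction p ¬p)
  return (true , (λ _ → p) , λ _ → refl)

-- Equality in Γ is not decided, so the vertex sets and graphs of chains become data only under a
-- double negation.
¬¬-comprehension : ∀ {n} (P : Fin n → Set ℓ₁) → ¬ ¬ (Σ (Subset n) λ U → ∀ v → Reflects (lookup U v) (P v))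
¬¬-comprehension P = do
  f ← ¬¬-Π-Fin (λ v → ¬¬-reflects (P v))
  return (Vec.tabulate (proj₁ ∘ f) , λ v → subst (λ b → Reflects b (P v)) (sym (Vec.lookup∘tabulate (proj₁ ∘ f) v)) (proj₂ (f v)))

-- Finite sums and cancellation over the rationals

ℚ-ring : AlmostCommutativeRing _ _
ℚ-ring = fromCommutativeRing ℚ.+-*-commutativeRing λ x → isZero (x ℚ.≟ 0ℚ)
  where
  isZero : ∀ {x} → Dec (x ≡ 0ℚ) → Maybe (0ℚ ≡ x)
  isZero (yes p) = just (sym p)
  isZero (no _) = nothing

open SemiringSum (CommutativeRing.semiring ℚ.+-*-commutativeRing)
  public using (∑-comm; ∑-distrib-+; *-distribˡ-sum)
  renaming (sum to ∑; sum-cong-≗ to ∑-cong; sum-replicate-zero to ∑-replicate-zero)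

∑-zero : ∀ {n} {f : Fin n → ℚ} → (∀ i → f i ≡ 0ℚ) → ∑ f ≡ 0ℚ
∑-zero {n} h = trans (∑-cong h) (∑-replicate-zero n)

∑-*ˡ : ∀ {n} q (f : Fin n → ℚ) → q * ∑ f ≡ ∑ λ i → q * f i
∑-*ˡ = *-distribˡ-sum

∑-distrib-- : ∀ {n} (f g : Fin n → ℚ) → ∑ (λ i → f i - g i) ≡ ∑ f - ∑ g
∑-distrib-- f g = trans (∑-distrib-+ f (λ i → - g i)) (cong (∑ f +_) (begin
  ∑ (λ i → - g i) ≡⟨ ∑-cong (λ i → neg-mult (g i)) ⟩
  ∑ (λ i → (- 1ℚ) * g i) ≡⟨ ∑-*ˡ (- 1ℚ) g ⟨
  (- 1ℚ) * ∑ g ≡⟨ neg-mult (∑ g) ⟨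
  - ∑ g ∎))
  where
  open ≡-Reasoning
  neg-mult : ∀ q → - q ≡ (- 1ℚ) * q
  neg-mult = solve-∀ ℚ-ring

∑-single : ∀ {n} (f : Fin n → ℚ) i → (∀ j → j ≢ i → f j ≡ 0ℚ) → ∑ f ≡ f i
∑-single f zero h = trans (cong (f zero +_) (∑-zero λ j → h (suc j) λ ())) (ℚ.+-identityʳ (f zero))
∑-single f (suc i) h = trans (cong₂ _+_ (h zero λ ()) (∑-single (f ∘ suc) i λ j ne → h (suc j) (ne ∘ Fin.suc-injective)))
  (ℚ.+-identityˡ (f (suc i)))

∑-splitAt : ∀ k {l} (f : Fin (k ℕ.+ l) → ℚ) → ∑ f ≡ ∑ (λ i → f (i ↑ˡ l)) + ∑ (λ j → f (k ↑ʳ j))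
∑-splitAt zero f = sym (ℚ.+-identityˡ (∑ f))
∑-splitAt (suc k) f = trans (cong (f zero +_) (∑-splitAt k (f ∘ suc))) (sym (ℚ.+-assoc (f zero) _ _))

∑-combine : ∀ {n d} (f : Fin (n ℕ.* d) → ℚ) → ∑ f ≡ ∑ λ (v : Fin n) → ∑ λ (k : Fin d) → f (combine v k)
∑-combine {zero} f = refl
∑-combine {suc n} {d} f = trans (∑-splitAt d f) (cong (∑ (λ k → f (k ↑ˡ (n ℕ.* d))) +_) (∑-combine {n} (λ j → f (d ↑ʳ j))))

*-cancel-≢0 : ∀ {p q} → p ≢ 0ℚ → p * q ≡ 0ℚ → q ≡ 0ℚ
*-cancel-≢0 {p} {q} p≢0 e = begin
  q ≡⟨ ℚ.*-identityˡ q ⟨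
  1ℚ * q ≡⟨ cong (_* q) (ℚ.*-inverseˡ p) ⟨
  (ℚ.1/ p * p) * q ≡⟨ ℚ.*-assoc (ℚ.1/ p) p q ⟩
  ℚ.1/ p * (p * q) ≡⟨ cong (ℚ.1/ p *_) e ⟩
  ℚ.1/ p * 0ℚ ≡⟨ ℚ.*-zeroʳ (ℚ.1/ p) ⟩
  0ℚ ∎
  where
  open ≡-Reasoning
  instance _ = ℚ.≢-nonZero p≢0

p-q≡0⇒p≡q : ∀ p q → p - q ≡ 0ℚ → p ≡ q
p-q≡0⇒p≡q p q e = trans (split p q) (trans (cong (_+ q) e) (ℚ.+-identityˡ q))
  where
  split : ∀ p q → p ≡ (p - q) + q
  split = solve-∀ ℚ-ring

p≡q⇒p-q≡0 : ∀ {p q} → p ≡ q → p - q ≡ 0ℚ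
p≡q⇒p-q≡0 {p} refl = ℚ.+-inverseʳ p

-- Subsets and the change of one element

infix 4 _∋_ _∌_
-- A record around the equation, so that `F` and `v` are recovered by unification where they are
-- implicit.
record _∋_ {n} (F : Subset n) (v : Fin n) : Set where
  constructor ∋⟨_⟩
  field ∋-eq : lookup F v ≡ true
open _∋_ public

record _∌_ {n} (F : Subset n) (v : Fin n) : Set where
  constructor ∌⟨_⟩
  field ∌-eq : lookup F v ≡ false
open _∌_ public

add del : ∀ {n} → Fin n → Subset n → Subset n
add v F = F [ v ]≔ true
del v F = F [ v ]≔ false

∋⊎∌ : ∀ {n} (F : Subset n) v → F ∋ v ⊎ F ∌ v
∋⊎∌ F v with lookup F v in eq
... | true = inj₁ ∋⟨ eq ⟩
... | false = inj₂ ∌⟨ eq ⟩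

∋-∌-contradiction : ∀ {n} {F : Subset n} {v} {ℓ} {W : Set ℓ} → F ∋ v → F ∌ v → W
∋-∌-contradiction ∋⟨ p ⟩ ∌⟨ q ⟩ with () ← trans (sym p) q

¬∋⇒∌ : ∀ {n} {F : Subset n} {v} → ¬ F ∋ v → F ∌ v
¬∋⇒∌ {F = F} {v} h with ∋⊎∌ F v
... | inj₁ p = contradiction p h
... | inj₂ q = q

∋-∌-≢ : ∀ {n} {F : Subset n} {u v} → F ∋ u → F ∌ v → u ≢ v
∋-∌-≢ p q refl = ∋-∌-contradiction p q

module _ {n : ℕ} where
  add-self : ∀ v (F : Subset n) → add v F ∋ v
  add-self v F = ∋⟨ Vec.lookup∘updateAt v F ⟩

  del-self : ∀ v (F : Subset n) → del v F ∌ v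
  del-self v F = ∌⟨ Vec.lookup∘updateAt v F ⟩

  add-∋ : ∀ {F : Subset n} {u} v → F ∋ u → add v F ∋ u
  add-∋ {F} {u} v p with u Fin.≟ v
  ... | yes refl = add-self v F
  ... | no ne = ∋⟨ trans (Vec.lookup∘updateAt′ u v ne F) (∋-eq p) ⟩

  add-∋⁻ : ∀ {F : Subset n} {u v} → u ≢ v → add v F ∋ u → F ∋ u
  add-∋⁻ {F} {u} {v} ne p = ∋⟨ trans (sym (Vec.lookup∘updateAt′ u v ne F)) (∋-eq p) ⟩

  add-∌ : ∀ {F : Subset n} {u v} → u ≢ v → F ∌ u → add v F ∌ u
  add-∌ {F} {u} {v} ne p = ∌⟨ trans (Vec.lookup∘updateAt′ u v ne F) (∌-eq p) ⟩

  add-∌⁻ : ∀ {F : Subset n} {u v} → add v F ∌ u → F ∌ u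
  add-∌⁻ {v = v} p = ¬∋⇒∌ λ q → ∋-∌-contradiction (add-∋ v q) p

  del-∌ : ∀ {F : Subset n} {u} v → F ∌ u → del v F ∌ u
  del-∌ {F} {u} v p with u Fin.≟ v
  ... | yes refl = del-self v F
  ... | no ne = ∌⟨ trans (Vec.lookup∘updateAt′ u v ne F) (∌-eq p) ⟩

  del-∋ : ∀ {F : Subset n} {u v} → u ≢ v → F ∋ u → del v F ∋ u
  del-∋ {F} {u} {v} ne p = ∋⟨ trans (Vec.lookup∘updateAt′ u v ne F) (∋-eq p) ⟩

  del-∋⁻ : ∀ {F : Subset n} {u v} → del v F ∋ u → u ≢ v × F ∋ u
  del-∋⁻ {F} {u} {v} p = ∋-∌-≢ p (del-self v F) , ne-∋ (∋-∌-≢ p (del-self v F))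
    where
    ne-∋ : u ≢ v → F ∋ u
    ne-∋ ne = ∋⟨ trans (sym (Vec.lookup∘updateAt′ u v ne F)) (∋-eq p) ⟩

  add-del : ∀ {F : Subset n} {v} → F ∋ v → add v (del v F) ≡ F
  add-del {F} {v} p = trans (Vec.[]≔-idempotent F v) (trans (cong (F [ v ]≔_) (sym (∋-eq p))) (Vec.[]≔-lookup F v))

  del-add : ∀ {F : Subset n} {v} → F ∌ v → del v (add v F) ≡ F
  del-add {F} {v} p = trans (Vec.[]≔-idempotent F v) (trans (cong (F [ v ]≔_) (sym (∌-eq p))) (Vec.[]≔-lookup F v))

𝟙 : Bool → ℕ
𝟙 true = 1
𝟙 false = 0

∣add∩∣ : ∀ {n} (F Q : Subset n) v → F ∌ v → ∣ add v F ∩ Q ∣ ≡ 𝟙 (lookup Q v) ℕ.+ ∣ F ∩ Q ∣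
∣add∩∣ (false ∷ F) (true ∷ Q) zero p = refl
∣add∩∣ (false ∷ F) (false ∷ Q) zero p = refl
∣add∩∣ (true ∷ F) (true ∷ Q) (suc v) ∌⟨ p ⟩ = trans (cong suc (∣add∩∣ F Q v ∌⟨ p ⟩)) (sym (ℕ.+-suc _ _))
∣add∩∣ (true ∷ F) (false ∷ Q) (suc v) ∌⟨ p ⟩ = ∣add∩∣ F Q v ∌⟨ p ⟩
∣add∩∣ (false ∷ F) (_ ∷ Q) (suc v) ∌⟨ p ⟩ = ∣add∩∣ F Q v ∌⟨ p ⟩

∣add∣ : ∀ {n} (F : Subset n) v → F ∌ v → ∣ add v F ∣ ≡ suc ∣ F ∣
∣add∣ (false ∷ F) zero p = refl
∣add∣ (true ∷ F) (suc v) ∌⟨ p ⟩ = cong suc (∣add∣ F v ∌⟨ p ⟩)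
∣add∣ (false ∷ F) (suc v) ∌⟨ p ⟩ = ∣add∣ F v ∌⟨ p ⟩

∣del∣ : ∀ {n} {F : Subset n} {v} → F ∋ v → ∣ F ∣ ≡ suc ∣ del v F ∣
∣del∣ {F = F} {v} p = trans (cong ∣_∣ (sym (add-del p))) (∣add∣ (del v F) v (del-self v F))

∣∣>0⇒∋ : ∀ {n} (F : Subset n) → 1 ≤ ∣ F ∣ → ∃[ v ] F ∋ v
∣∣>0⇒∋ (true ∷ F) h = zero , ∋⟨ refl ⟩
∣∣>0⇒∋ (false ∷ F) h = let v , ∋⟨ p ⟩ = ∣∣>0⇒∋ F h in suc v , ∋⟨ p ⟩

∋-∩⁻ : ∀ {n} (F Q : Subset n) v → F ∩ Q ∋ v → F ∋ v × Q ∋ v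
∋-∩⁻ (true ∷ F) (true ∷ Q) zero p = ∋⟨ refl ⟩ , ∋⟨ refl ⟩
∋-∩⁻ (_ ∷ F) (_ ∷ Q) (suc v) ∋⟨ p ⟩ with ∋⟨ q ⟩ , ∋⟨ r ⟩ ← ∋-∩⁻ F Q v ∋⟨ p ⟩ = ∋⟨ q ⟩ , ∋⟨ r ⟩

-- Polynomials in one variable, as coefficient sequences with the constant term first.

ev : ∀ {k} → (Fin k → ℚ) → ℚ → ℚ
ev {zero} f t = 0ℚ
ev {suc k} f t = f zero + t * ev (f ∘ suc) t

-- The quotient of f by X - r.
dv : ∀ {k} → ℚ → (Fin (suc k) → ℚ) → Fin k → ℚ
dv r f zero = ev (f ∘ suc) r
dv r f (suc j) = dv r (f ∘ suc) j

ev-dv : ∀ {k} r t (f : Fin (suc k) → ℚ) → (t - r) * ev (dv r f) t ≡ ev f t - ev f r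
ev-dv {zero} r t f = eq (f zero) r t
  where
  eq : ∀ a r t → (t - r) * 0ℚ ≡ (a + t * 0ℚ) - (a + r * 0ℚ)
  eq = solve-∀ ℚ-ring
ev-dv {suc k} r t f = begin
  (t - r) * (ev g r + t * ev (dv r g) t) ≡⟨ eq₁ r t (ev g r) (ev (dv r g) t) ⟩
  (t - r) * ev g r + t * ((t - r) * ev (dv r g) t) ≡⟨ cong (λ z → (t - r) * ev g r + t * z) (ev-dv r t g) ⟩
  (t - r) * ev g r + t * (ev g t - ev g r) ≡⟨ eq₂ (f zero) r t (ev g r) (ev g t) ⟩
  (f zero + t * ev g t) - (f zero + r * ev g r) ∎
  where
  open ≡-Reasoning
  g = f ∘ suc
  eq₁ : ∀ r t a b → (t - r) * (a + t * b) ≡ (t - r) * a + t * ((t - r) * b)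
  eq₁ = solve-∀ ℚ-ring
  eq₂ : ∀ c r t a b → (t - r) * a + t * (b - a) ≡ (c + t * b) - (c + r * a)
  eq₂ = solve-∀ ℚ-ring

-- Division with remainder: f = (X - r) q + f(r), so f is zero when quotient and remainder are.
dv≡0⇒≡0 : ∀ {k} r (f : Fin (suc k) → ℚ) → (∀ j → dv r f j ≡ 0ℚ) → ev f r ≡ 0ℚ → ∀ j → f j ≡ 0ℚ
dv≡0⇒≡0 {zero} r f d e zero = trans (eq (f zero) r) e
  where
  eq : ∀ a r → a ≡ a + r * 0ℚ
  eq = solve-∀ ℚ-ring
dv≡0⇒≡0 {suc k} r f d e zero = begin
  f zero ≡⟨ eq (f zero) r ⟩
  f zero + r * 0ℚ ≡⟨ cong (λ z → f zero + r * z) (d zero) ⟨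
  f zero + r * ev (f ∘ suc) r ≡⟨ e ⟩
  0ℚ ∎
  where
  open ≡-Reasoning
  eq : ∀ a r → a ≡ a + r * 0ℚ
  eq = solve-∀ ℚ-ring
dv≡0⇒≡0 {suc k} r f d e (suc j) = dv≡0⇒≡0 r (f ∘ suc) (d ∘ suc) (d zero) j

InjectiveOn : ∀ {n} → Subset n → (Fin n → ℚ) → Set
InjectiveOn R t = ∀ {u v} → R ∋ u → R ∋ v → t u ≡ t v → u ≡ v

dv-root : ∀ {k} r t (f : Fin (suc k) → ℚ) → t ≢ r → ev f t ≡ ev f r → ev (dv r f) t ≡ 0ℚ
dv-root r t f t≢r e = *-cancel-≢0 (t≢r ∘ p-q≡0⇒p≡q t r) (trans (ev-dv r t f) (p≡q⇒p-q≡0 e))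

-- One root r is divided out; the quotient has one coefficient fewer and vanishes at the remaining
-- points, as their parameters differ from that of r.
vanishes : ∀ {n k} (t : Fin n → ℚ) (R : Subset n) → InjectiveOn R t → (f : Fin k → ℚ) → k ≤ ∣ R ∣ →
           (∀ v → R ∋ v → ev f (t v) ≡ 0ℚ) → ∀ j → f j ≡ 0ℚ
vanishes {k = zero} t R inj f h z ()
vanishes {k = suc k} t R inj f h z =
  let r , r∈R = ∣∣>0⇒∋ R (ℕ.≤-trans (ℕ.s≤s ℕ.z≤n) h)
      old : ∀ {v} → del r R ∋ v → v ≢ r × R ∋ v
      old = del-∋⁻
  in dv≡0⇒≡0 (t r) f
       (vanishes t (del r R) (λ p q → inj (proj₂ (old p)) (proj₂ (old q))) (dv (t r) f)
         (ℕ.s≤s⁻¹ (subst (suc k ≤_) (∣del∣ r∈R) h))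
         λ v p → dv-root (t r) (t v) f (λ e → proj₁ (old p) (inj (proj₂ (old p)) r∈R e))
           (trans (z v (proj₂ (old p))) (sym (z r r∈R))))
       (z r r∈R)

-- Polynomial functions at large integers

Eventually : ∀ {ℓ} → (ℕ → Set ℓ) → Set ℓ
Eventually P = ∃[ N ] ∀ s → N ≤ s → P s

module _ {P Q : ℕ → Set} where
  ev-map : (∀ s → P s → Q s) → Eventually P → Eventually Q
  ev-map f (N , p) = N , λ s h → f s (p s h)

  ev-× : Eventually P → Eventually Q → Eventually (λ s → P s × Q s)
  ev-× (N , p) (M , q) = N ℕ.⊔ M , λ s h → p s (ℕ.m⊔n≤o⇒m≤o N M h) , q s (ℕ.m⊔n≤o⇒n≤o N M h)

ι : ℕ → ℚ
ι s = mkℚ (ℤ.+ s) 0 (Coprime.sym (1-coprimeTo s))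

ι-injective : ∀ {s u} → ι s ≡ ι u → s ≡ u
ι-injective e = ℤ.+-injective (cong ℚ.numerator e)

ι-mono : ∀ {s u} → s ≤ u → ι s ℚ.≤ ι u
ι-mono {s} {u} h = ℚ.*≤* (subst₂ ℤ._≤_ (sym (ℤ.*-identityʳ (ℤ.+ s))) (sym (ℤ.*-identityʳ (ℤ.+ u))) (ℤ.+≤+ h))

archimedean : ∀ q → ∃[ N ] q ℚ.≤ ι N
archimedean q@(mkℚ n d c) = ℤ.∣ n ∣ , ℚ.*≤* (begin
  n ℤ.* ℤ.1ℤ ≡⟨ ℤ.*-identityʳ n ⟩
  n ≤⟨ i≤∣i∣ n ⟩
  ℤ.+ ℤ.∣ n ∣ ≤⟨ ℤ.+≤+ (ℕ.m≤m*n ℤ.∣ n ∣ (suc d)) ⟩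
  ℤ.+ (ℤ.∣ n ∣ ℕ.* suc d) ≡⟨ ℤ.pos-* ℤ.∣ n ∣ (suc d) ⟩
  ℤ.+ ℤ.∣ n ∣ ℤ.* ℤ.+ suc d ∎)
  where
  open ℤ.≤-Reasoning
  i≤∣i∣ : ∀ i → i ℤ.≤ ℤ.+ ℤ.∣ i ∣
  i≤∣i∣ (ℤ.+ _) = ℤ.≤-refl
  i≤∣i∣ (ℤ.-[1+ _ ]) = ℤ.-≤+

evL : List ℚ → ℚ → ℚ
evL [] t = 0ℚ
evL (a ∷ f) t = a + t * evL f t

IsPoly : (ℚ → ℚ) → Set
IsPoly f = Σ (List ℚ) λ c → ∀ t → f t ≡ evL c t

const-poly : ∀ q → IsPoly (λ _ → q)
const-poly q = q ∷ [] , λ t → eq q t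
  where
  eq : ∀ q t → q ≡ q + t * 0ℚ
  eq = solve-∀ ℚ-ring

+-poly : ∀ {f g} → IsPoly f → IsPoly g → IsPoly (λ t → f t + g t)
+-poly (c , p) (e , q) = addL c e , λ t → trans (cong₂ _+_ (p t) (q t)) (addL-ev c e t)
  where
  addL : List ℚ → List ℚ → List ℚ
  addL [] e = e
  addL (a ∷ c) [] = a ∷ c
  addL (a ∷ c) (b ∷ e) = a + b ∷ addL c e
  eq : ∀ a b t x y → (a + t * x) + (b + t * y) ≡ (a + b) + t * (x + y)
  eq = solve-∀ ℚ-ring
  addL-ev : ∀ c e t → evL c t + evL e t ≡ evL (addL c e) t
  addL-ev [] e t = ℚ.+-identityˡ (evL e t)
  addL-ev (a ∷ c) [] t = ℚ.+-identityʳ _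
  addL-ev (a ∷ c) (b ∷ e) t = trans (eq a b t (evL c t) (evL e t)) (cong (λ z → (a + b) + t * z) (addL-ev c e t))

scale-poly : ∀ {f} q → IsPoly f → IsPoly (λ t → q * f t)
scale-poly {f} q (c , p) = List.map (q *_) c , λ t → trans (cong (q *_) (p t)) (go c t)
  where
  eq : ∀ q a t x → q * (a + t * x) ≡ q * a + t * (q * x)
  eq = solve-∀ ℚ-ring
  go : ∀ c t → q * evL c t ≡ evL (List.map (q *_) c) t
  go [] t = ℚ.*-zeroʳ q
  go (a ∷ c) t = trans (eq q a t (evL c t)) (cong (λ z → q * a + t * z) (go c t))

shift-poly : ∀ {f} → IsPoly f → IsPoly (λ t → t * f t)
shift-poly {f} (c , p) = 0ℚ ∷ c , λ t → trans (cong (t *_) (p t)) (sym (ℚ.+-identityˡ _))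

poly-cong : ∀ {f g} → (∀ t → g t ≡ f t) → IsPoly f → IsPoly g
poly-cong e (c , p) = c , λ t → trans (e t) (p t)

*-poly : ∀ {f g} → IsPoly f → IsPoly g → IsPoly (λ t → f t * g t)
*-poly {f} {g} (c , p) G = poly-cong (λ t → cong (_* g t) (p t)) (go c)
  where
  eq : ∀ a t x y → (a + t * x) * y ≡ a * y + t * (x * y)
  eq = solve-∀ ℚ-ring
  go : ∀ c → IsPoly (λ t → evL c t * g t)
  go [] = poly-cong (λ t → ℚ.*-zeroˡ (g t)) (const-poly 0ℚ)
  go (a ∷ c) = poly-cong (λ t → eq a t (evL c t) (g t)) (+-poly (scale-poly a G) (shift-poly (go c)))

neg-poly : ∀ {f} → IsPoly f → IsPoly (λ t → - f t)
neg-poly {f} F = poly-cong (λ t → eq (f t)) (scale-poly (- 1ℚ) F)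
  where
  eq : ∀ a → - a ≡ (- 1ℚ) * a
  eq = solve-∀ ℚ-ring

sub-poly : ∀ {f g} → IsPoly f → IsPoly g → IsPoly (λ t → f t - g t)
sub-poly F G = +-poly F (neg-poly G)

∑-poly : ∀ {n} {f : Fin n → ℚ → ℚ} → (∀ i → IsPoly (f i)) → IsPoly (λ t → ∑ λ i → f i t)
∑-poly {zero} h = const-poly 0ℚ
∑-poly {suc n} h = +-poly (h zero) (∑-poly (h ∘ suc))

p+r≤q+r⇒p≤q : ∀ {p q} r → p + r ℚ.≤ q + r → p ℚ.≤ q
p+r≤q+r⇒p≤q {p} {q} r h = subst₂ ℚ._≤_ (eq p r) (eq q r) (ℚ.+-monoˡ-≤ (- r) h)
  where
  eq : ∀ p r → (p + r) + - r ≡ p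
  eq = solve-∀ ℚ-ring

-- The lower bound q, stronger than being nonzero, is what the induction needs: if the tail stays at
-- least q in absolute value, then t times the tail outgrows the constant term a.
zero-or-large : ∀ c → (∀ t → evL c t ≡ 0ℚ) ⊎
  (∃[ q ] Positive q × Eventually (λ s → q ℚ.≤ ℚ.∣ evL c (ι s) ∣))
zero-or-large [] = inj₁ λ _ → refl
zero-or-large (a ∷ c) with zero-or-large c
... | inj₁ z with a ℚ.≟ 0ℚ
... | yes refl = inj₁ λ t → trans (cong (λ w → 0ℚ + t * w) (z t)) (eq t)
  where
  eq : ∀ t → 0ℚ + t * 0ℚ ≡ 0ℚ
  eq = solve-∀ ℚ-ring
... | no a≢0 = inj₂ (ℚ.∣ a ∣ , ℚ.nonNeg∧nonZero⇒pos ℚ.∣ a ∣ {{ℚ.∣-∣-nonNeg a}} {{ℚ.≢-nonZero (a≢0 ∘ ℚ.∣p∣≡0⇒p≡0 a)}} ,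
  0 , λ s _ → ℚ.≤-reflexive (cong ℚ.∣_∣ (trans (eq a (ι s)) (cong (λ w → a + ι s * w) (sym (z (ι s)))))))
  where
  eq : ∀ a t → a ≡ a + t * 0ℚ
  eq = solve-∀ ℚ-ring
zero-or-large (a ∷ c) | inj₂ (q , q>0 , N , large) =
  let instance _ = q>0
               _ = ℚ.pos⇒nonZero q
      -- For s ≥ w the term s · tail has absolute value at least q + |a|, which leaves q after a is
      -- added.
      w = (q + ℚ.∣ a ∣) * ℚ.1/ q
      M , w≤M = archimedean w
  in inj₂ (q , q>0 , N ℕ.⊔ M , λ s h → p+r≤q+r⇒p≤q ℚ.∣ a ∣ (begin
    q + ℚ.∣ a ∣ ≡⟨ ℚ.*-identityʳ _ ⟨
    (q + ℚ.∣ a ∣) * 1ℚ ≡⟨ cong ((q + ℚ.∣ a ∣) *_) (ℚ.*-inverseˡ q) ⟨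
    (q + ℚ.∣ a ∣) * (ℚ.1/ q * q) ≡⟨ ℚ.*-assoc (q + ℚ.∣ a ∣) (ℚ.1/ q) q ⟨
    w * q ≤⟨ ℚ.*-monoʳ-≤-nonNeg q {{ℚ.pos⇒nonNeg q}} (ℚ.≤-trans w≤M (ι-mono (ℕ.m⊔n≤o⇒n≤o N M h))) ⟩
    ι s * q ≤⟨ ℚ.*-monoˡ-≤-nonNeg (ι s) (large s (ℕ.m⊔n≤o⇒m≤o N M h)) ⟩
    ι s * ℚ.∣ evL c (ι s) ∣ ≡⟨ cong (_* ℚ.∣ evL c (ι s) ∣) (ℚ.0≤p⇒∣p∣≡p {ι s} (ℚ.nonNegative⁻¹ (ι s))) ⟨
    ℚ.∣ ι s ∣ * ℚ.∣ evL c (ι s) ∣ ≡⟨ ℚ.∣p*q∣≡∣p∣*∣q∣ (ι s) (evL c (ι s)) ⟨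
    ℚ.∣ ι s * evL c (ι s) ∣ ≡⟨ cong ℚ.∣_∣ (eq a (ι s * evL c (ι s))) ⟩
    ℚ.∣ (a + ι s * evL c (ι s)) + - a ∣ ≤⟨ ℚ.∣p+q∣≤∣p∣+∣q∣ (a + ι s * evL c (ι s)) (- a) ⟩
    ℚ.∣ a + ι s * evL c (ι s) ∣ + ℚ.∣ - a ∣ ≡⟨ cong (ℚ.∣ a + ι s * evL c (ι s) ∣ +_) (ℚ.∣-p∣≡∣p∣ a) ⟩
    ℚ.∣ a + ι s * evL c (ι s) ∣ + ℚ.∣ a ∣ ∎))
  where
  open ℚ.≤-Reasoning
  eq : ∀ a x → x ≡ (a + x) + - a
  eq = solve-∀ ℚ-ring

eventually-≢0 : ∀ {f} → IsPoly f → ∀ t₀ → f t₀ ≢ 0ℚ → Eventually (λ s → f (ι s) ≢ 0ℚ)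
eventually-≢0 {f} (c , p) t₀ ne with zero-or-large c
... | inj₁ z = contradiction (trans (p t₀) (z t₀)) ne
... | inj₂ (q , q>0 , N , large) = N , λ s h e →
  ℚ.<-irrefl refl (ℚ.<-≤-trans (ℚ.positive⁻¹ q {{q>0}}) (ℚ.≤-trans (large s h) (ℚ.≤-reflexive (cong ℚ.∣_∣ (trans (sym (p (ι s))) e)))))

-- Gaussian elimination

Row : ℕ → Set
Row N = Fin N → ℚ

app : ∀ {N} → Row N → (Fin N → ℚ) → ℚ
app r x = ∑ λ j → r j * x j

Inj : ∀ {N} → List (Row N) → Set
Inj A = ∀ x → All (λ r → app r x ≡ 0ℚ) A → ∀ j → x j ≡ 0ℚ

eliminate : ∀ {N} → Row (suc N) → Row (suc N) → Row N
eliminate r q j = r zero * q (suc j) - q zero * r (suc j)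

app-eliminate : ∀ {N} (r q : Row (suc N)) x →
  app (eliminate r q) x ≡ r zero * app (q ∘ suc) x - q zero * app (r ∘ suc) x
app-eliminate r q x = begin
  ∑ (λ j → (r zero * q (suc j) - q zero * r (suc j)) * x j)
    ≡⟨ ∑-cong (λ j → eq (r zero) (q (suc j)) (q zero) (r (suc j)) (x j)) ⟩
  ∑ (λ j → r zero * (q (suc j) * x j) - q zero * (r (suc j) * x j))
    ≡⟨ ∑-distrib-- (λ j → r zero * (q (suc j) * x j)) (λ j → q zero * (r (suc j) * x j)) ⟩
  ∑ (λ j → r zero * (q (suc j) * x j)) - ∑ (λ j → q zero * (r (suc j) * x j))
    ≡⟨ cong₂ _-_ (∑-*ˡ (r zero) (λ j → q (suc j) * x j)) (∑-*ˡ (q zero) (λ j → r (suc j) * x j)) ⟨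
  r zero * app (q ∘ suc) x - q zero * app (r ∘ suc) x ∎
  where
  open ≡-Reasoning
  eq : ∀ a b c d x → (a * b - c * d) * x ≡ a * (b * x) - c * (d * x)
  eq = solve-∀ ℚ-ring

-- Back substitution: a solution of the reduced system extends by the first coordinate that solves
-- the pivot row, and then solves every row.
Inj-eliminate : ∀ {N} (A : List (Row (suc N))) r → r zero ≢ 0ℚ → Inj A → Inj (List.map (eliminate r) A)
Inj-eliminate A r r≢0 inj x h j = inj x⁺ (All.map (λ {q} → solved {q}) (All.map⁻ h)) (suc j)
  where
  instance _ = ℚ.≢-nonZero r≢0
  x⁺ : Fin _ → ℚ
  x⁺ zero = - (ℚ.1/ (r zero) * app (r ∘ suc) x)
  x⁺ (suc j) = x j
  eq₁ : ∀ i r q a b → q * - (i * b) + a ≡ i * (r * a - q * b) + (1ℚ - i * r) * a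
  eq₁ = solve-∀ ℚ-ring
  eq₂ : ∀ i a → i * 0ℚ + (1ℚ - 1ℚ) * a ≡ 0ℚ
  eq₂ = solve-∀ ℚ-ring
  solved : ∀ {q} → app (eliminate r q) x ≡ 0ℚ → app q x⁺ ≡ 0ℚ
  solved {q} e = trans (eq₁ (ℚ.1/ (r zero)) (r zero) (q zero) (app (q ∘ suc) x) (app (r ∘ suc) x))
    (trans (cong₂ (λ z w → ℚ.1/ (r zero) * z + (1ℚ - w) * app (q ∘ suc) x)
                  (trans (sym (app-eliminate r q x)) e) (ℚ.*-inverseˡ (r zero)))
           (eq₂ (ℚ.1/ (r zero)) (app (q ∘ suc) x)))

-- If the first column is zero, the first unit vector lies in the kernel.
no-pivot : ∀ {N} (A : List (Row (suc N))) → ¬ Any (λ r → r zero ≢ 0ℚ) A → ¬ Inj A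
no-pivot A np inj = case inj e₀ (All.tabulate kills) zero of λ ()
  where
  e₀ : Fin _ → ℚ
  e₀ zero = 1ℚ
  e₀ (suc _) = 0ℚ
  kills : ∀ {r} → r ∈ A → app r e₀ ≡ 0ℚ
  kills {r} r∈A = cong₂ _+_
    (trans (ℚ.*-identityʳ (r zero)) (decidable-stable (r zero ℚ.≟ 0ℚ) λ ne → np (lose r∈A ne)))
    (∑-zero λ j → ℚ.*-zeroʳ (r (suc j)))

-- An elimination step also transfers smallness of all equations to smallness
-- of all unknowns, for sequences of vectors: Z is "identically zero" or "null".
record IsSmallness (Z : (ℕ → ℚ) → Set) : Set where
  field
    small-0 : Z (λ _ → 0ℚ)
    small-+ : ∀ {f g} → Z f → Z g → Z (λ n → f n + g n)
    small-* : ∀ q {f} → Z f → Z (λ n → q * f n)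
    small-cong : ∀ {f g} → (∀ n → f n ≡ g n) → Z f → Z g

module _ {Z : (ℕ → ℚ) → Set} (isZ : IsSmallness Z) where
  open IsSmallness isZ

  small-app : ∀ {N} (q : Row N) (x : Fin N → ℕ → ℚ) → (∀ j → Z (x j)) → Z (λ n → app q (λ j → x j n))
  small-app {zero} q x h = small-0
  small-app {suc N} q x h = small-+ (small-* (q zero) (h zero)) (small-app (q ∘ suc) (x ∘ suc) (h ∘ suc))

  small-uneliminate : ∀ {N} (A : List (Row (suc N))) r → r ∈ A → r zero ≢ 0ℚ →
    (∀ x → All (λ q → Z (λ n → app q (λ j → x j n))) (List.map (eliminate r) A) → ∀ j → Z (x j)) →
    ∀ x → All (λ q → Z (λ n → app q (λ j → x j n))) A → ∀ j → Z (x j)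
  small-uneliminate A r r∈A r≢0 ih x h = λ { zero → head ; (suc j) → tail j }
    where
    instance _ = ℚ.≢-nonZero r≢0
    r-small = All.lookup h r∈A
    eq : ∀ r q x a b → r * (q * x + a) + (- q) * (r * x + b) ≡ r * a - q * b
    eq = solve-∀ ℚ-ring
    eq′ : ∀ r x a → (r * x + a) + (- 1ℚ) * a ≡ r * x
    eq′ = solve-∀ ℚ-ring
    tail : ∀ j → Z (x (suc j))
    tail = ih (x ∘ suc) (All.map⁺ (All.map (λ {q} qz → small-cong
      (λ n → trans (eq (r zero) (q zero) (x zero n) _ _) (sym (app-eliminate r q (λ j → x (suc j) n))))
      (small-+ (small-* (r zero) qz) (small-* (- q zero) r-small))) h))
    head : Z (x zero)
    head = small-cong
      (λ n → trans (cong (ℚ.1/ (r zero) *_) (eq′ (r zero) (x zero n) _))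
        (trans (sym (ℚ.*-assoc (ℚ.1/ (r zero)) (r zero) (x zero n)))
          (trans (cong (_* x zero n) (ℚ.*-inverseˡ (r zero))) (ℚ.*-identityˡ (x zero n)))))
      (small-* (ℚ.1/ (r zero)) (small-+ r-small (small-* (- 1ℚ) (small-app (r ∘ suc) (x ∘ suc) tail))))

  small-transfer : ∀ {N} (A : List (Row N)) → Inj A →
    ∀ x → All (λ q → Z (λ n → app q (λ j → x j n))) A → ∀ j → Z (x j)
  small-transfer {zero} A inj x h ()
  small-transfer {suc N} A inj with Any.any? (λ r → ¬? (r zero ℚ.≟ 0ℚ)) A
  ... | yes p = let r , r∈A , r≢0 = find p in
    small-uneliminate A r r∈A r≢0 (small-transfer (List.map (eliminate r) A) (Inj-eliminate A r r≢0 inj))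
  ... | no np = ⊥-elim (no-pivot A np inj)

constantly-zero : IsSmallness (λ f → f 0 ≡ 0ℚ)
constantly-zero = record
  { small-0 = refl
  ; small-+ = λ p q → cong₂ _+_ p q
  ; small-* = λ q p → trans (cong (q *_) p) (ℚ.*-zeroʳ q)
  ; small-cong = λ e p → trans (sym (e 0)) p
  }

Inj-uneliminate : ∀ {N} (A : List (Row (suc N))) r → r ∈ A → r zero ≢ 0ℚ → Inj (List.map (eliminate r) A) → Inj A
Inj-uneliminate A r r∈A r≢0 inj x h = small-uneliminate constantly-zero A r r∈A r≢0
  (λ y → inj (λ j → y j 0)) (λ j _ → x j) h

PolyRow : ℕ → Set
PolyRow N = Σ (Fin N → ℚ → ℚ) λ α → ∀ j → IsPoly (α j)

infixl 9 _at_
_at_ : ∀ {N} → PolyRow N → ℚ → Row N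
(α , _) at t = λ j → α j t

eliminateₚ : ∀ {N} → PolyRow (suc N) → PolyRow (suc N) → PolyRow N
eliminateₚ (r , R) (q , Q) =
  (λ j t → r zero t * q (suc j) t - q zero t * r (suc j) t) ,
  λ j → sub-poly (*-poly (R zero) (Q (suc j))) (*-poly (Q zero) (R (suc j)))

-- Elimination at t₀ and at s runs with the same pivot rows: a pivot entry nonzero at t₀ is a
-- nonzero polynomial, hence nonzero at all large integers. The premise at t₀ stays inside
-- `Eventually` because the bound on s comes from the pivots alone.
Inj-open : ∀ {N} (A : List (PolyRow N)) t₀ →
  Eventually λ s → Inj (List.map (_at t₀) A) → Inj (List.map (_at ι s) A)
Inj-open {zero} A t₀ = 0 , λ _ _ _ _ _ ()
Inj-open {suc N} A t₀ with Any.any? (λ r → ¬? (proj₁ r zero t₀ ℚ.≟ 0ℚ)) A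
... | no np = 0 , λ s _ inj → ⊥-elim (no-pivot (List.map (_at t₀) A) (np ∘ Any.map⁻) inj)
... | yes p = let r , r∈A , r≢0 = find p in
  ev-map (λ s (step , r≢0′) inj →
      Inj-uneliminate (List.map (_at ι s) A) (r at ι s) (List.∈-map⁺ (_at ι s) r∈A) r≢0′
        (subst Inj (commute r (ι s)) (step (subst Inj (sym (commute r t₀)) (Inj-eliminate (List.map (_at t₀) A) (r at t₀) r≢0 inj)))))
    (ev-× (Inj-open (List.map (eliminateₚ r) A) t₀) (eventually-≢0 (proj₂ r zero) t₀ r≢0))
  where
  commute : ∀ r t → List.map (_at t) (List.map (eliminateₚ r) A) ≡ List.map (eliminate (r at t)) (List.map (_at t) A)
  commute r t = trans (sym (List.map-∘ A)) (List.map-∘ A)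

module _ {N : ℕ} where
  app-comm : ∀ (e x : Row N) → app e x ≡ app x e
  app-comm e x = ∑-cong λ j → ℚ.*-comm (e j) (x j)

  app-cong : ∀ {e e′ x x′ : Row N} → (∀ j → e j ≡ e′ j) → (∀ j → x j ≡ x′ j) → app e x ≡ app e′ x′
  app-cong p q = ∑-cong λ j → cong₂ _*_ (p j) (q j)

  app-congʳ : ∀ (e : Row N) {x x′} → (∀ j → x j ≡ x′ j) → app e x ≡ app e x′
  app-congʳ e = app-cong {e} {e} (λ _ → refl)

  app-zeroˡ : ∀ {e : Row N} x → (∀ j → e j ≡ 0ℚ) → app e x ≡ 0ℚ
  app-zeroˡ x h = ∑-zero λ j → trans (cong (_* x j) (h j)) (ℚ.*-zeroˡ (x j))

  app-+ˡ : ∀ (e f x : Row N) → app (λ j → e j + f j) x ≡ app e x + app f x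
  app-+ˡ e f x = trans (∑-cong λ j → ℚ.*-distribʳ-+ (x j) (e j) (f j)) (∑-distrib-+ (λ j → e j * x j) (λ j → f j * x j))

  app--ˡ : ∀ (e f x : Row N) → app (λ j → e j - f j) x ≡ app e x - app f x
  app--ˡ e f x = trans (∑-cong λ j → eq (e j) (f j) (x j)) (∑-distrib-- (λ j → e j * x j) (λ j → f j * x j))
    where
    eq : ∀ a b c → (a - b) * c ≡ a * c - b * c
    eq = solve-∀ ℚ-ring

  app--ʳ : ∀ (e x y : Row N) → app e (λ j → x j - y j) ≡ app e x - app e y
  app--ʳ e x y = trans (app-comm e (λ j → x j - y j)) (trans (app--ˡ x y e) (cong₂ _-_ (app-comm x e) (app-comm y e)))

  app-*ˡ : ∀ q (e x : Row N) → app (λ j → q * e j) x ≡ q * app e x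
  app-*ˡ q e x = trans (∑-cong λ j → ℚ.*-assoc q (e j) (x j)) (sym (∑-*ˡ q (λ j → e j * x j)))

  app-∑ˡ : ∀ {M} (e : Fin M → Row N) x → app (λ j → ∑ λ v → e v j) x ≡ ∑ λ v → app (e v) x
  app-∑ˡ e x = begin
    ∑ (λ j → (∑ λ v → e v j) * x j) ≡⟨ ∑-cong (λ j → ℚ.*-comm (∑ λ v → e v j) (x j)) ⟩
    ∑ (λ j → x j * (∑ λ v → e v j)) ≡⟨ ∑-cong (λ j → ∑-*ˡ (x j) (λ v → e v j)) ⟩
    ∑ (λ j → ∑ λ v → x j * e v j) ≡⟨ ∑-comm (λ j v → x j * e v j) ⟩
    ∑ (λ v → ∑ λ j → x j * e v j) ≡⟨ ∑-cong (λ v → app-comm x (e v)) ⟩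
    ∑ (λ v → app (e v) x) ∎
    where open ≡-Reasoning

-- The moment curve in one block of coordinates

pow : ℚ → ℕ → ℚ
pow t zero = 1ℚ
pow t (suc l) = t * pow t l

-- (t^(l+1) - r^(l+1)) / (t - r)
divided : ℚ → ℚ → ℕ → ℚ
divided r t zero = 1ℚ
divided r t (suc l) = t * divided r t l + pow r (suc l)

divided-* : ∀ r t l → (t - r) * divided r t l ≡ pow t (suc l) - pow r (suc l)
divided-* r t zero = eq r t
  where
  eq : ∀ r t → (t - r) * 1ℚ ≡ t * 1ℚ - r * 1ℚ
  eq = solve-∀ ℚ-ring
divided-* r t (suc l) = trans (eq₁ r t (divided r t l) (pow r (suc l)))
  (trans (cong (λ z → t * z + (t - r) * pow r (suc l)) (divided-* r t l)) (eq₂ r t (pow t (suc l)) (pow r (suc l))))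
  where
  eq₁ : ∀ r t d p → (t - r) * (t * d + p) ≡ t * ((t - r) * d) + (t - r) * p
  eq₁ = solve-∀ ℚ-ring
  eq₂ : ∀ r t a b → t * (a - b) + (t - r) * b ≡ t * a - r * b
  eq₂ = solve-∀ ℚ-ring

pow-poly : ∀ l → IsPoly (λ t → pow t l)
pow-poly zero = const-poly 1ℚ
pow-poly (suc l) = shift-poly (pow-poly l)

divided-poly : ∀ r l → IsPoly (λ t → divided r t l)
divided-poly r zero = const-poly 1ℚ
divided-poly r (suc l) = +-poly (shift-poly (divided-poly r l)) (const-poly (pow r (suc l)))

moment : ∀ k → ℚ → Row k
moment k t l = pow t (suc (toℕ l))

app-moment : ∀ {k} (b : Row k) t → app b (moment k t) ≡ t * ev b t
app-moment {k} b t = trans (∑-cong λ l → cong (b l *_) (ℚ.*-comm t (pow t (toℕ l)))) (scaled b t)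
  where
  eq₁ : ∀ t p u → (t * p) * u ≡ p * (t * u)
  eq₁ = solve-∀ ℚ-ring
  eq₂ : ∀ b t u z → b * (1ℚ * u) + (t * u) * z ≡ u * (b + t * z)
  eq₂ = solve-∀ ℚ-ring
  scaled : ∀ {k} (b : Row k) u → ∑ (λ l → b l * (pow t (toℕ l) * u)) ≡ u * ev b t
  scaled {zero} b u = sym (ℚ.*-zeroʳ u)
  scaled {suc k} b u = trans
    (cong (b zero * (1ℚ * u) +_)
      (trans (∑-cong λ l → cong (b (suc l) *_) (eq₁ t (pow t (toℕ l)) u)) (scaled (b ∘ suc) (t * u))))
    (eq₂ (b zero) t u (ev (b ∘ suc) t))

-- Both sides are (f(t) - f(r)) / (t - r), written without division and so meaningful at t = r. The
-- constant term of f drops out.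
app-divided : ∀ {k} (f : Row (suc k)) r t → app (f ∘ suc) (λ l → divided r t (toℕ l)) ≡ ev (dv r f) t
app-divided {zero} f r t = refl
app-divided {suc k} f r t = begin
  g zero * 1ℚ + ∑ (λ l → g (suc l) * (t * divided r t (toℕ l) + moment k r l))
    ≡⟨ cong (g zero * 1ℚ +_) (trans (∑-cong λ l → eq₁ (g (suc l)) t (divided r t (toℕ l)) (moment k r l)) (∑-distrib-+ (λ l → t * (g (suc l) * divided r t (toℕ l))) (λ l → g (suc l) * moment k r l))) ⟩
  g zero * 1ℚ + (∑ (λ l → t * (g (suc l) * divided r t (toℕ l))) + app (g ∘ suc) (moment k r))
    ≡⟨ cong₂ (λ z w → g zero * 1ℚ + (z + w))
         (trans (sym (∑-*ˡ t (λ l → g (suc l) * divided r t (toℕ l)))) (cong (t *_) (app-divided g r t))) (app-moment (g ∘ suc) r) ⟩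
  g zero * 1ℚ + (t * ev (dv r g) t + r * ev (g ∘ suc) r)
    ≡⟨ eq₂ (g zero) (t * ev (dv r g) t) (r * ev (g ∘ suc) r) ⟩
  (g zero + r * ev (g ∘ suc) r) + t * ev (dv r g) t ∎
  where
  open ≡-Reasoning
  g = f ∘ suc
  eq₁ : ∀ g t d m → g * (t * d + m) ≡ t * (g * d) + g * m
  eq₁ = solve-∀ ℚ-ring
  eq₂ : ∀ g x y → g * 1ℚ + (x + y) ≡ (g + y) + x
  eq₂ = solve-∀ ℚ-ring

-- Blocks of coordinates

in-block : ∀ {m} (a : Vec ℕ m) i → Row (lookup a i) → Row (sum a)
in-block (k ∷ a) zero b j with splitAt k j
... | inj₁ l = b l
... | inj₂ _ = 0ℚ
in-block (k ∷ a) (suc i) b j with splitAt k j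
... | inj₁ _ = 0ℚ
... | inj₂ j′ = in-block a i b j′

to-block : ∀ {m} (a : Vec ℕ m) i → Row (sum a) → Row (lookup a i)
to-block (k ∷ a) zero e l = e (l ↑ˡ sum a)
to-block (k ∷ a) (suc i) e = to-block a i (λ j → e (k ↑ʳ j))

in-block-outside : ∀ {m} (a : Vec ℕ m) i b j → block a j ≢ i → in-block a i b j ≡ 0ℚ
in-block-outside (k ∷ a) zero b j ne with splitAt k j
... | inj₁ l = contradiction refl ne
... | inj₂ _ = refl
in-block-outside (k ∷ a) (suc i) b j ne with splitAt k j
... | inj₁ _ = refl
... | inj₂ j′ = in-block-outside a i b j′ (ne ∘ cong suc)

app-in-block : ∀ {m} (a : Vec ℕ m) i e b → app e (in-block a i b) ≡ app (to-block a i e) b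
app-in-block (k ∷ a) zero e b = trans (∑-splitAt k _) (trans
  (cong₂ _+_ (∑-cong left) (∑-zero right)) (ℚ.+-identityʳ _))
  where
  left : ∀ l → e (l ↑ˡ sum a) * in-block (k ∷ a) zero b (l ↑ˡ sum a) ≡ e (l ↑ˡ sum a) * b l
  left l rewrite Fin.splitAt-↑ˡ k l (sum a) = refl
  right : ∀ j → e (k ↑ʳ j) * in-block (k ∷ a) zero b (k ↑ʳ j) ≡ 0ℚ
  right j rewrite Fin.splitAt-↑ʳ k (sum a) j = ℚ.*-zeroʳ (e (k ↑ʳ j))
app-in-block (k ∷ a) (suc i) e b = trans (∑-splitAt k _) (trans
  (cong₂ _+_ (∑-zero left) (∑-cong right)) (trans (ℚ.+-identityˡ _) (app-in-block a i (λ j → e (k ↑ʳ j)) b)))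
  where
  left : ∀ l → e (l ↑ˡ sum a) * in-block (k ∷ a) (suc i) b (l ↑ˡ sum a) ≡ 0ℚ
  left l rewrite Fin.splitAt-↑ˡ k l (sum a) = ℚ.*-zeroʳ (e (l ↑ˡ sum a))
  right : ∀ j → e (k ↑ʳ j) * in-block (k ∷ a) (suc i) b (k ↑ʳ j) ≡ e (k ↑ʳ j) * in-block a i b j
  right j rewrite Fin.splitAt-↑ʳ k (sum a) j = refl

in-block-poly : ∀ {m} (a : Vec ℕ m) i {b : ℚ → Row (lookup a i)} → (∀ l → IsPoly (λ t → b t l)) →
  ∀ j → IsPoly (λ t → in-block a i (b t) j)
in-block-poly (k ∷ a) zero h j with splitAt k j
... | inj₁ l = h l
... | inj₂ _ = const-poly 0ℚ
in-block-poly (k ∷ a) (suc i) h j with splitAt k j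
... | inj₁ _ = const-poly 0ℚ
... | inj₂ j′ = in-block-poly a i h j′

in-block-* : ∀ {m} (a : Vec ℕ m) i {b c c′ : Row (lookup a i)} q → (∀ l → q * b l ≡ c l - c′ l) →
  ∀ j → q * in-block a i b j ≡ in-block a i c j - in-block a i c′ j
in-block-* (k ∷ a) zero q h j with splitAt k j
... | inj₁ l = h l
... | inj₂ _ = ℚ.*-zeroʳ q
in-block-* (k ∷ a) (suc i) q h j with splitAt k j
... | inj₁ _ = ℚ.*-zeroʳ q
... | inj₂ j′ = in-block-* a i q h j′

to-block-cong : ∀ {m} (a : Vec ℕ m) i {e f} → (∀ j → e j ≡ f j) → ∀ l → to-block a i e l ≡ to-block a i f l
to-block-cong (k ∷ a) zero h l = h (l ↑ˡ sum a)
to-block-cong (k ∷ a) (suc i) h = to-block-cong a i (λ j → h (k ↑ʳ j))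

to-in-block : ∀ {m} (a : Vec ℕ m) i b l → to-block a i (in-block a i b) l ≡ b l
to-in-block (k ∷ a) zero b l rewrite Fin.splitAt-↑ˡ k l (sum a) = refl
to-in-block (k ∷ a) (suc i) b l = trans (to-block-cong a i right l) (to-in-block a i b l)
  where
  right : ∀ j → in-block (k ∷ a) (suc i) b (k ↑ʳ j) ≡ in-block a i b j
  right j rewrite Fin.splitAt-↑ʳ k (sum a) j = refl

to-block-0 : ∀ {m} (a : Vec ℕ m) i {e} → (∀ j → e j ≡ 0ℚ) → ∀ l → to-block a i e l ≡ 0ℚ
to-block-0 (k ∷ a) zero h l = h (l ↑ˡ sum a)
to-block-0 (k ∷ a) (suc i) h = to-block-0 a i (λ j → h (k ↑ʳ j))

to-other-block : ∀ {m} (a : Vec ℕ m) {i i′} → i ≢ i′ → ∀ b l → to-block a i′ (in-block a i b) l ≡ 0ℚ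
to-other-block (k ∷ a) {zero} {zero} ne b l = contradiction refl ne
to-other-block (k ∷ a) {zero} {suc i′} ne b = to-block-0 a i′ right
  where
  right : ∀ j → in-block (k ∷ a) zero b (k ↑ʳ j) ≡ 0ℚ
  right j rewrite Fin.splitAt-↑ʳ k (sum a) j = refl
to-other-block (k ∷ a) {suc i} {zero} ne b l rewrite Fin.splitAt-↑ˡ k l (sum a) = refl
to-other-block (k ∷ a) {suc i} {suc i′} ne b l = trans (to-block-cong a i′ right l) (to-other-block a (ne ∘ cong suc) b l)
  where
  right : ∀ j → in-block (k ∷ a) (suc i) b (k ↑ʳ j) ≡ in-block a i b j
  right j rewrite Fin.splitAt-↑ʳ k (sum a) j = refl

blocks-0 : ∀ {m} (a : Vec ℕ m) e → (∀ i l → to-block a i e l ≡ 0ℚ) → ∀ j → e j ≡ 0ℚ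
blocks-0 (k ∷ a) e h j with splitAt k j in eq
... | inj₁ l = trans (cong e (sym (Fin.splitAt⁻¹-↑ˡ eq))) (h zero l)
... | inj₂ j′ = trans (cong e (sym (Fin.splitAt⁻¹-↑ʳ eq))) (blocks-0 a (λ j → e (k ↑ʳ j)) (h ∘ suc) j′)

mulLin : ∀ {k} → ℚ → Row k → Row (suc k)
mulLin {zero} r g j = 0ℚ
mulLin {suc k} r g zero = - r * g zero
mulLin {suc k} r g (suc zero) = g zero + mulLin r (g ∘ suc) zero
mulLin {suc k} r g (suc (suc j)) = mulLin r (g ∘ suc) (suc j)

ev-mulLin : ∀ {k} r (g : Row k) t → ev (mulLin r g) t ≡ (t - r) * ev g t
ev-mulLin {zero} r g t = eq r t
  where
  eq : ∀ r t → 0ℚ + t * 0ℚ ≡ (t - r) * 0ℚ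
  eq = solve-∀ ℚ-ring
ev-mulLin {suc k} r g t = trans (eq₁ r (g zero) t _ _) (trans
  (cong (λ z → - r * g zero + t * (g zero + z)) (ev-mulLin r (g ∘ suc) t)) (eq₂ r (g zero) t (ev (g ∘ suc) t)))
  where
  eq₁ : ∀ r g t x y → - r * g + t * ((g + x) + t * y) ≡ - r * g + t * (g + (x + t * y))
  eq₁ = solve-∀ ℚ-ring
  eq₂ : ∀ r g t z → - r * g + t * (g + (t - r) * z) ≡ (t - r) * (g + t * z)
  eq₂ = solve-∀ ℚ-ring

*-≢0 : ∀ {p q} → p ≢ 0ℚ → q ≢ 0ℚ → p * q ≢ 0ℚ
*-≢0 p≢0 q≢0 e = q≢0 (*-cancel-≢0 p≢0 e)

-- The product of X - t u over u ∈ R, of degree |R| < k. It is the ingredient of a dual basis inside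
-- one factor.
annihilator : ∀ {n} (t : Fin n → ℚ) k (R : Subset n) r → suc ∣ R ∣ ≤ k → (∀ u → R ∋ u → r ≢ t u) →
              Σ (Row k) λ g → (∀ u → R ∋ u → ev g (t u) ≡ 0ℚ) × ev g r ≢ 0ℚ
annihilator t (suc k) R r h ne with ∣ R ∣ in eq
... | zero = 1-row , (λ u p → case trans (sym eq) (∣del∣ p) of λ ()) , λ e → case trans (sym (1-row-ev r)) e of λ ()
  where
  1-row : Row (suc k)
  1-row zero = 1ℚ
  1-row (suc _) = 0ℚ
  ev-0 : ∀ k t → ev {k} (λ _ → 0ℚ) t ≡ 0ℚ
  ev-0 zero t = refl
  ev-0 (suc k) t = trans (ℚ.+-identityˡ _) (trans (cong (t *_) (ev-0 k t)) (ℚ.*-zeroʳ t))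
  1-row-ev : ∀ t → ev 1-row t ≡ 1ℚ
  1-row-ev t = trans (cong (λ z → 1ℚ + t * z) (ev-0 k t)) (trans (cong (1ℚ +_) (ℚ.*-zeroʳ t)) (ℚ.+-identityʳ 1ℚ))
... | suc c =
  let u , u∈R = ∣∣>0⇒∋ R (subst (1 ≤_) (sym eq) (ℕ.s≤s ℕ.z≤n))
      size : suc ∣ del u R ∣ ≤ k
      size = subst (_≤ k) (trans (sym eq) (∣del∣ u∈R)) (ℕ.s≤s⁻¹ h)
      g , g0 , g≢0 = annihilator t k (del u R) r size λ w p → ne w (proj₂ (del-∋⁻ p))
      vanish : ∀ w → R ∋ w → ev (mulLin (t u) g) (t w) ≡ 0ℚ
      vanish w p = trans (ev-mulLin (t u) g (t w)) (case w Fin.≟ u of λ where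
        (yes refl) → trans (cong (_* ev g (t w)) (ℚ.+-inverseʳ (t w))) (ℚ.*-zeroˡ (ev g (t w)))
        (no w≢u) → trans (cong ((t w - t u) *_) (g0 w (del-∋ w≢u p))) (ℚ.*-zeroʳ (t w - t u)))
  in mulLin (t u) g , vanish , λ e → *-≢0 (ne u u∈R ∘ p-q≡0⇒p≡q r (t u)) g≢0 (trans (sym (ev-mulLin (t u) g r)) e)

infixr 5 _∷ʳ_
_∷ʳ_ : ∀ {k} → ℚ → Row k → Row (suc k)
(s ∷ʳ b) zero = s
(s ∷ʳ b) (suc l) = b l

neg-0 : ∀ s → - s ≡ 0ℚ → s ≡ 0ℚ
neg-0 s e = trans (eq s) (cong -_ e)
  where
  eq : ∀ s → s ≡ - (- s)
  eq = solve-∀ ℚ-ring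

shifted : ∀ s w → w ≡ s → - s + w ≡ 0ℚ
shifted s w refl = ℚ.+-inverseˡ s

does-true : ∀ {ℓ} {P : Set ℓ} (P? : Dec P) → does P? ≡ true → P
does-true (yes p) _ = p

-- Sparse placements on the moment curves

module Curve {n m} (a : Vec ℕ m) (κ : Fin n → Fin m) where

  d : ℕ
  d = sum a

  μ : Fin m → ℚ → Row d
  μ i t = in-block a i (moment (lookup a i) t)

  -- The secant from parameter r to parameter t, divided by t - r; at t = r it is the tangent of the
  -- curve.
  η : Fin m → ℚ → ℚ → Row d
  η i r t = in-block a i (λ l → divided r t (toℕ l))

  μ-poly : ∀ i j → IsPoly (λ t → μ i t j)
  μ-poly i = in-block-poly a i λ l → pow-poly (suc (toℕ l))

  η-poly : ∀ i r j → IsPoly (λ t → η i r t j)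
  η-poly i r = in-block-poly a i λ l → divided-poly r (toℕ l)

  η-* : ∀ i r t j → (t - r) * η i r t j ≡ μ i t j - μ i r j
  η-* i r t = in-block-* a i (t - r) λ l → divided-* r t (toℕ l)

  app-μ : ∀ e i t → app e (μ i t) ≡ t * ev (to-block a i e) t
  app-μ e i t = trans (app-in-block a i e (moment (lookup a i) t)) (app-moment (to-block a i e) t)

  app-η : ∀ e i r t s → app e (η i r t) ≡ ev (dv r (s ∷ʳ to-block a i e)) t
  app-η e i r t s = trans (app-in-block a i e (λ l → divided r t (toℕ l))) (app-divided (s ∷ʳ to-block a i e) r t)

  colour : Fin m → Subset n → Subset n
  colour i F = F ∩ fibre κ i

  cnt : Fin m → Subset n → ℕ
  cnt i F = ∣ colour i F ∣

  lookup-fibre : ∀ i v → lookup (fibre κ i) v ≡ does (κ v Fin.≟ i)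
  lookup-fibre i v = Vec.lookup∘tabulate (λ v → does (κ v Fin.≟ i)) v

  colour-∋⁻ : ∀ {i F v} → colour i F ∋ v → F ∋ v × κ v ≡ i
  colour-∋⁻ {i} {F} {v} p with F∋v , ∋⟨ q ⟩ ← ∋-∩⁻ F (fibre κ i) v p = F∋v ,
    does-true (κ v Fin.≟ i) (trans (sym (lookup-fibre i v)) q)

  colour-∋ : ∀ {i F v} → κ v ≡ i → F ∋ v → colour i F ∋ v
  colour-∋ {i} {F} {v} κv≡i F∋v = ∋⟨ trans (Vec.lookup-zipWith _∧_ v F (fibre κ i))
    (cong₂ _∧_ (∋-eq F∋v) (trans (lookup-fibre i v) (dec-true (κ v Fin.≟ i) κv≡i))) ⟩

  cnt-add : ∀ i {F v} → F ∌ v → cnt i (add v F) ≡ 𝟙 (does (κ v Fin.≟ i)) ℕ.+ cnt i F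
  cnt-add i {F} {v} p = trans (∣add∩∣ F (fibre κ i) v p) (cong (λ b → 𝟙 b ℕ.+ cnt i F) (lookup-fibre i v))

  cnt-add-≡ : ∀ {i F v} → F ∌ v → κ v ≡ i → cnt i (add v F) ≡ suc (cnt i F)
  cnt-add-≡ {i} {F} {v} p e = trans (cnt-add i p) (cong (λ b → 𝟙 b ℕ.+ cnt i F) (dec-true (κ v Fin.≟ i) e))

  cnt-add-≢ : ∀ {i F v} → F ∌ v → κ v ≢ i → cnt i (add v F) ≡ cnt i F
  cnt-add-≢ {i} {F} {v} p e = trans (cnt-add i p) (cong (λ b → 𝟙 b ℕ.+ cnt i F) (dec-false (κ v Fin.≟ i) e))

  cnt-add-≤ : ∀ i {F v} → F ∌ v → cnt i F ≤ cnt i (add v F)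
  cnt-add-≤ i p = ℕ.≤-trans (ℕ.m≤n+m _ _) (ℕ.≤-reflexive (sym (cnt-add i p)))

  Covers : Subset n → Set
  Covers T = ∀ i → lookup a i ≤ cnt i T

  module Generic (t : Fin n → ℚ) (t-inj : ∀ {u v} → t u ≡ t v → u ≡ v) (t≢0 : ∀ v → t v ≢ 0ℚ) where

    p : Fin n → Row d
    p v = μ (κ v) (t v)

    app-p : ∀ e v i → κ v ≡ i → app e (p v) ≡ t v * ev (to-block a i e) (t v)
    app-p e v i refl = app-μ e (κ v) (t v)

    block-vanishes : ∀ {k} (b : Row k) R → k ≤ ∣ R ∣ → (∀ v → R ∋ v → t v * ev b (t v) ≡ 0ℚ) → ∀ l → b l ≡ 0ℚ
    block-vanishes b R h z = vanishes t R (λ _ _ → t-inj) b h λ v q → *-cancel-≢0 (t≢0 v) (z v q)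

    block-const : ∀ {k} (b : Row k) s R → suc k ≤ ∣ R ∣ → (∀ v → R ∋ v → t v * ev b (t v) ≡ s) → s ≡ 0ℚ × ∀ l → b l ≡ 0ℚ
    block-const b s R h z = neg-0 s (f≡0 zero) , f≡0 ∘ suc
      where
      f≡0 : ∀ j → (- s ∷ʳ b) j ≡ 0ℚ
      f≡0 = vanishes t R (λ _ _ → t-inj) (- s ∷ʳ b) h λ v q → shifted s _ (z v q)

    -- Along the curve of colour i, the pairing with e is t times a polynomial with a_i
    -- coefficients, so a_i distinct nonzero parameters force these coefficients to vanish.
    spanning : ∀ {T} → Covers T → ∀ e → (∀ v → T ∋ v → app e (p v) ≡ 0ℚ) → ∀ j → e j ≡ 0ℚ
    spanning {T} cov e z = blocks-0 a e λ i → block-vanishes (to-block a i e) (colour i T) (cov i) λ v q →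
      let T∋v , κv≡i = colour-∋⁻ q in trans (sym (app-p e v i κv≡i)) (z v T∋v)

    -- The further point of colour i pays for the constant s as one more coefficient. Once s is 0
    -- for one colour, it is 0 for all.
    affinely-spanning : ∀ {T} → Covers T → ∀ i → suc (lookup a i) ≤ cnt i T →
      ∀ e s → (∀ v → T ∋ v → app e (p v) ≡ s) → s ≡ 0ℚ × ∀ j → e j ≡ 0ℚ
    affinely-spanning {T} cov i more e s z = s≡0 , spanning cov e λ v q → trans (z v q) s≡0
      where
      s≡0 = proj₁ (block-const (to-block a i e) s (colour i T) more λ v q →
        let T∋v , κv≡i = colour-∋⁻ q in trans (sym (app-p e v i κv≡i)) (z v T∋v))

    -- The tangent η to the curve at t x supplies a double root.
    data Splits (x : Fin n) (C : Subset n) : Set where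
      tight : (∀ i → i ≢ κ x → lookup a i ≤ cnt i C) → lookup a (κ x) ≤ suc (cnt (κ x) C) → Splits x C
      crossing : ∀ k → k ≢ κ x → suc (lookup a k) ≤ cnt k C →
                 (∀ i → i ≢ κ x → lookup a i ≤ cnt i C) → lookup a (κ x) ≤ 2 ℕ.+ cnt (κ x) C → Splits x C

    -- The other colours follow as in `spanning` once s = 0. In the factor of x, with a =
    -- `lookup a (κ x)`, the pairing with e minus s has a + 1 coefficients. It has a double root at
    -- t x and a root at each vertex of C of that colour, so a - 1 such vertices suffice (`tight`).
    -- If another colour is overfull, it forces s = 0 beforehand; the root 0 is then divided out and
    -- a - 2 suffice (`crossing`).
    splits-vanishes : ∀ {x C} → C ∌ x → Splits x C → ∀ e → app e (η (κ x) (t x) (t x)) ≡ 0ℚ →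
      (∀ w → C ∋ w → app e (p w) ≡ app e (p x)) → ∀ j → e j ≡ 0ℚ
    splits-vanishes {x} {C} C∌x splits e tangent z = case splits of λ where
        (tight cov more) → case-tight cov more
        (crossing k k≢κx k-more cov more) → case-crossing k k≢κx k-more cov more
      where
      i = κ x
      b = to-block a i e
      r = t x
      s = app e (p x)
      R = colour i C
      R∌x : R ∌ x
      R∌x = ¬∋⇒∌ λ q → ∋-∌-contradiction (proj₁ (colour-∋⁻ q)) C∌x

      conclude : s ≡ 0ℚ → (∀ l → b l ≡ 0ℚ) → (∀ i → i ≢ κ x → lookup a i ≤ cnt i C) → ∀ j → e j ≡ 0ℚ
      conclude s≡0 b≡0 cov = blocks-0 a e λ i′ → case i′ Fin.≟ κ x of λ where
        (yes refl) → b≡0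
        (no ne) → block-vanishes (to-block a i′ e) (colour i′ C) (cov i′ ne) λ v q →
          let C∋v , κv≡i = colour-∋⁻ q in trans (sym (app-p e v i′ κv≡i)) (trans (z v C∋v) s≡0)

      on-R : ∀ w → R ∋ w → t w * ev b (t w) ≡ s
      on-R w q = let C∋w , κw≡i = colour-∋⁻ q in trans (sym (app-p e w i κw≡i)) (z w C∋w)

      case-tight : (∀ i → i ≢ κ x → lookup a i ≤ cnt i C) → lookup a i ≤ suc (cnt i C) → ∀ j → e j ≡ 0ℚ
      case-tight cov more = conclude (neg-0 s (f≡0 zero)) (f≡0 ∘ suc) cov
        where
        f = - s ∷ʳ b
        f-root : ev f r ≡ 0ℚ
        f-root = shifted s _ (sym (app-p e x i refl))
        f≡0 : ∀ j → f j ≡ 0ℚ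
        f≡0 = dv≡0⇒≡0 r f (vanishes t (add x R) (λ _ _ → t-inj) (dv r f)
          (subst (lookup a i ≤_) (sym (∣add∣ R x R∌x)) more)
          λ v q → case v Fin.≟ x of λ where
            (yes refl) → trans (sym (app-η e i r r (- s))) tangent
            (no v≢x) → dv-root r (t v) f (v≢x ∘ t-inj) (trans (shifted s _ (on-R v (add-∋⁻ v≢x q))) (sym f-root)))
          f-root

      case-crossing : ∀ k → k ≢ κ x → suc (lookup a k) ≤ cnt k C → (∀ i → i ≢ κ x → lookup a i ≤ cnt i C) →
        lookup a i ≤ 2 ℕ.+ cnt i C → ∀ j → e j ≡ 0ℚ
      case-crossing k k≢κx k-more cov more = conclude s≡0 (go b more b-root on-R₀ λ s′ → trans (sym (app-η e i r r s′)) tangent) cov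
        where
        s≡0 : s ≡ 0ℚ
        s≡0 = proj₁ (block-const (to-block a k e) s (colour k C) k-more λ v q →
          let C∋v , κv≡k = colour-∋⁻ q in trans (sym (app-p e v k κv≡k)) (z v C∋v))
        b-root : ev b r ≡ 0ℚ
        b-root = *-cancel-≢0 (t≢0 x) (trans (sym (app-p e x i refl)) s≡0)
        on-R₀ : ∀ w → R ∋ w → ev b (t w) ≡ 0ℚ
        on-R₀ w q = *-cancel-≢0 (t≢0 w) (trans (on-R w q) s≡0)
        go : ∀ {k} (b : Row k) → k ≤ 2 ℕ.+ cnt i C → ev b r ≡ 0ℚ → (∀ w → R ∋ w → ev b (t w) ≡ 0ℚ) →
             (∀ s → ev (dv r (s ∷ʳ b)) r ≡ 0ℚ) → ∀ l → b l ≡ 0ℚ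
        go {zero} b h root zs double ()
        go {suc k} b h root zs double = dv≡0⇒≡0 r b (vanishes t (add x R) (λ _ _ → t-inj) (dv r b)
          (subst (k ≤_) (sym (∣add∣ R x R∌x)) (ℕ.s≤s⁻¹ h))
          λ v q → case v Fin.≟ x of λ where
            (yes refl) → double-root
            (no v≢x) → dv-root r (t v) b (v≢x ∘ t-inj) (trans (zs v (add-∋⁻ v≢x q)) (sym root)))
          root
          where
          double-root : ev (dv r b) r ≡ 0ℚ
          double-root = *-cancel-≢0 (t≢0 x) (trans (sym (ℚ.+-identityˡ _))
            (trans (cong (_+ r * ev (dv r b) r) (sym root)) (double 0ℚ)))

-- Skew forms, trivial motions and pins

double-0 : ∀ q → q ≡ - q → q ≡ 0ℚ
double-0 q e = *-cancel-≢0 {1ℚ + 1ℚ} (λ ()) (trans (eq q) (trans (cong (_+ q) e) (ℚ.+-inverseˡ q)))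
  where
  eq : ∀ q → (1ℚ + 1ℚ) * q ≡ q + q
  eq = solve-∀ ℚ-ring

Skew : ∀ {N} → (Fin N → Row N) → Set
Skew S = ∀ k l → S k l ≡ - S l k

infixl 6 _⊖_
_⊖_ : ∀ {N} → Row N → Row N → Row N
(x ⊖ y) k = x k - y k

skew-form : ∀ {N} {S : Fin N → Row N} → Skew S → ∀ x y →
  app (λ k → app (S k) x) y ≡ - app (λ k → app (S k) y) x
skew-form {N} {S} skew x y = begin
  ∑ (λ k → app (S k) x * y k) ≡⟨ expand x y ⟩
  ∑ (λ k → ∑ λ l → S k l * x l * y k) ≡⟨ ∑-comm (λ k l → S k l * x l * y k) ⟩
  ∑ (λ l → ∑ λ k → S k l * x l * y k) ≡⟨ (∑-cong λ l → ∑-cong λ k → trans (cong (λ z → z * x l * y k) (skew k l)) (eq (S l k) (x l) (y k))) ⟩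
  ∑ (λ l → ∑ λ k → - 1ℚ * (S l k * y k * x l)) ≡⟨ ∑-cong (λ l → ∑-*ˡ (- 1ℚ) (λ k → S l k * y k * x l)) ⟨
  ∑ (λ l → - 1ℚ * ∑ λ k → S l k * y k * x l) ≡⟨ ∑-*ˡ (- 1ℚ) (λ l → ∑ λ k → S l k * y k * x l) ⟨
  - 1ℚ * ∑ (λ l → ∑ λ k → S l k * y k * x l) ≡⟨ cong (- 1ℚ *_) (expand y x) ⟨
  - 1ℚ * ∑ (λ l → app (S l) y * x l) ≡⟨ neg _ ⟩
  - ∑ (λ l → app (S l) y * x l) ∎
  where
  open ≡-Reasoning
  eq : ∀ s x y → (- s) * x * y ≡ - 1ℚ * (s * y * x)
  eq = solve-∀ ℚ-ring
  neg : ∀ q → - 1ℚ * q ≡ - q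
  neg = solve-∀ ℚ-ring
  expand : ∀ x y → app (λ k → app (S k) x) y ≡ ∑ λ k → ∑ λ l → S k l * x l * y k
  expand x y = ∑-cong λ k → trans (ℚ.*-comm (app (S k) x) (y k)) (trans (∑-*ˡ (y k) (λ l → S k l * x l))
    (∑-cong λ l → ℚ.*-comm (y k) (S k l * x l)))

skew-form-diagonal : ∀ {N} {S : Fin N → Row N} → Skew S → ∀ x → app (λ k → app (S k) x) x ≡ 0ℚ
skew-form-diagonal skew x = double-0 _ (skew-form skew x x)

module Frame {n m} (a : Vec ℕ m) (κ : Fin n → Fin m) where
  open Curve a κ

  Field : Set
  Field = Fin n → Row d

  Stretch : (Fin n → Row d) → Field → Fin n → Fin n → ℚ
  Stretch p u v w = app (p v ⊖ p w) (u v ⊖ u w)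

  trivial : (Fin n → Row d) → (Fin d → Row d) → Row d → Field
  trivial p S s v k = app (S k) (p v) + s k

  trivial-⊖ : ∀ p S s v w k → (trivial p S s v ⊖ trivial p S s w) k ≡ app (S k) (p v ⊖ p w)
  trivial-⊖ p S s v w k = trans (eq (app (S k) (p v)) (app (S k) (p w)) (s k)) (sym (app--ʳ (S k) (p v) (p w)))
    where
    eq : ∀ a b c → (a + c) - (b + c) ≡ a - b
    eq = solve-∀ ℚ-ring

  trivial-motion : ∀ p {S} s → Skew S → ∀ v w → Stretch p (trivial p S s) v w ≡ 0ℚ
  trivial-motion p {S} s skew v w = trans (app-congʳ (p v ⊖ p w) (trivial-⊖ p S s v w))
    (trans (app-comm (p v ⊖ p w) (λ k → app (S k) (p v ⊖ p w))) (skew-form-diagonal skew (p v ⊖ p w)))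

  stretch-sub : ∀ p u u′ v w → Stretch p (λ v → u v ⊖ u′ v) v w ≡ Stretch p u v w - Stretch p u′ v w
  stretch-sub p u u′ v w = trans
    (app-congʳ (p v ⊖ p w) (λ k → eq (u v k) (u′ v k) (u w k) (u′ w k)))
    (app--ʳ (p v ⊖ p w) (u v ⊖ u w) (u′ v ⊖ u′ w))
    where
    eq : ∀ a b c d → (a - b) - (c - d) ≡ (a - c) - (b - d)
    eq = solve-∀ ℚ-ring

  stretch-mod-trivial : ∀ p u {S} s → Skew S → ∀ v w → Stretch p (λ v → u v ⊖ trivial p S s v) v w ≡ Stretch p u v w
  stretch-mod-trivial p u {S} s skew v w = trans (stretch-sub p u (trivial p S s) v w)
    (trans (cong (λ z → Stretch p u v w - z) (trivial-motion p s skew v w)) (eq (Stretch p u v w)))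
    where
    eq : ∀ a → a - 0ℚ ≡ a
    eq = solve-∀ ℚ-ring

  -- When the p v with v ∈ B form a basis, these are d(d + 1)/2 conditions, the dimension of the
  -- space of trivial motions: the diagonal pairings fix the translation, those with v < w the
  -- rotation.
  Pinned : Subset n → (Fin n → Row d) → Field → Set
  Pinned B p u = ∀ {v w} → B ∋ v → B ∋ w → v Fin.≤ w → app (u v) (p w) ≡ 0ℚ

  module Basis (t : Fin n → ℚ) (t-inj : ∀ {u v} → t u ≡ t v → u ≡ v) (t≢0 : ∀ v → t v ≢ 0ℚ)
               (B : Subset n) (exact : ∀ i → cnt i B ≡ lookup a i) where
    open Generic t t-inj t≢0

    B-covers : Covers B
    B-covers i = ℕ.≤-reflexive (sym (exact i))

    -- The annihilator of the other vertices of the colour of v, placed in that factor and rescaled;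
    -- vertices of other colours lie in other factors and pair to 0 with it.
    dual-vector : ∀ v → B ∋ v → Σ (Row d) λ w → app w (p v) ≡ 1ℚ × (∀ u → B ∋ u → u ≢ v → app w (p u) ≡ 0ℚ)
    dual-vector v B∋v =
      let i = κ v
          R = del v (colour i B)
          size = ℕ.≤-reflexive (trans (sym (∣del∣ (colour-∋ {i} refl B∋v))) (exact i))
          g , g0 , g≢0 = annihilator t (lookup a i) R (t v) size λ u q e → proj₁ (del-∋⁻ q) (t-inj (sym e))
          e = in-block a i g
          c≢0 = *-≢0 (t≢0 v) g≢0
          instance _ = ℚ.≢-nonZero c≢0
          c = t v * ev g (t v)
          value : ∀ u → κ u ≡ i → app e (p u) ≡ t u * ev g (t u)
          value u κu≡i = trans (app-p e u i κu≡i) (cong (t u *_) (ev-cong (t u) (to-in-block a i g)))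
          zero′ : ∀ u → B ∋ u → u ≢ v → app e (p u) ≡ 0ℚ
          zero′ u B∋u u≢v = case κ u Fin.≟ i of λ where
            (yes κu≡i) → trans (value u κu≡i) (trans (cong (t u *_) (g0 u (del-∋ u≢v (colour-∋ κu≡i B∋u)))) (ℚ.*-zeroʳ (t u)))
            (no κu≢i) → trans (app-in-block a (κ u) e (moment (lookup a (κ u)) (t u)))
              (app-zeroˡ (moment (lookup a (κ u)) (t u)) (to-other-block a (κu≢i ∘ sym) g))
      in (λ j → ℚ.1/ c * e j)
       , trans (app-*ˡ (ℚ.1/ c) e (p v)) (trans (cong (ℚ.1/ c *_) (value v refl)) (ℚ.*-inverseˡ c))
       , λ u B∋u u≢v → trans (app-*ˡ (ℚ.1/ c) e (p u)) (trans (cong (ℚ.1/ c *_) (zero′ u B∋u u≢v)) (ℚ.*-zeroʳ (ℚ.1/ c)))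
      where
      ev-cong : ∀ {k} {f g : Row k} t → (∀ l → f l ≡ g l) → ev f t ≡ ev g t
      ev-cong {zero} t h = refl
      ev-cong {suc k} t h = cong₂ (λ y z → y + t * z) (h zero) (ev-cong t (h ∘ suc))

    w : Fin n → Row d
    w v with ∋⊎∌ B v
    ... | inj₁ B∋v = proj₁ (dual-vector v B∋v)
    ... | inj₂ _ = λ _ → 0ℚ

    w-other : ∀ u v → B ∋ u → v ≢ u → app (w v) (p u) ≡ 0ℚ
    w-other u v B∋u v≢u with ∋⊎∌ B v
    ... | inj₁ B∋v = proj₂ (proj₂ (dual-vector v B∋v)) u B∋u (v≢u ∘ sym)
    ... | inj₂ _ = app-zeroˡ (p u) (λ _ → refl)

    w-self : ∀ v → B ∋ v → app (w v) (p v) ≡ 1ℚ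
    w-self v B∋v with ∋⊎∌ B v
    ... | inj₁ B∋v′ = proj₁ (proj₂ (dual-vector v B∋v′))
    ... | inj₂ B∌v = ∋-∌-contradiction B∋v B∌v

    ∑-dual : ∀ (c : Fin n → ℚ) u → B ∋ u → ∑ (λ v → c v * app (w v) (p u)) ≡ c u
    ∑-dual c u B∋u = trans
      (∑-single (λ v → c v * app (w v) (p u)) u λ v v≢u → trans (cong (c v *_) (w-other u v B∋u v≢u)) (ℚ.*-zeroʳ (c v)))
      (trans (cong (c u *_) (w-self u B∋u)) (ℚ.*-identityʳ (c u)))

    -- A skew form vanishes on the diagonal, so the diagonal pins see only the translation. This one
    -- takes the values u v · p v on the basis.
    shift : Field → Row d
    shift u k = ∑ λ v → app (u v) (p v) * w v k

    pairing : Field → Fin n → Fin n → ℚ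
    pairing u v v′ = app (u v ⊖ shift u) (p v′)

    -- The skew form, given on the basis p v: the pins with v < v′ prescribe its values above the
    -- diagonal, and skewness gives the rest.
    torque : Field → Fin n → Fin n → ℚ
    torque u v v′ = if does (v Fin.<? v′) then pairing u v v′ else if does (v′ Fin.<? v) then - pairing u v′ v else 0ℚ

    torque-< : ∀ u {v v′} → v Fin.< v′ → torque u v v′ ≡ pairing u v v′
    torque-< u {v} {v′} h rewrite dec-true (v Fin.<? v′) h = refl

    torque-> : ∀ u {v v′} → v′ Fin.< v → torque u v v′ ≡ - pairing u v′ v
    torque-> u {v} {v′} h rewrite dec-false (v Fin.<? v′) (λ h′ → Fin.<-asym h h′) | dec-true (v′ Fin.<? v) h = refl

    torque-≡ : ∀ u v → torque u v v ≡ 0ℚ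
    torque-≡ u v rewrite dec-false (v Fin.<? v) (Fin.<-irrefl refl) = refl

    torque-skew : ∀ u v v′ → torque u v v′ ≡ - torque u v′ v
    torque-skew u v v′ with Fin.<-cmp v v′
    ... | tri< h _ _ = trans (torque-< u h) (trans (eq _) (cong -_ (sym (torque-> u h))))
      where
      eq : ∀ q → q ≡ - (- q)
      eq = solve-∀ ℚ-ring
    ... | tri> _ _ h = trans (torque-> u h) (cong -_ (sym (torque-< u h)))
    ... | tri≈ _ refl _ = trans (torque-≡ u v) (cong -_ (sym (torque-≡ u v)))

    rotation : Field → Fin d → Row d
    rotation u k l = ∑ λ v → ∑ λ v′ → torque u v v′ * w v′ k * w v l

    rotation-skew : ∀ u → Skew (rotation u)
    rotation-skew u k l = begin
      ∑ (λ v → ∑ λ v′ → torque u v v′ * w v′ k * w v l) ≡⟨ ∑-comm (λ v v′ → torque u v v′ * w v′ k * w v l) ⟩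
      ∑ (λ v′ → ∑ λ v → torque u v v′ * w v′ k * w v l) ≡⟨ (∑-cong λ v′ → ∑-cong λ v → trans (cong (λ z → z * w v′ k * w v l) (torque-skew u v v′)) (eq (torque u v′ v) (w v′ k) (w v l))) ⟩
      ∑ (λ v′ → ∑ λ v → - 1ℚ * (torque u v′ v * w v l * w v′ k)) ≡⟨ ∑-cong (λ v′ → ∑-*ˡ (- 1ℚ) (λ v → torque u v′ v * w v l * w v′ k)) ⟨
      ∑ (λ v′ → - 1ℚ * ∑ λ v → torque u v′ v * w v l * w v′ k) ≡⟨ ∑-*ˡ (- 1ℚ) (λ v′ → ∑ λ v → torque u v′ v * w v l * w v′ k) ⟨
      - 1ℚ * rotation u l k ≡⟨ neg _ ⟩
      - rotation u l k ∎
      where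
      open ≡-Reasoning
      eq : ∀ s x y → (- s) * x * y ≡ - 1ℚ * (s * y * x)
      eq = solve-∀ ℚ-ring
      neg : ∀ q → - 1ℚ * q ≡ - q
      neg = solve-∀ ℚ-ring

    rotation-form : ∀ u {v v′} → B ∋ v → B ∋ v′ → app (λ k → app (rotation u k) (p v)) (p v′) ≡ torque u v v′
    rotation-form u {v₀} {v₁} B∋v₀ B∋v₁ = begin
      app (λ k → app (rotation u k) (p v₀)) (p v₁)
        ≡⟨ app-cong {x = p v₁} inner (λ _ → refl) ⟩
      app (λ k → ∑ λ v′ → torque u v₀ v′ * w v′ k) (p v₁)
        ≡⟨ app-∑ˡ (λ v′ k → torque u v₀ v′ * w v′ k) (p v₁) ⟩
      ∑ (λ v′ → app (λ k → torque u v₀ v′ * w v′ k) (p v₁))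
        ≡⟨ ∑-cong (λ v′ → app-*ˡ (torque u v₀ v′) (w v′) (p v₁)) ⟩
      ∑ (λ v′ → torque u v₀ v′ * app (w v′) (p v₁))
        ≡⟨ ∑-dual (torque u v₀) v₁ B∋v₁ ⟩
      torque u v₀ v₁ ∎
      where
      open ≡-Reasoning
      inner : ∀ k → app (rotation u k) (p v₀) ≡ ∑ λ v′ → torque u v₀ v′ * w v′ k
      inner k = begin
        app (λ l → ∑ λ v → ∑ λ v′ → torque u v v′ * w v′ k * w v l) (p v₀)
          ≡⟨ app-∑ˡ (λ v l → ∑ λ v′ → torque u v v′ * w v′ k * w v l) (p v₀) ⟩
        ∑ (λ v → app (λ l → ∑ λ v′ → torque u v v′ * w v′ k * w v l) (p v₀))
          ≡⟨ ∑-cong (λ v → trans (app-cong {x = p v₀} (λ l → factor v l) (λ _ → refl)) (app-*ˡ (c v) (w v) (p v₀))) ⟩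
        ∑ (λ v → c v * app (w v) (p v₀))
          ≡⟨ ∑-dual c v₀ B∋v₀ ⟩
        c v₀ ∎
        where
        c : Fin n → ℚ
        c v = ∑ λ v′ → torque u v v′ * w v′ k
        factor : ∀ v l → ∑ (λ v′ → torque u v v′ * w v′ k * w v l) ≡ c v * w v l
        factor v l = trans (∑-cong λ v′ → ℚ.*-comm (torque u v v′ * w v′ k) (w v l))
          (trans (sym (∑-*ˡ (w v l) (λ v′ → torque u v v′ * w v′ k))) (ℚ.*-comm (w v l) (c v)))

    app-shift : ∀ u v → B ∋ v → app (shift u) (p v) ≡ app (u v) (p v)
    app-shift u v B∋v = trans (app-∑ˡ (λ v′ k → app (u v′) (p v′) * w v′ k) (p v))
      (trans (∑-cong λ v′ → app-*ˡ (app (u v′) (p v′)) (w v′) (p v)) (∑-dual (λ v′ → app (u v′) (p v′)) v B∋v))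

    adjusted : Field → Field
    adjusted u v = u v ⊖ trivial p (rotation u) (shift u) v

    adjusted-pinned : ∀ u → Pinned B p (adjusted u)
    adjusted-pinned u {v} {v′} B∋v B∋v′ v≤v′ = trans
      (app-cong {x = p v′} (λ k → eq (u v k) (app (rotation u k) (p v)) (shift u k)) (λ _ → refl))
      (trans (app--ˡ (u v ⊖ shift u) (λ k → app (rotation u k) (p v)) (p v′))
        (trans (cong (λ z → pairing u v v′ - z) (rotation-form u B∋v B∋v′)) (p≡q⇒p-q≡0 pairing≡torque)))
      where
      eq : ∀ a b c → a - (b + c) ≡ (a - c) - b
      eq = solve-∀ ℚ-ring
      pairing≡torque : pairing u v v′ ≡ torque u v v′
      pairing≡torque with Fin.<-cmp v v′
      ... | tri< h _ _ = sym (torque-< u h)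
      ... | tri> _ _ h = contradiction v≤v′ (ℕ.<⇒≱ h)
      ... | tri≈ _ refl _ = trans (app--ˡ (u v) (shift u) (p v))
        (trans (p≡q⇒p-q≡0 (sym (app-shift u v B∋v))) (sym (torque-≡ u v)))

    -- The diagonal pins kill s first; the others then kill the form of S on all pairs of a basis.
    trivial-pinned : ∀ {S s} → Skew S → Pinned B p (trivial p S s) → (∀ k l → S k l ≡ 0ℚ) × (∀ k → s k ≡ 0ℚ)
    trivial-pinned {S} {s} skew pinned = S≡0 , s≡0
      where
      split : ∀ v v′ → app (trivial p S s v) (p v′) ≡ app (λ k → app (S k) (p v)) (p v′) + app s (p v′)
      split v v′ = app-+ˡ (λ k → app (S k) (p v)) s (p v′)
      s≡0 : ∀ k → s k ≡ 0ℚ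
      s≡0 = spanning B-covers s λ v B∋v → trans (sym (ℚ.+-identityˡ _))
        (trans (cong (_+ app s (p v)) (sym (skew-form-diagonal skew (p v)))) (trans (sym (split v v)) (pinned B∋v B∋v ℕ.≤-refl)))
      ordered : ∀ {v v′} → B ∋ v → B ∋ v′ → v Fin.≤ v′ → app (λ k → app (S k) (p v)) (p v′) ≡ 0ℚ
      ordered {v} {v′} B∋v B∋v′ h = trans (sym (ℚ.+-identityʳ _))
        (trans (cong (app (λ k → app (S k) (p v)) (p v′) +_) (sym (app-zeroˡ (p v′) s≡0))) (trans (sym (split v v′)) (pinned B∋v B∋v′ h)))
      form : ∀ {v v′} → B ∋ v → B ∋ v′ → app (λ k → app (S k) (p v)) (p v′) ≡ 0ℚ
      form {v} {v′} B∋v B∋v′ with Fin.≤-total v v′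
      ... | inj₁ h = ordered B∋v B∋v′ h
      ... | inj₂ h = trans (skew-form skew (p v) (p v′)) (cong -_ (ordered B∋v′ B∋v h))
      S≡0 : ∀ k l → S k l ≡ 0ℚ
      S≡0 k = spanning B-covers (S k) λ v B∋v → spanning B-covers (λ k → app (S k) (p v)) (λ v′ B∋v′ → form B∋v B∋v′) k

    -- After the adjusting trivial motion is subtracted, the pairings with v ≤ v′ vanish by the
    -- pins. The stretch of vv′ combines four pairings, three of them pinned, so the fourth vanishes
    -- as well.
    simplex-rigid : ∀ u → (∀ v v′ → B ∋ v → B ∋ v′ → Stretch p u v v′ ≡ 0ℚ) →
      ∀ v → B ∋ v → ∀ k → u v k ≡ trivial p (rotation u) (shift u) v k
    simplex-rigid u motion v B∋v k = p-q≡0⇒p≡q _ _ (spanning B-covers (adjusted u v) (λ v′ B∋v′ → all-0 B∋v B∋v′) k)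
      where
      all-0 : ∀ {v v′} → B ∋ v → B ∋ v′ → app (adjusted u v) (p v′) ≡ 0ℚ
      all-0 {v} {v′} B∋v B∋v′ with Fin.≤-total v v′
      ... | inj₁ h = adjusted-pinned u B∋v B∋v′ h
      ... | inj₂ h = begin
        app x (p v′)
          ≡⟨ eq (app x (p v)) (app x (p v′)) (app y (p v)) (app y (p v′)) ⟩
        app x (p v) + app y (p v′) - app y (p v) - ((app x (p v) - app y (p v)) - (app x (p v′) - app y (p v′)))
          ≡⟨ cong₂ (λ z z′ → z - z′) (cong₂ _-_ (cong₂ _+_ (adjusted-pinned u B∋v B∋v ℕ.≤-refl) (adjusted-pinned u B∋v′ B∋v′ ℕ.≤-refl)) (adjusted-pinned u B∋v′ B∋v h)) stretched ⟩
        0ℚ ∎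
        where
        open ≡-Reasoning
        x = adjusted u v
        y = adjusted u v′
        eq : ∀ xv xv′ yv yv′ → xv′ ≡ xv + yv′ - yv - ((xv - yv) - (xv′ - yv′))
        eq = solve-∀ ℚ-ring
        stretched : (app x (p v) - app y (p v)) - (app x (p v′) - app y (p v′)) ≡ 0ℚ
        stretched = trans (sym (trans (trans (app-comm (p v ⊖ p v′) (x ⊖ y)) (app--ʳ (x ⊖ y) (p v) (p v′)))
            (cong₂ _-_ (app--ˡ x y (p v)) (app--ˡ x y (p v′)))))
          (trans (stretch-mod-trivial p u (shift u) (rotation-skew u) v v′) (motion v v′ B∋v B∋v′))

-- Rigid frameworks as injective matrices

ForAll-Eventually : Set → Set₁
ForAll-Eventually A = ∀ {P : A → ℕ → Set} → (∀ a → Eventually (P a)) → Eventually (λ s → ∀ a → P a s)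

Fin-eventually : ∀ n → ForAll-Eventually (Fin n)
Fin-eventually zero h = 0 , λ _ _ ()
Fin-eventually (suc n) h = ev-map (λ { s (p , q) → λ { zero → p ; (suc i) → q i } }) (ev-× (h zero) (Fin-eventually n (h ∘ suc)))

Bool-eventually : ForAll-Eventually Bool
Bool-eventually h = ev-map (λ { s (p , q) → λ { true → p ; false → q } }) (ev-× (h true) (h false))

Vec-eventually : ∀ {A} → ForAll-Eventually A → ∀ n → ForAll-Eventually (Vec A n)
Vec-eventually A-ev zero h = ev-map (λ { s p [] → p }) (h [])
Vec-eventually A-ev (suc n) h = ev-map (λ { s p (x ∷ v) → p x v }) (A-ev λ x → Vec-eventually A-ev n λ v → h (x ∷ v))

_∋?_ : ∀ {n} (F : Subset n) v → Dec (F ∋ v)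
F ∋? v with ∋⊎∌ F v
... | inj₁ p = yes p
... | inj₂ q = no λ p → ∋-∌-contradiction p q

PolyLin : ∀ {N} → (ℚ → (Fin N → ℚ) → ℚ) → Set
PolyLin {N} φ = Σ (PolyRow N) λ r → ∀ t x → app (r at t) x ≡ φ t x

module _ {N : ℕ} where
  zero-lin : PolyLin {N} (λ _ _ → 0ℚ)
  zero-lin = ((λ _ _ → 0ℚ) , λ _ → const-poly 0ℚ) , λ t x → app-zeroˡ x (λ _ → refl)

  coordinate-lin : ∀ (j : Fin N) → PolyLin (λ _ x → x j)
  coordinate-lin j = ((λ i _ → if does (i Fin.≟ j) then 1ℚ else 0ℚ) , λ i → const-poly _) ,
    λ t x → trans (∑-single (λ i → (if does (i Fin.≟ j) then 1ℚ else 0ℚ) * x i) j (off x)) (on x)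
    where
    off : ∀ (x : Fin N → ℚ) i → i ≢ j → (if does (i Fin.≟ j) then 1ℚ else 0ℚ) * x i ≡ 0ℚ
    off x i ne rewrite dec-false (i Fin.≟ j) ne = ℚ.*-zeroˡ (x i)
    on : ∀ (x : Fin N → ℚ) → (if does (j Fin.≟ j) then 1ℚ else 0ℚ) * x j ≡ x j
    on x rewrite dec-true (j Fin.≟ j) refl = ℚ.*-identityˡ (x j)

  sub-lin : ∀ {φ ψ} → PolyLin φ → PolyLin ψ → PolyLin {N} (λ t x → φ t x - ψ t x)
  sub-lin ((α , A) , p) ((β , B) , q) = ((λ j t → α j t - β j t) , λ j → sub-poly (A j) (B j)) ,
    λ t x → trans (app--ˡ (λ j → α j t) (λ j → β j t) x) (cong₂ _-_ (p t x) (q t x))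

  add-lin : ∀ {φ ψ} → PolyLin φ → PolyLin ψ → PolyLin {N} (λ t x → φ t x + ψ t x)
  add-lin ((α , A) , p) ((β , B) , q) = ((λ j t → α j t + β j t) , λ j → +-poly (A j) (B j)) ,
    λ t x → trans (app-+ˡ (λ j → α j t) (λ j → β j t) x) (cong₂ _+_ (p t x) (q t x))

  scale-lin : ∀ {f φ} → IsPoly f → PolyLin φ → PolyLin {N} (λ t x → f t * φ t x)
  scale-lin {f} F ((α , A) , p) = ((λ j t → f t * α j t) , λ j → *-poly F (A j)) ,
    λ t x → trans (app-*ˡ (f t) (λ j → α j t) x) (cong (f t *_) (p t x))

  ∑-lin : ∀ {k} {φ : Fin k → ℚ → (Fin N → ℚ) → ℚ} → (∀ i → PolyLin (φ i)) → PolyLin (λ t x → ∑ λ i → φ i t x)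
  ∑-lin {zero} h = zero-lin
  ∑-lin {suc k} h = add-lin (h zero) (∑-lin (h ∘ suc))

module Position {n m} (a : Vec ℕ m) (κ : Fin n → Fin m) where
  open Curve a κ public
  open Frame a κ public

  -- Graphs as finite data, because the choice of each parameter quantifies over all of them.
  Adjacency : Set
  Adjacency = Vec (Subset n) n

  -- Pinning on B replaces the quotient by trivial motions, and vanishing outside U keeps n · d
  -- unknowns for every U. Rigidity on U thus becomes injectivity of a matrix.
  record Solves (E : Adjacency) (U B : Subset n) (p : Fin n → Row d) (u : Field) : Set where
    field
      edges : ∀ {v w} → U ∋ v → U ∋ w → lookup E v ∋ w → Stretch p u v w ≡ 0ℚ
      pins : Pinned B p u
      support : ∀ {v} → U ∌ v → ∀ k → u v k ≡ 0ℚ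
  open Solves public

  Determined : Adjacency → (U B : Subset n) → (Fin n → Row d) → Set
  Determined E U B p = ∀ u → Solves E U B p u → ∀ v k → u v k ≡ 0ℚ

  -- x and y are infinitesimally joined along the direction e.
  DeterminedAlong : Row d → (x y : Fin n) → Adjacency → (U B : Subset n) → (Fin n → Row d) → Set
  DeterminedAlong e x y E U B p = ∀ u → Solves E U B p u → app e (u y ⊖ u x) ≡ 0ℚ → ∀ v k → u v k ≡ 0ℚ

  solves-local : ∀ {E U B p p′ u} → (∀ {v} → U ∋ v → p v ≡ p′ v) → (∀ {v} → B ∋ v → U ∋ v) →
                 Solves E U B p u → Solves E U B p′ u
  solves-local {u = u} same B⊆U s = record
    { edges = λ {v} {w} U∋v U∋w e → trans (sym (cong₂ (λ x y → app (x ⊖ y) (u v ⊖ u w)) (same U∋v) (same U∋w))) (edges s U∋v U∋w e)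
    ; pins = λ {v} {w} B∋v B∋w h → trans (sym (cong (app (u v)) (same (B⊆U B∋w)))) (pins s B∋v B∋w h)
    ; support = support s }

  unflatten : (Fin (n ℕ.* d) → ℚ) → Field
  unflatten x v k = x (combine v k)

  flatten : Field → Fin (n ℕ.* d) → ℚ
  flatten u j = u (proj₁ (remQuot {n} d j)) (proj₂ (remQuot {n} d j))

  unflatten-flatten : ∀ u v k → unflatten (flatten u) v k ≡ u v k
  unflatten-flatten u v k = cong (λ z → u (proj₁ z) (proj₂ z)) (Fin.remQuot-combine {n} v k)

  solves-flatten : ∀ {E U B p u} → Solves E U B p u → Solves E U B p (unflatten (flatten u))
  solves-flatten {p = p} {u} s = record
    { edges = λ {v} {w} U∋v U∋w e → trans (app-congʳ (p v ⊖ p w) (λ k → cong₂ _-_ (unflatten-flatten u v k) (unflatten-flatten u w k))) (edges s U∋v U∋w e)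
    ; pins = λ {v} {w} B∋v B∋w h → trans (app-cong {x = p w} (unflatten-flatten u v) (λ _ → refl)) (pins s B∋v B∋w h)
    ; support = λ {v} U∌v k → trans (unflatten-flatten u v k) (support s U∌v k) }

  field-lin : ∀ v k → PolyLin (λ _ x → unflatten x v k)
  field-lin v k = coordinate-lin (combine v k)

  app-lin : ∀ {e : ℚ → Row d} {φ : Fin d → ℚ → (Fin (n ℕ.* d) → ℚ) → ℚ} → (∀ k → IsPoly (λ t → e t k)) → (∀ k → PolyLin (φ k)) →
            PolyLin (λ t x → app (e t) (λ k → φ k t x))
  app-lin E Φ = ∑-lin λ k → scale-lin (E k) (Φ k)

  module Rows (E : Adjacency) (U B : Subset n) {p : ℚ → Fin n → Row d} (P : ∀ v k → IsPoly (λ t → p t v k)) where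

    edge? : ∀ v w → Dec (U ∋ v × U ∋ w × lookup E v ∋ w)
    edge? v w = (U ∋? v) ×-dec ((U ∋? w) ×-dec (lookup E v ∋? w))

    pin? : ∀ v w → Dec (B ∋ v × B ∋ w × v Fin.≤ w)
    pin? v w = (B ∋? v) ×-dec ((B ∋? w) ×-dec (v Fin.≤? w))

    -- A condition that does not apply contributes a zero row, so rows can be tabulated over all
    -- index pairs.
    when : ∀ {C : Set} → Dec C → ∀ {φ} → PolyLin {n ℕ.* d} φ → PolyRow (n ℕ.* d)
    when (yes _) Φ = proj₁ Φ
    when (no _) _ = proj₁ zero-lin

    when⁺ : ∀ {ℓ} {C : Set} (Z : PolyRow (n ℕ.* d) → Set ℓ) (C? : Dec C) {φ} (Φ : PolyLin φ) →
            (C → Z (proj₁ Φ)) → Z (proj₁ zero-lin) → Z (when C? Φ)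
    when⁺ Z (yes c) Φ h z = h c
    when⁺ Z (no _) Φ h z = z

    when⁻ : ∀ {ℓ} {C : Set} (Z : PolyRow (n ℕ.* d) → Set ℓ) (C? : Dec C) {φ} (Φ : PolyLin φ) →
            C → Z (when C? Φ) → Z (proj₁ Φ)
    when⁻ Z (yes _) Φ c z = z
    when⁻ Z (no ¬c) Φ c z = contradiction c ¬c

    edge-lin : ∀ v w → PolyLin (λ t x → Stretch (p t) (unflatten x) v w)
    edge-lin v w = app-lin (λ k → sub-poly (P v k) (P w k)) (λ k → sub-lin (field-lin v k) (field-lin w k))

    pin-lin : ∀ v w → PolyLin (λ t x → app (p t w) (unflatten x v))
    pin-lin v w = app-lin (P w) (field-lin v)

    edge-row pin-row : Fin n → Fin n → PolyRow (n ℕ.* d)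
    edge-row v w = when (edge? v w) (edge-lin v w)
    pin-row v w = when (pin? v w) (pin-lin v w)

    support-row : Fin n → Fin d → PolyRow (n ℕ.* d)
    support-row v k = when (¬? (U ∋? v)) (field-lin v k)

    table : ∀ {j k} → (Fin j → Fin k → PolyRow (n ℕ.* d)) → List (PolyRow (n ℕ.* d))
    table {j} {k} f = List.cartesianProductWith f (List.allFin j) (List.allFin k)

    rows : List (PolyRow (n ℕ.* d))
    rows = table edge-row List.++ table pin-row List.++ table support-row

    module _ {ℓ} {Z : PolyRow (n ℕ.* d) → Set ℓ} where
      table⁺ : ∀ {j k} {f : Fin j → Fin k → PolyRow (n ℕ.* d)} → (∀ i l → Z (f i l)) → All Z (table f)
      table⁺ {j} {k} {f} h = All.tabulate λ q →
        let i , l , _ , _ , e = List.∈-cartesianProductWith⁻ f (List.allFin j) (List.allFin k) q in subst Z (sym e) (h i l)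

      table⁻ : ∀ {j k} {f : Fin j → Fin k → PolyRow (n ℕ.* d)} → All Z (table f) → ∀ i l → Z (f i l)
      table⁻ {f = f} h i l = All.lookup h (List.∈-cartesianProductWith⁺ f (List.∈-allFin i) (List.∈-allFin l))

    -- `Q` is "vanishes at a given vector" over the rationals and "is null along a given sequence"
    -- in the passage to the reals.
    Solved : ∀ {ℓ} (Q : ((Fin (n ℕ.* d) → ℚ) → ℚ) → Set ℓ) → ℚ → Set ℓ
    Solved Q t =
      (∀ {v w} → U ∋ v → U ∋ w → lookup E v ∋ w → Q (λ x → Stretch (p t) (unflatten x) v w)) ×
      (∀ {v w} → B ∋ v → B ∋ w → v Fin.≤ w → Q (λ x → app (p t w) (unflatten x v))) ×
      (∀ {v} → U ∌ v → ∀ k → Q (λ x → unflatten x v k))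

    rows-complete : ∀ {ℓ} (Q : ((Fin (n ℕ.* d) → ℚ) → ℚ) → Set ℓ) → (∀ {φ ψ} → (∀ x → φ x ≡ ψ x) → Q φ → Q ψ) → Q (λ _ → 0ℚ) →
      ∀ t → Solved Q t → All (λ r → Q (app r)) (List.map (_at t) rows)
    rows-complete Q resp Q0 t (e , p , s) = All.map⁺ (All.++⁺ (table⁺ edge) (All.++⁺ (table⁺ pin) (table⁺ supp)))
      where
      sound : ∀ {φ} (Φ : PolyLin φ) → Q (φ t) → Q (app (proj₁ Φ at t))
      sound {φ} Φ = resp {φ t} {app (proj₁ Φ at t)} λ x → sym (proj₂ Φ t x)
      zero′ : Q (app (proj₁ zero-lin at t))
      zero′ = sound zero-lin Q0
      edge : ∀ v w → Q (app (edge-row v w at t))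
      edge v w = when⁺ (λ r → Q (app (r at t))) (edge? v w) (edge-lin v w) (λ (a , b , c) → sound (edge-lin v w) (e a b c)) zero′
      pin : ∀ v w → Q (app (pin-row v w at t))
      pin v w = when⁺ (λ r → Q (app (r at t))) (pin? v w) (pin-lin v w) (λ (a , b , c) → sound (pin-lin v w) (p a b c)) zero′
      supp : ∀ v k → Q (app (support-row v k at t))
      supp v k = when⁺ (λ r → Q (app (r at t))) (¬? (U ∋? v)) (field-lin v k) (λ h → sound (field-lin v k) (s (¬∋⇒∌ h) k)) zero′

    rows-sound : ∀ t x → All (λ r → app r x ≡ 0ℚ) (List.map (_at t) rows) → Solves E U B (p t) (unflatten x)
    rows-sound t x h = record { edges = edge ; pins = pin ; support = supp }
      where
      h′ = All.map⁻ h
      h₁ = All.++⁻ˡ (table edge-row) h′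
      h₂ = All.++⁻ˡ (table pin-row) (All.++⁻ʳ (table edge-row) h′)
      h₃ = All.++⁻ʳ (table pin-row) (All.++⁻ʳ (table edge-row) h′)
      Z : PolyRow (n ℕ.* d) → Set
      Z r = app (r at t) x ≡ 0ℚ
      edge : ∀ {v w} → U ∋ v → U ∋ w → lookup E v ∋ w → Stretch (p t) (unflatten x) v w ≡ 0ℚ
      edge {v} {w} a b c = trans (sym (proj₂ (edge-lin v w) t x))
        (when⁻ Z (edge? v w) (edge-lin v w) (a , b , c) (table⁻ {Z = Z} {f = edge-row} h₁ v w))
      pin : Pinned B (p t) (unflatten x)
      pin {v} {w} a b c = trans (app-comm (unflatten x v) (p t w)) (trans (sym (proj₂ (pin-lin v w) t x))
        (when⁻ Z (pin? v w) (pin-lin v w) (a , b , c) (table⁻ {Z = Z} {f = pin-row} h₂ v w)))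
      supp : ∀ {v} → U ∌ v → ∀ k → unflatten x v k ≡ 0ℚ
      supp {v} U∌v k = trans (sym (proj₂ (field-lin v k) t x))
        (when⁻ Z (¬? (U ∋? v)) (field-lin v k) (λ U∋v → ∋-∌-contradiction U∋v U∌v) (table⁻ {Z = Z} {f = support-row} h₃ v k))

  flatten-zero : ∀ {x : Fin (n ℕ.* d) → ℚ} → (∀ v k → unflatten x v k ≡ 0ℚ) → ∀ j → x j ≡ 0ℚ
  flatten-zero {x} h j = trans (cong x (sym (Fin.combine-remQuot {n} d j))) (h _ _)

  solves-flattened : ∀ {E U B} {p : ℚ → Fin n → Row d} (P : ∀ v k → IsPoly (λ t → p t v k)) t {u} → Solves E U B (p t) u →
    All (λ r → app r (flatten u) ≡ 0ℚ) (List.map (_at t) (Rows.rows E U B P))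
  solves-flattened {E} {U} {B} {p} P t {u} s = Rows.rows-complete E U B P (λ φ → φ (flatten u) ≡ 0ℚ)
    (λ e q → trans (sym (e (flatten u))) q) refl t
    ((λ a b c → edges s′ a b c) , (λ {v} {w} a b c → trans (app-comm (p t w) _) (pins s′ a b c)) , support s′)
    where
    s′ = solves-flatten s

  Along-open : ∀ E U B x y {p : ℚ → Fin n → Row d} (P : ∀ v k → IsPoly (λ t → p t v k))
    {e : ℚ → Row d} (e-poly : ∀ k → IsPoly (λ t → e t k)) t₀ →
    Eventually λ s → DeterminedAlong (e t₀) x y E U B (p t₀) → DeterminedAlong (e (ι s)) x y E U B (p (ι s))
  Along-open E U B x y {p} P {e} e-poly t₀ = ev-map
    (λ s step det u sol along v k → trans (sym (unflatten-flatten u v k))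
      (step (from-det det) (flatten u)
        (trans (proj₂ along-lin (ι s) (flatten u)) (trans (app-congʳ (e (ι s)) (λ k → cong₂ _-_ (unflatten-flatten u y k) (unflatten-flatten u x k))) along)
         ∷ solves-flattened P (ι s) sol) (combine v k)))
    (Inj-open (proj₁ along-lin ∷ Rows.rows E U B P) t₀)
    where
    along-lin : PolyLin (λ t z → app (e t) (unflatten z y ⊖ unflatten z x))
    along-lin = app-lin e-poly (λ k → sub-lin (field-lin y k) (field-lin x k))
    from-det : DeterminedAlong (e t₀) x y E U B (p t₀) → Inj (List.map (_at t₀) (proj₁ along-lin ∷ Rows.rows E U B P))
    from-det det z (z₀ ∷ zs) = flatten-zero (det (unflatten z) (Rows.rows-sound E U B P t₀ z zs)
      (trans (sym (proj₂ along-lin t₀ z)) z₀))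

-- Choice of the placement

module Choice {n m} (a : Vec ℕ m) (κ : Fin n → Fin m) where
  open Position a κ

  place : (Fin n → ℕ) → Fin n → Row d
  place τ v = μ (κ v) (ι (τ v))

  move : (Fin n → ℕ) → Fin n → ℚ → Fin n → Row d
  move τ y s v = if does (v Fin.≟ y) then μ (κ y) s else place τ v

  move-≡ : ∀ τ y s → move τ y s y ≡ μ (κ y) s
  move-≡ τ y s rewrite dec-true (y Fin.≟ y) refl = refl

  move-≢ : ∀ τ {y v} s → v ≢ y → move τ y s v ≡ place τ v
  move-≢ τ {y} {v} s ne rewrite dec-false (v Fin.≟ y) ne = refl

  move-cong : ∀ τ τ′ y s v → (v ≢ y → τ v ≡ τ′ v) → move τ y s v ≡ move τ′ y s v
  move-cong τ τ′ y s v h with v Fin.≟ y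
  ... | yes _ = refl
  ... | no ne = cong (μ (κ v) ∘ ι) (h ne)

  move-poly : ∀ τ y v k → IsPoly (λ s → move τ y s v k)
  move-poly τ y v k with v Fin.≟ y
  ... | yes _ = μ-poly (κ y) k
  ... | no _ = const-poly (place τ v k)

  record Admissible (E : Adjacency) (U B : Subset n) (x y : Fin n) : Set where
    field
      same-colour : κ x ≡ κ y
      before : x Fin.< y
      x∈U : U ∋ x
      y∈U : U ∋ y
      joined : lookup E y ∋ x
      bounded : ∀ {v} → U ∋ v → v Fin.≤ y
      pins⊆U : ∀ {v} → B ∋ v → U ∋ v
  open Admissible public

  -- With y on top of x, the edge xy has length 0 and imposes nothing; the constraint along the
  -- tangent at x takes its place.
  Limit : (Fin n → ℕ) → Adjacency → (U B : Subset n) → (x y : Fin n) → Set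
  Limit τ E U B x y = DeterminedAlong (η (κ y) (ι (τ x)) (ι (τ x))) x y E U B (move τ y (ι (τ x)))

  -- The position of y is generic over the positions of the earlier vertices:
  -- a framework that is determined in the limit y → x is determined.
  Opened : (Fin n → ℕ) → Fin n → Set
  Opened τ y = ∀ E U B x → Admissible E U B x y → Limit τ E U B x y → Determined E U B (place τ)

  Limit-local : ∀ τ τ′ {E U B x y} → Admissible E U B x y → (∀ {v} → v Fin.< y → τ v ≡ τ′ v) →
                Limit τ′ E U B x y → Limit τ E U B x y
  Limit-local τ τ′ {E} {U} {B} {x} {y} adm agree lim u sol along = lim u
    (subst (λ r → Solves E U B (move τ′ y (ι r)) u) (agree (before adm))
      (solves-local (λ {v} U∋v → move-cong τ τ′ y (ι (τ x)) v λ ne → agree (Fin.≤∧≢⇒< (bounded adm U∋v) ne)) (pins⊆U adm) sol))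
    (subst (λ r → app (η (κ y) (ι r) (ι r)) (u y ⊖ u x) ≡ 0ℚ) (agree (before adm)) along)

  -- An admissible U has no vertex after y, so parameters chosen later cannot spoil the condition.
  Opened-local : ∀ {τ τ′} y → (∀ {v} → v Fin.≤ y → τ v ≡ τ′ v) → Opened τ y → Opened τ′ y
  Opened-local {τ} {τ′} y agree op E U B x adm lim u sol =
    op E U B x adm (Limit-local τ τ′ adm (agree ∘ ℕ.<⇒≤) lim) u
      (solves-local (λ {v} U∋v → cong (μ (κ v) ∘ ι) (sym (agree (bounded adm U∋v)))) (pins⊆U adm) sol)

  update : (Fin n → ℕ) → Fin n → ℕ → Fin n → ℕ
  update τ y s v = if does (v Fin.≟ y) then s else τ v

  update-≡ : ∀ τ y s → update τ y s y ≡ s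
  update-≡ τ y s rewrite dec-true (y Fin.≟ y) refl = refl

  update-≢ : ∀ τ {y v} s → v ≢ y → update τ y s v ≡ τ v
  update-≢ τ {y} {v} s ne rewrite dec-false (v Fin.≟ y) ne = refl

  place-update : ∀ τ y s v → move τ y (ι s) v ≡ place (update τ y s) v
  place-update τ y s v with v Fin.≟ y
  ... | yes refl = refl
  ... | no _ = refl

  open-step : ∀ τ y → Eventually λ s → ∀ E U B x →
    (τ x ℕ.< s) × (Limit τ E U B x y → DeterminedAlong (η (κ y) (ι (τ x)) (ι s)) x y E U B (move τ y (ι s)))
  open-step τ y =
    Vec-eventually (Vec-eventually Bool-eventually n) n λ E →
    Vec-eventually Bool-eventually n λ U →
    Vec-eventually Bool-eventually n λ B →
    Fin-eventually n λ x →
    ev-× (suc (τ x) , λ s h → h)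
         (Along-open E U B x y (move-poly τ y) (η-poly (κ y) (ι (τ x))) (ι (τ x)))

  -- The edge vector p y - p x is s - τ x times the divided difference. As the parameters differ,
  -- the edge equation gives the constraint along the latter.
  along-edge : ∀ {τ E U B x y s} → Admissible E U B x y → τ x ≢ s →
    DeterminedAlong (η (κ y) (ι (τ x)) (ι s)) x y E U B (move τ y (ι s)) → Determined E U B (move τ y (ι s))
  along-edge {τ} {E} {U} {B} {x} {y} {s} adm ne det u sol = det u sol
    (*-cancel-≢0 (λ e → ne (sym (ι-injective (p-q≡0⇒p≡q (ι s) (ι (τ x)) e)))) (begin
      (ι s - ι (τ x)) * app (η (κ y) (ι (τ x)) (ι s)) (u y ⊖ u x)
        ≡⟨ app-*ˡ (ι s - ι (τ x)) (η (κ y) (ι (τ x)) (ι s)) (u y ⊖ u x) ⟨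
      app (λ j → (ι s - ι (τ x)) * η (κ y) (ι (τ x)) (ι s) j) (u y ⊖ u x)
        ≡⟨ app-cong {x = u y ⊖ u x} (λ j → trans (η-* (κ y) (ι (τ x)) (ι s) j) (sym (ends j))) (λ _ → refl) ⟩
      Stretch (move τ y (ι s)) u y x
        ≡⟨ edges sol (y∈U adm) (x∈U adm) (joined adm) ⟩
      0ℚ ∎))
    where
    open ≡-Reasoning
    ends : ∀ j → (move τ y (ι s) y ⊖ move τ y (ι s) x) j ≡ μ (κ y) (ι s) j - μ (κ y) (ι (τ x)) j
    ends j = cong₂ _-_ (cong (λ r → r j) (move-≡ τ y (ι s)))
      (cong (λ r → r j) (trans (move-≢ τ (ι s) (Fin.<⇒≢ (before adm))) (cong (λ i → μ i (ι (τ x))) (same-colour adm))))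

  record GoodBelow (k : ℕ) (τ : Fin n → ℕ) : Set where
    field
      positive : ∀ v → toℕ v ℕ.< k → 1 ≤ τ v
      increasing : ∀ {u v} → u Fin.< v → toℕ v ℕ.< k → τ u ℕ.< τ v
      opened : ∀ v → toℕ v ℕ.< k → Opened τ v
  open GoodBelow

  good-step : ∀ τ (y : Fin n) s → 1 ≤ s →
    (∀ E U B x → (τ x ℕ.< s) × (Limit τ E U B x y → DeterminedAlong (η (κ y) (ι (τ x)) (ι s)) x y E U B (move τ y (ι s)))) →
    GoodBelow (toℕ y) τ → GoodBelow (suc (toℕ y)) (update τ y s)
  good-step τ y s 1≤s step good = record { positive = pos ; increasing = inc ; opened = opn }
    where
    τ′ = update τ y s
    old : ∀ {v} → v Fin.< y → τ v ≡ τ′ v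
    old h = sym (update-≢ τ s (Fin.<⇒≢ h))
    cases : ∀ v → toℕ v ℕ.< suc (toℕ y) → v ≡ y ⊎ v Fin.< y
    cases v h with v Fin.≟ y
    ... | yes e = inj₁ e
    ... | no ne = inj₂ (Fin.≤∧≢⇒< (ℕ.s≤s⁻¹ h) ne)
    pos : ∀ v → toℕ v ℕ.< suc (toℕ y) → 1 ≤ τ′ v
    pos v h with cases v h
    ... | inj₁ refl = subst (1 ≤_) (sym (update-≡ τ y s)) 1≤s
    ... | inj₂ v<y = subst (1 ≤_) (old v<y) (positive good v v<y)
    ∅ : Subset n
    ∅ = Vec.replicate n false
    inc : ∀ {u v} → u Fin.< v → toℕ v ℕ.< suc (toℕ y) → τ′ u ℕ.< τ′ v
    inc {u} {v} u<v h with cases v h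
    -- The inequality supplied by `step` is the same for every framework; the empty one serves.
    ... | inj₁ refl = subst₂ ℕ._<_ (old u<v) (sym (update-≡ τ y s)) (proj₁ (step (Vec.replicate n ∅) ∅ ∅ u))
    ... | inj₂ v<y = subst₂ ℕ._<_ (old (Fin.<-trans u<v v<y)) (old v<y) (increasing good u<v v<y)
    opn : ∀ v → toℕ v ℕ.< suc (toℕ y) → Opened τ′ v
    opn v h with cases v h
    ... | inj₂ v<y = Opened-local v (λ u≤v → old (ℕ.≤-<-trans u≤v v<y)) (opened good v v<y)
    ... | inj₁ refl = λ E U B x adm lim u sol →
      let x<s , det = step E U B x
      in along-edge adm (ℕ.<⇒≢ x<s) (det (Limit-local τ τ′ adm old lim)) u
           (solves-local (λ {w} _ → sym (place-update τ y s w)) (pins⊆U adm) sol)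

  good-below : ∀ k → k ≤ n → ∃[ τ ] GoodBelow k τ
  good-below zero h = (λ _ → 0) , record { positive = λ _ () ; increasing = λ _ () ; opened = λ _ () }
  good-below (suc k) h =
    let τ , good = good-below k (ℕ.<⇒≤ h)
        y = Fin.fromℕ< h
        e = Fin.toℕ-fromℕ< h
        N , step = open-step τ y
    -- `suc N` instead of `N`: parameter 0 would put the vertex at the origin.
    in update τ y (suc N) , subst (λ k → GoodBelow (suc k) (update τ y (suc N))) e
         (good-step τ y (suc N) (ℕ.s≤s ℕ.z≤n) (step (suc N) (ℕ.n≤1+n N)) (subst (λ k → GoodBelow k τ) (sym e) good))

  record Placement : Set where
    field
      τ : Fin n → ℕ
      τ-inj : ∀ {u v} → ι (τ u) ≡ ι (τ v) → u ≡ v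
      τ≢0 : ∀ v → ι (τ v) ≢ 0ℚ
      open-at : ∀ y → Opened τ y

  placement : Placement
  placement with τ , good ← good-below n ℕ.≤-refl = record
    { τ = τ
    ; τ-inj = λ {u} {v} e → inj u v (ι-injective e)
    ; τ≢0 = λ v e → ℕ.<⇒≢ (positive good v (Fin.toℕ<n v)) (sym (ι-injective e))
    ; open-at = λ y → opened good y (Fin.toℕ<n y) }
    where
    inj : ∀ u v → τ u ≡ τ v → u ≡ v
    inj u v e with Fin.<-cmp u v
    ... | tri< h _ _ = contradiction e (ℕ.<⇒≢ (increasing good h (Fin.toℕ<n v)))
    ... | tri> _ _ h = contradiction (sym e) (ℕ.<⇒≢ (increasing good h (Fin.toℕ<n u)))
    ... | tri≈ _ h _ = h

-- Chain calculus in the exterior algebra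

module ChainAlgebra {g ℓ} (Γ : AbelianGroup g ℓ) where
  open AbelianGroup Γ public
    renaming (_∙_ to _⊕_; ε to 𝟘; _⁻¹ to ⊝_; Carrier to G; refl to ≈-refl; sym to ≈-sym; trans to ≈-trans;
              reflexive to ≈-reflexive; assoc to ⊕-assoc; comm to ⊕-comm; identityˡ to ⊕-identityˡ;
              identityʳ to ⊕-identityʳ; inverseˡ to ⊝-inverseˡ; inverseʳ to ⊝-inverseʳ;
              ∙-cong to ⊕-cong; ∙-congˡ to ⊕-congˡ; ∙-congʳ to ⊕-congʳ; ⁻¹-cong to ⊝-cong)
    using (_≈_)
  open AbelianGroupProperties Γ public
    renaming (⁻¹-involutive to ⊝-involutive; ε⁻¹≈ε to ⊝𝟘≈𝟘; ⁻¹-∙-comm to ⊝-⊕-comm) using ()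
  open CommutativeSemigroupProperties (AbelianGroup.commutativeSemigroup Γ) using (interchange)
  open import Relation.Binary.Reasoning.Setoid (AbelianGroup.setoid Γ)

  -- Coefficients on subsets of all sizes at once; homogeneity returns later as a property of the
  -- faces in the support.
  Ch : ℕ → Set g
  Ch n = Subset n → G

  infix 4 _≐_
  infixl 6 _⊞_
  infix 8 ⊟_
  _≐_ : ∀ {n} → Ch n → Ch n → Set ℓ
  b ≐ c = ∀ F → b F ≈ c F

  _⊞_ : ∀ {n} → Ch n → Ch n → Ch n
  (b ⊞ c) F = b F ⊕ c F

  ⊟_ : ∀ {n} → Ch n → Ch n
  (⊟ c) F = ⊝ c F

  𝕆 : ∀ {n} → Ch n
  𝕆 F = 𝟘

  out inn : ∀ {n} → Ch (suc n) → Ch n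
  out c F = c (false ∷ F)
  inn c F = c (true ∷ F)

  -- On the exterior algebra, wedge v is multiplication by v, hook v is the contraction with the dual of v,
  -- and ∂ is the sum of all hooks.
  ∂ : ∀ {n} → Ch n → Ch n
  ∂ {zero} c F = 𝟘
  ∂ {suc n} c (false ∷ F) = ∂ (out c) F ⊕ c (true ∷ F)
  ∂ {suc n} c (true ∷ F) = ⊝ ∂ (inn c) F

  wedge hook : ∀ {n} → Fin n → Ch n → Ch n
  wedge zero c (false ∷ F) = 𝟘
  wedge zero c (true ∷ F) = c (false ∷ F)
  wedge (suc v) c (false ∷ F) = wedge v (out c) F
  wedge (suc v) c (true ∷ F) = ⊝ wedge v (inn c) F

  hook zero c (false ∷ F) = c (true ∷ F)
  hook zero c (true ∷ F) = 𝟘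
  hook (suc v) c (false ∷ F) = hook v (out c) F
  hook (suc v) c (true ∷ F) = ⊝ hook v (inn c) F

  𝟘⊕𝟘 : 𝟘 ⊕ 𝟘 ≈ 𝟘
  𝟘⊕𝟘 = ⊕-identityˡ 𝟘

  ⊝-zero : ∀ {x} → x ≈ 𝟘 → ⊝ x ≈ 𝟘
  ⊝-zero e = ≈-trans (⊝-cong e) ⊝𝟘≈𝟘

  ⊝-zero⁻ : ∀ {x} → ⊝ x ≈ 𝟘 → x ≈ 𝟘
  ⊝-zero⁻ {x} e = ≈-trans (≈-sym (⊝-involutive x)) (⊝-zero e)

  ⊕-zero : ∀ {x y} → x ≈ 𝟘 → y ≈ 𝟘 → x ⊕ y ≈ 𝟘
  ⊕-zero p q = ≈-trans (⊕-cong p q) 𝟘⊕𝟘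

  ⊝-unique : ∀ {x y} → x ⊕ y ≈ 𝟘 → x ≈ ⊝ y
  ⊝-unique {x} {y} e = begin
    x ≈⟨ ⊕-identityʳ x ⟨
    x ⊕ 𝟘 ≈⟨ ⊕-congˡ (⊝-inverseʳ y) ⟨
    x ⊕ (y ⊕ ⊝ y) ≈⟨ ⊕-assoc x y (⊝ y) ⟨
    (x ⊕ y) ⊕ ⊝ y ≈⟨ ⊕-congʳ e ⟩
    𝟘 ⊕ ⊝ y ≈⟨ ⊕-identityˡ (⊝ y) ⟩
    ⊝ y ∎

  record Linear {n} (L : Ch n → Ch n) : Set (g ⊔ ℓ) where
    field
      L-cong : ∀ {b c} → b ≐ c → L b ≐ L c
      L-⊞ : ∀ b c → L (b ⊞ c) ≐ L b ⊞ L c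
    L-𝕆 : ∀ {c} → c ≐ 𝕆 → L c ≐ 𝕆
    L-𝕆 {c} e F = begin
      L c F ≈⟨ ⊕-identityʳ (L c F) ⟨
      L c F ⊕ 𝟘 ≈⟨ ⊕-congˡ (⊝-inverseʳ (L c F)) ⟨
      L c F ⊕ (L c F ⊕ ⊝ L c F) ≈⟨ ⊕-assoc (L c F) (L c F) (⊝ L c F) ⟨
      (L c F ⊕ L c F) ⊕ ⊝ L c F ≈⟨ ⊕-congʳ (≈-sym (L-⊞ c c F)) ⟩
      L (c ⊞ c) F ⊕ ⊝ L c F ≈⟨ ⊕-congʳ (L-cong (λ H → ≈-trans (⊕-congˡ (e H)) (⊕-identityʳ (c H))) F) ⟩
      L c F ⊕ ⊝ L c F ≈⟨ ⊝-inverseʳ (L c F) ⟩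
      𝟘 ∎
    L-⊟ : ∀ c → L (⊟ c) ≐ ⊟ L c
    L-⊟ c F = ⊝-unique (≈-trans (≈-sym (L-⊞ (⊟ c) c F)) (L-𝕆 (λ H → ⊝-inverseˡ (c H)) F))
  open Linear

  ∂-linear : ∀ {n} → Linear (∂ {n})
  L-cong (∂-linear {zero}) e F = ≈-refl
  L-cong (∂-linear {suc n}) e (false ∷ F) = ⊕-cong (L-cong ∂-linear (e ∘ (false ∷_)) F) (e (true ∷ F))
  L-cong (∂-linear {suc n}) e (true ∷ F) = ⊝-cong (L-cong ∂-linear (e ∘ (true ∷_)) F)
  L-⊞ (∂-linear {zero}) b c F = ≈-sym 𝟘⊕𝟘
  L-⊞ (∂-linear {suc n}) b c (false ∷ F) = ≈-trans (⊕-congʳ (L-⊞ ∂-linear (out b) (out c) F)) (interchange _ _ _ _)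
  L-⊞ (∂-linear {suc n}) b c (true ∷ F) = ≈-trans (⊝-cong (L-⊞ ∂-linear (inn b) (inn c) F)) (≈-sym (⊝-⊕-comm _ _))

  wedge-linear : ∀ {n} (v : Fin n) → Linear (wedge v)
  L-cong (wedge-linear zero) e (false ∷ F) = ≈-refl
  L-cong (wedge-linear zero) e (true ∷ F) = e (false ∷ F)
  L-cong (wedge-linear (suc v)) e (false ∷ F) = L-cong (wedge-linear v) (e ∘ (false ∷_)) F
  L-cong (wedge-linear (suc v)) e (true ∷ F) = ⊝-cong (L-cong (wedge-linear v) (e ∘ (true ∷_)) F)
  L-⊞ (wedge-linear zero) b c (false ∷ F) = ≈-sym 𝟘⊕𝟘
  L-⊞ (wedge-linear zero) b c (true ∷ F) = ≈-refl
  L-⊞ (wedge-linear (suc v)) b c (false ∷ F) = L-⊞ (wedge-linear v) (out b) (out c) F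
  L-⊞ (wedge-linear (suc v)) b c (true ∷ F) = ≈-trans (⊝-cong (L-⊞ (wedge-linear v) (inn b) (inn c) F)) (≈-sym (⊝-⊕-comm _ _))

  hook-linear : ∀ {n} (v : Fin n) → Linear (hook v)
  L-cong (hook-linear zero) e (false ∷ F) = e (true ∷ F)
  L-cong (hook-linear zero) e (true ∷ F) = ≈-refl
  L-cong (hook-linear (suc v)) e (false ∷ F) = L-cong (hook-linear v) (e ∘ (false ∷_)) F
  L-cong (hook-linear (suc v)) e (true ∷ F) = ⊝-cong (L-cong (hook-linear v) (e ∘ (true ∷_)) F)
  L-⊞ (hook-linear zero) b c (false ∷ F) = ≈-refl
  L-⊞ (hook-linear zero) b c (true ∷ F) = ≈-sym 𝟘⊕𝟘
  L-⊞ (hook-linear (suc v)) b c (false ∷ F) = L-⊞ (hook-linear v) (out b) (out c) F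
  L-⊞ (hook-linear (suc v)) b c (true ∷ F) = ≈-trans (⊝-cong (L-⊞ (hook-linear v) (inn b) (inn c) F)) (≈-sym (⊝-⊕-comm _ _))

  ⊝-L-⊟ : ∀ {n} {L : Ch n → Ch n} → Linear L → ∀ c F → ⊝ L (⊟ c) F ≈ L c F
  ⊝-L-⊟ lin c F = ≈-trans (⊝-cong (L-⊟ lin c F)) (⊝-involutive _)

  ∂∂ : ∀ {n} (c : Ch n) → ∂ (∂ c) ≐ 𝕆
  ∂∂ {zero} c F = ≈-refl
  ∂∂ {suc n} c (false ∷ F) = begin
    ∂ (∂ (out c) ⊞ inn c) F ⊕ ⊝ ∂ (inn c) F ≈⟨ ⊕-congʳ (L-⊞ ∂-linear (∂ (out c)) (inn c) F) ⟩
    (∂ (∂ (out c)) F ⊕ ∂ (inn c) F) ⊕ ⊝ ∂ (inn c) F ≈⟨ ⊕-congʳ (≈-trans (⊕-congʳ (∂∂ (out c) F)) (⊕-identityˡ _)) ⟩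
    ∂ (inn c) F ⊕ ⊝ ∂ (inn c) F ≈⟨ ⊝-inverseʳ _ ⟩
    𝟘 ∎
  ∂∂ {suc n} c (true ∷ F) = ≈-trans (⊝-L-⊟ ∂-linear (∂ (inn c)) F) (∂∂ (inn c) F)

  -- The Leibniz rule: coning with v is a contracting homotopy of the full simplex.
  ∂-wedge : ∀ {n} (v : Fin n) c F → ∂ (wedge v c) F ⊕ wedge v (∂ c) F ≈ c F
  ∂-wedge zero c (false ∷ F) = begin
    (∂ 𝕆 F ⊕ c (false ∷ F)) ⊕ 𝟘 ≈⟨ ⊕-identityʳ _ ⟩
    ∂ 𝕆 F ⊕ c (false ∷ F) ≈⟨ ⊕-congʳ (L-𝕆 ∂-linear (λ _ → ≈-refl) F) ⟩
    𝟘 ⊕ c (false ∷ F) ≈⟨ ⊕-identityˡ _ ⟩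
    c (false ∷ F) ∎
  ∂-wedge zero c (true ∷ F) = begin
    ⊝ ∂ (out c) F ⊕ (∂ (out c) F ⊕ c (true ∷ F)) ≈⟨ ⊕-assoc _ _ _ ⟨
    (⊝ ∂ (out c) F ⊕ ∂ (out c) F) ⊕ c (true ∷ F) ≈⟨ ⊕-congʳ (⊝-inverseˡ _) ⟩
    𝟘 ⊕ c (true ∷ F) ≈⟨ ⊕-identityˡ _ ⟩
    c (true ∷ F) ∎
  ∂-wedge (suc v) c (false ∷ F) = begin
    (∂ (wedge v (out c)) F ⊕ ⊝ wedge v (inn c) F) ⊕ wedge v (∂ (out c) ⊞ inn c) F
      ≈⟨ ⊕-congˡ (≈-trans (L-⊞ (wedge-linear v) (∂ (out c)) (inn c) F) (⊕-comm _ _)) ⟩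
    (∂ (wedge v (out c)) F ⊕ ⊝ wedge v (inn c) F) ⊕ (wedge v (inn c) F ⊕ wedge v (∂ (out c)) F)
      ≈⟨ ⊕-assoc _ _ _ ⟩
    ∂ (wedge v (out c)) F ⊕ (⊝ wedge v (inn c) F ⊕ (wedge v (inn c) F ⊕ wedge v (∂ (out c)) F))
      ≈⟨ ⊕-congˡ (≈-trans (≈-sym (⊕-assoc _ _ _)) (≈-trans (⊕-congʳ (⊝-inverseˡ _)) (⊕-identityˡ _))) ⟩
    ∂ (wedge v (out c)) F ⊕ wedge v (∂ (out c)) F
      ≈⟨ ∂-wedge v (out c) F ⟩
    c (false ∷ F) ∎
  ∂-wedge (suc v) c (true ∷ F) = ≈-trans
    (⊕-cong (⊝-L-⊟ ∂-linear (wedge v (inn c)) F) (⊝-L-⊟ (wedge-linear v) (∂ (inn c)) F))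
    (∂-wedge v (inn c) F)

  ∂-hook : ∀ {n} (v : Fin n) c F → ∂ (hook v c) F ≈ ⊝ hook v (∂ c) F
  ∂-hook zero c (false ∷ F) = ≈-trans (⊕-identityʳ _) (≈-sym (⊝-involutive _))
  ∂-hook zero c (true ∷ F) = ⊝-cong (L-𝕆 ∂-linear (λ _ → ≈-refl) F)
  ∂-hook (suc v) c (false ∷ F) = begin
    ∂ (hook v (out c)) F ⊕ ⊝ hook v (inn c) F ≈⟨ ⊕-congʳ (∂-hook v (out c) F) ⟩
    ⊝ hook v (∂ (out c)) F ⊕ ⊝ hook v (inn c) F ≈⟨ ⊝-⊕-comm _ _ ⟩
    ⊝ (hook v (∂ (out c)) F ⊕ hook v (inn c) F) ≈⟨ ⊝-cong (L-⊞ (hook-linear v) (∂ (out c)) (inn c) F) ⟨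
    ⊝ hook v (∂ (out c) ⊞ inn c) F ∎
  ∂-hook (suc v) c (true ∷ F) = begin
    ⊝ ∂ (⊟ hook v (inn c)) F ≈⟨ ⊝-L-⊟ ∂-linear (hook v (inn c)) F ⟩
    ∂ (hook v (inn c)) F ≈⟨ ∂-hook v (inn c) F ⟩
    ⊝ hook v (∂ (inn c)) F ≈⟨ L-⊟ (hook-linear v) (∂ (inn c)) F ⟨
    hook v (⊟ ∂ (inn c)) F ≈⟨ ⊝-involutive _ ⟨
    ⊝ ⊝ hook v (⊟ ∂ (inn c)) F ∎

  wedge-local : ∀ {n} (v : Fin n) {b c} F → b (del v F) ≈ c (del v F) → wedge v b F ≈ wedge v c F
  wedge-local zero (false ∷ F) e = ≈-refl
  wedge-local zero (true ∷ F) e = e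
  wedge-local (suc v) (false ∷ F) e = wedge-local v F e
  wedge-local (suc v) (true ∷ F) e = ⊝-cong (wedge-local v F e)

  wedge-∌ : ∀ {n} (v : Fin n) c {F} → F ∌ v → wedge v c F ≈ 𝟘
  wedge-∌ zero c {false ∷ F} _ = ≈-refl
  wedge-∌ (suc v) c {false ∷ F} ∌⟨ e ⟩ = wedge-∌ v (out c) ∌⟨ e ⟩
  wedge-∌ (suc v) c {true ∷ F} ∌⟨ e ⟩ = ⊝-zero (wedge-∌ v (inn c) ∌⟨ e ⟩)

  wedge-zero : ∀ {n} (v : Fin n) {c} F → c (del v F) ≈ 𝟘 → wedge v c F ≈ 𝟘
  wedge-zero v {c} F e = ≈-trans (wedge-local v {c} {𝕆} F e) (L-𝕆 (wedge-linear v) (λ _ → ≈-refl) F)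

  wedge-zero⁻ : ∀ {n} (v : Fin n) {c F} → F ∋ v → wedge v c F ≈ 𝟘 → c (del v F) ≈ 𝟘
  wedge-zero⁻ zero {F = true ∷ F} _ e = e
  wedge-zero⁻ (suc v) {F = false ∷ F} ∋⟨ p ⟩ e = wedge-zero⁻ v ∋⟨ p ⟩ e
  wedge-zero⁻ (suc v) {F = true ∷ F} ∋⟨ p ⟩ e = wedge-zero⁻ v ∋⟨ p ⟩ (⊝-zero⁻ e)

  hook-local : ∀ {n} (v : Fin n) {b c} F → b (add v F) ≈ c (add v F) → hook v b F ≈ hook v c F
  hook-local zero (false ∷ F) e = e
  hook-local zero (true ∷ F) e = ≈-refl
  hook-local (suc v) (false ∷ F) e = hook-local v F e
  hook-local (suc v) (true ∷ F) e = ⊝-cong (hook-local v F e)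

  hook-zero : ∀ {n} (v : Fin n) {c} F → c (add v F) ≈ 𝟘 → hook v c F ≈ 𝟘
  hook-zero v {c} F e = ≈-trans (hook-local v {c} {𝕆} F e) (L-𝕆 (hook-linear v) (λ _ → ≈-refl) F)

  hook-∋ : ∀ {n} (v : Fin n) c {F} → F ∋ v → hook v c F ≈ 𝟘
  hook-∋ zero c {true ∷ F} _ = ≈-refl
  hook-∋ (suc v) c {false ∷ F} ∋⟨ e ⟩ = hook-∋ v (out c) ∋⟨ e ⟩
  hook-∋ (suc v) c {true ∷ F} ∋⟨ e ⟩ = ⊝-zero (hook-∋ v (inn c) ∋⟨ e ⟩)

  wedge-hook : ∀ {n} (v : Fin n) c {F} → F ∋ v → wedge v (hook v c) F ≈ c F
  wedge-hook zero c {true ∷ F} _ = ≈-refl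
  wedge-hook (suc v) c {false ∷ F} ∋⟨ e ⟩ = wedge-hook v (out c) ∋⟨ e ⟩
  wedge-hook (suc v) c {true ∷ F} ∋⟨ e ⟩ = ≈-trans (⊝-cong (≈-trans (L-⊟ (wedge-linear v) (hook v (inn c)) F) (⊝-cong (wedge-hook v (inn c) ∋⟨ e ⟩)))) (⊝-involutive _)

  ∂-zero : ∀ {n} c (F : Subset n) → (∀ v → F ∌ v → c (add v F) ≈ 𝟘) → ∂ c F ≈ 𝟘
  ∂-zero c [] h = ≈-refl
  ∂-zero c (false ∷ F) h = ⊕-zero (∂-zero (out c) F λ v p → h (suc v) ∌⟨ ∌-eq p ⟩) (h zero ∌⟨ refl ⟩)
  ∂-zero c (true ∷ F) h = ⊝-zero (∂-zero (inn c) F λ v p → h (suc v) ∌⟨ ∌-eq p ⟩)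

  -- The image of a chain under the simplicial map y ↦ x.
  push : ∀ {n} → Fin n → Fin n → Ch n → Ch n
  push x y c = c ⊞ (wedge x (hook y c) ⊞ ⊟ wedge y (hook y c))

  Cycle : ∀ {n} → Ch n → Set ℓ
  Cycle c = ∂ c ≐ 𝕆

  ∂-wedge′ : ∀ {n} (v : Fin n) c F → ∂ (wedge v c) F ≈ c F ⊕ ⊝ wedge v (∂ c) F
  ∂-wedge′ v c F = begin
    ∂ (wedge v c) F ≈⟨ ⊕-identityʳ _ ⟨
    ∂ (wedge v c) F ⊕ 𝟘 ≈⟨ ⊕-congˡ (⊝-inverseʳ _) ⟨
    ∂ (wedge v c) F ⊕ (wedge v (∂ c) F ⊕ ⊝ wedge v (∂ c) F) ≈⟨ ⊕-assoc _ _ _ ⟨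
    (∂ (wedge v c) F ⊕ wedge v (∂ c) F) ⊕ ⊝ wedge v (∂ c) F ≈⟨ ⊕-congʳ (∂-wedge v c F) ⟩
    c F ⊕ ⊝ wedge v (∂ c) F ∎

  ⊕-difference : ∀ k a b → (k ⊕ a) ⊕ ⊝ (k ⊕ b) ≈ a ⊕ ⊝ b
  ⊕-difference k a b = begin
    (k ⊕ a) ⊕ ⊝ (k ⊕ b) ≈⟨ ⊕-congˡ (⊝-⊕-comm k b) ⟨
    (k ⊕ a) ⊕ (⊝ k ⊕ ⊝ b) ≈⟨ interchange k a (⊝ k) (⊝ b) ⟩
    (k ⊕ ⊝ k) ⊕ (a ⊕ ⊝ b) ≈⟨ ⊕-congʳ (⊝-inverseʳ k) ⟩
    𝟘 ⊕ (a ⊕ ⊝ b) ≈⟨ ⊕-identityˡ _ ⟩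
    a ⊕ ⊝ b ∎

  -- Substituting x for y adds (x - y) ∧ k with k = `hook y c`. In the boundary the two copies of k
  -- cancel, and the sign of `∂-hook` undoes that of the Leibniz rule.
  ∂-push : ∀ {n} (x y : Fin n) c → ∂ (push x y c) ≐ push x y (∂ c)
  ∂-push x y c F = ≈-trans (L-⊞ ∂-linear c (wedge x k ⊞ ⊟ wedge y k) F) (⊕-congˡ (begin
    ∂ (wedge x k ⊞ ⊟ wedge y k) F
      ≈⟨ ≈-trans (L-⊞ ∂-linear (wedge x k) (⊟ wedge y k) F) (⊕-congˡ (L-⊟ ∂-linear (wedge y k) F)) ⟩
    ∂ (wedge x k) F ⊕ ⊝ ∂ (wedge y k) F
      ≈⟨ ⊕-cong (∂-wedge′ x k F) (⊝-cong (∂-wedge′ y k F)) ⟩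
    (k F ⊕ ⊝ wedge x (∂ k) F) ⊕ ⊝ (k F ⊕ ⊝ wedge y (∂ k) F)
      ≈⟨ ⊕-difference (k F) _ _ ⟩
    ⊝ wedge x (∂ k) F ⊕ ⊝ ⊝ wedge y (∂ k) F
      ≈⟨ ⊕-cong (flip x) (⊝-cong (flip y)) ⟩
    wedge x (hook y (∂ c)) F ⊕ ⊝ wedge y (hook y (∂ c)) F ∎))
    where
    k = hook y c
    flip : ∀ z → ⊝ wedge z (∂ k) F ≈ wedge z (hook y (∂ c)) F
    flip z = ≈-trans (⊝-cong (L-cong (wedge-linear z) (∂-hook y c) F)) (⊝-L-⊟ (wedge-linear z) (hook y (∂ c)) F)

true-or-false : ∀ b → b ≡ true ⊎ b ≡ false
true-or-false true = inj₁ refl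
true-or-false false = inj₂ refl

-- Contraction of an edge and lifting back

module StableChains {g ℓ} (Γ : AbelianGroup g ℓ)
  (stable : ∀ {x y} → ¬ ¬ AbelianGroup._≈_ Γ x y → AbelianGroup._≈_ Γ x y) where
  open ChainAlgebra Γ public
  open Linear
  open import Relation.Binary.Reasoning.Setoid (AbelianGroup.setoid Γ)

  NonZero : G → Set ℓ
  NonZero x = ¬ x ≈ 𝟘

  restrict : ∀ {n} → (Subset n → Bool) → Ch n → Ch n
  restrict Q c F = if Q F then c F else 𝟘

  restrict-true : ∀ {n} (Q : Subset n → Bool) c {F} → Q F ≡ true → restrict Q c F ≈ c F
  restrict-true Q c e rewrite e = ≈-refl

  restrict-false : ∀ {n} (Q : Subset n → Bool) c {F} → Q F ≡ false → restrict Q c F ≈ 𝟘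
  restrict-false Q c e rewrite e = ≈-refl

  ∂-nonzero : ∀ {n} (c : Ch n) F → NonZero (∂ c F) → ¬ ¬ (∃[ v ] F ∌ v × NonZero (c (add v F)))
  ∂-nonzero c F nz k = nz (∂-zero c F λ v F∌v → stable λ h → k (v , F∌v , h))

  -- A cycle is the boundary of its cone v ∧ c, and near F the faces of this cone come from faces of
  -- c that replace v by another vertex.
  cycle-exchange : ∀ {n} (c : Ch n) → Cycle c → ∀ {F v} → F ∋ v → NonZero (c F) →
    ¬ ¬ (∃[ w ] w ≢ v × F ∌ w × NonZero (c (add w (del v F))))
  cycle-exchange c cyc {F} {v} F∋v nz k = nz (begin
    c F ≈⟨ ∂-wedge v c F ⟨
    ∂ (wedge v c) F ⊕ wedge v (∂ c) F ≈⟨ ⊕-congˡ (L-𝕆 (wedge-linear v) cyc F) ⟩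
    ∂ (wedge v c) F ⊕ 𝟘 ≈⟨ ⊕-identityʳ _ ⟩
    ∂ (wedge v c) F ≈⟨ ∂-zero (wedge v c) F (λ w F∌w → wedge-zero v (add w F) (stable λ h →
                                                         k (w , (λ e → ∋-∌-≢ F∋v F∌w (sym e)) , F∌w ,
                                                            subst (NonZero ∘ c) (Vec.[]≔-commutes F w v (λ e → ∋-∌-≢ F∋v F∌w (sym e))) h))) ⟩
    𝟘 ∎)

  module _ {n} {x y : Fin n} (x≢y : x ≢ y) where

    push-∋ : ∀ c {F} → F ∋ y → push x y c F ≈ 𝟘
    push-∋ c {F} F∋y = begin
      c F ⊕ (wedge x (hook y c) F ⊕ ⊝ wedge y (hook y c) F)
        ≈⟨ ⊕-congˡ (⊕-cong (wedge-zero x F (hook-∋ y c (del-∋ (x≢y ∘ sym) F∋y))) (⊝-cong (wedge-hook y c F∋y))) ⟩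
      c F ⊕ (𝟘 ⊕ ⊝ c F) ≈⟨ ⊕-congˡ (⊕-identityˡ _) ⟩
      c F ⊕ ⊝ c F ≈⟨ ⊝-inverseʳ _ ⟩
      𝟘 ∎

    push-∌∌ : ∀ c {F} → F ∌ y → F ∌ x → push x y c F ≈ c F
    push-∌∌ c {F} F∌y F∌x = begin
      c F ⊕ (wedge x (hook y c) F ⊕ ⊝ wedge y (hook y c) F)
        ≈⟨ ⊕-congˡ (⊕-zero (wedge-∌ x (hook y c) F∌x) (⊝-zero (wedge-∌ y (hook y c) F∌y))) ⟩
      c F ⊕ 𝟘 ≈⟨ ⊕-identityʳ _ ⟩
      c F ∎

    push-local : ∀ {b c F} → F ∌ y → b F ≈ c F → b (add y (del x F)) ≈ c (add y (del x F)) → push x y b F ≈ push x y c F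
    push-local {b} {c} {F} F∌y e e′ = ⊕-cong e (⊕-cong
      (wedge-local x F (hook-local y (del x F) e′))
      (⊝-cong (≈-trans (wedge-∌ y (hook y b) F∌y) (≈-sym (wedge-∌ y (hook y c) F∌y)))))

    push-zero : ∀ {c F} → F ∌ y → c F ≈ 𝟘 → c (add y (del x F)) ≈ 𝟘 → push x y c F ≈ 𝟘
    push-zero {c} {F} F∌y e e′ = ≈-trans (push-local {c} {𝕆} F∌y e e′)
      (⊕-zero ≈-refl (⊕-zero (L-𝕆 (wedge-linear x) hook-𝕆 F) (⊝-zero (L-𝕆 (wedge-linear y) hook-𝕆 F))))
      where
      hook-𝕆 : hook y 𝕆 ≐ 𝕆
      hook-𝕆 = L-𝕆 (hook-linear y) (λ _ → ≈-refl)

    swap : Subset n → Subset n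
    swap F = add x (del y F)

    -- The part of c, away from the edge xy, that push maps to the faces selected by Q.
    lift : (Subset n → Bool) → Ch n → Ch n
    lift Q c F = if lookup F y then (if lookup F x then 𝟘 else if Q (swap F) then c F else 𝟘) else restrict Q c F

    module _ (Q : Subset n → Bool) (c : Ch n) where
      lift-∋∋ : ∀ {F} → F ∋ x → F ∋ y → lift Q c F ≈ 𝟘
      lift-∋∋ ∋⟨ p ⟩ ∋⟨ q ⟩ rewrite q | p = ≈-refl

      lift-∌ : ∀ {F} → F ∌ y → lift Q c F ≈ restrict Q c F
      lift-∌ ∌⟨ q ⟩ rewrite q = ≈-refl

      lift-true : ∀ {F} → F ∌ x → F ∋ y → Q (swap F) ≡ true → lift Q c F ≈ c F
      lift-true ∌⟨ p ⟩ ∋⟨ q ⟩ e rewrite q | p | e = ≈-refl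

      lift-false : ∀ {F} → F ∌ x → F ∋ y → Q (swap F) ≡ false → lift Q c F ≈ 𝟘
      lift-false ∌⟨ p ⟩ ∋⟨ q ⟩ e rewrite q | p | e = ≈-refl

      lift-∋-nonzero : ∀ {F} → F ∋ y → NonZero (lift Q c F) → F ∌ x × Q (swap F) ≡ true × NonZero (c F)
      lift-∋-nonzero {F} F∋y nz with ∋⊎∌ F x | true-or-false (Q (swap F))
      ... | inj₁ F∋x | _ = contradiction (lift-∋∋ F∋x F∋y) nz
      ... | inj₂ F∌x | inj₁ e = F∌x , e , λ z → nz (≈-trans (lift-true F∌x F∋y e) z)
      ... | inj₂ F∌x | inj₂ e = contradiction (lift-false F∌x F∋y e) nz

      lift-∌-nonzero : ∀ {F} → F ∌ y → NonZero (lift Q c F) → Q F ≡ true × NonZero (c F)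
      lift-∌-nonzero {F} F∌y nz with true-or-false (Q F)
      ... | inj₁ e = e , λ z → nz (≈-trans (lift-∌ F∌y) (≈-trans (restrict-true Q c e) z))
      ... | inj₂ e = contradiction (≈-trans (lift-∌ F∌y) (restrict-false Q c e)) nz

      swap-partner : ∀ {F} → F ∌ y → F ∋ x → swap (add y (del x F)) ≡ F
      swap-partner F∌y F∋x = trans (cong (add x) (del-add (del-∌ x F∌y))) (add-del F∋x)

      -- A face of the image comes from itself and, if it contains x, from its partner with y in
      -- place of x; `lift` keeps both or neither.
      push-lift : push x y (lift Q c) ≐ restrict Q (push x y c)
      push-lift F with ∋⊎∌ F y | ∋⊎∌ F x | true-or-false (Q F)
      ... | inj₁ F∋y | _ | inj₁ e = ≈-trans (push-∋ (lift Q c) F∋y) (≈-sym (≈-trans (restrict-true Q (push x y c) e) (push-∋ c F∋y)))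
      ... | inj₁ F∋y | _ | inj₂ e = ≈-trans (push-∋ (lift Q c) F∋y) (≈-sym (restrict-false Q (push x y c) e))
      ... | inj₂ F∌y | inj₂ F∌x | inj₁ e = ≈-trans (push-∌∌ (lift Q c) F∌y F∌x)
        (≈-trans (≈-trans (lift-∌ F∌y) (restrict-true Q c e)) (≈-sym (≈-trans (restrict-true Q (push x y c) e) (push-∌∌ c F∌y F∌x))))
      ... | inj₂ F∌y | inj₂ F∌x | inj₂ e = ≈-trans (push-∌∌ (lift Q c) F∌y F∌x)
        (≈-trans (≈-trans (lift-∌ F∌y) (restrict-false Q c e)) (≈-sym (restrict-false Q (push x y c) e)))
      ... | inj₂ F∌y | inj₁ F∋x | inj₁ e = ≈-trans (push-local F∌y (≈-trans (lift-∌ F∌y) (restrict-true Q c e))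
        (lift-true (add-∌ x≢y (del-self x F)) (add-self y (del x F)) (trans (cong Q (swap-partner F∌y F∋x)) e)))
        (≈-sym (restrict-true Q (push x y c) e))
      ... | inj₂ F∌y | inj₁ F∋x | inj₂ e = ≈-trans (push-zero F∌y (≈-trans (lift-∌ F∌y) (restrict-false Q c e))
        (lift-false (add-∌ x≢y (del-self x F)) (add-self y (del x F)) (trans (cong Q (swap-partner F∌y F∋x)) e)))
        (≈-sym (restrict-false Q (push x y c) e))

      module Lifted (cyc : Cycle (restrict Q (push x y c))) where
        r b k r⁺ : Ch n
        r = lift Q c
        b = ∂ r
        k = hook y b
        -- ∂ r is annihilated by `push`, hence equals (y - x) ∧ k, and k is a cycle. Then x ∧ y ∧ k
        -- has the same boundary as r, and subtracting it closes r; k is the link of xy.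
        r⁺ = r ⊞ ⊟ wedge x (wedge y k)

        push-b : push x y b ≐ 𝕆
        push-b F = ≈-trans (≈-sym (∂-push x y r F)) (≈-trans (L-cong ∂-linear push-lift F) (cyc F))

        b-eq : ∀ F → b F ≈ wedge y k F ⊕ ⊝ wedge x k F
        b-eq F = begin
          b F ≈⟨ ⊝-unique (push-b F) ⟩
          ⊝ (wedge x k F ⊕ ⊝ wedge y k F) ≈⟨ ⊝-⊕-comm _ _ ⟨
          ⊝ wedge x k F ⊕ ⊝ ⊝ wedge y k F ≈⟨ ⊕-comm _ _ ⟩
          ⊝ ⊝ wedge y k F ⊕ ⊝ wedge x k F ≈⟨ ⊕-congʳ (⊝-involutive _) ⟩
          wedge y k F ⊕ ⊝ wedge x k F ∎

        k-cycle : Cycle k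
        k-cycle F = ≈-trans (∂-hook y b F) (⊝-zero (L-𝕆 (hook-linear y) (∂∂ r) F))

        r⁺-cycle : Cycle r⁺
        r⁺-cycle F = begin
          ∂ r⁺ F ≈⟨ L-⊞ ∂-linear r (⊟ wedge x (wedge y k)) F ⟩
          b F ⊕ ∂ (⊟ wedge x (wedge y k)) F ≈⟨ ⊕-congˡ (L-⊟ ∂-linear (wedge x (wedge y k)) F) ⟩
          b F ⊕ ⊝ ∂ (wedge x (wedge y k)) F ≈⟨ ⊕-congˡ (⊝-cong (∂-wedge′ x (wedge y k) F)) ⟩
          b F ⊕ ⊝ (wedge y k F ⊕ ⊝ wedge x (∂ (wedge y k)) F) ≈⟨ ⊕-congˡ (⊝-cong (⊕-congˡ (⊝-cong (L-cong (wedge-linear x) ∂-wedge-k F)))) ⟩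
          b F ⊕ ⊝ (wedge y k F ⊕ ⊝ wedge x k F) ≈⟨ ⊕-congʳ (b-eq F) ⟩
          (wedge y k F ⊕ ⊝ wedge x k F) ⊕ ⊝ (wedge y k F ⊕ ⊝ wedge x k F) ≈⟨ ⊝-inverseʳ _ ⟩
          𝟘 ∎
          where
          ∂-wedge-k : ∂ (wedge y k) ≐ k
          ∂-wedge-k F = begin
            ∂ (wedge y k) F ≈⟨ ∂-wedge′ y k F ⟩
            k F ⊕ ⊝ wedge y (∂ k) F ≈⟨ ⊕-congˡ (⊝-zero (L-𝕆 (wedge-linear y) k-cycle F)) ⟩
            k F ⊕ 𝟘 ≈⟨ ⊕-identityʳ _ ⟩
            k F ∎

        module _ {K} (nz : NonZero (k K)) where
          K∌y : K ∌ y
          K∌y = ¬∋⇒∌ λ K∋y → nz (hook-∋ y b K∋y)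

          -- K ∪ {y} is in the support of ∂ r, hence in a face of r, and faces of r through y avoid
          -- x.
          face-y : ¬ ¬ (∃[ w ] K ∌ x × K ∌ w × w ≢ x × w ≢ y × NonZero (r (add w (add y K))))
          face-y = do
            w , ∌w , nz′ ← ∂-nonzero r (add y K) (λ z → nz (hook-zero y K z))
            let F∌x = proj₁ (lift-∋-nonzero (add-∋ w (add-self y K)) nz′)
            return (w , add-∌⁻ (add-∌⁻ F∌x) , add-∌⁻ ∌w
                      , (λ e → ∋-∌-contradiction (subst (λ z → add w (add y K) ∋ z) e (add-self w _)) F∌x)
                      , (λ e → ∋-∌-≢ (add-self y K) ∌w (sym e)) , nz′)

          K∌x : K ∌ x
          K∌x = ¬∋⇒∌ λ K∋x → face-y λ (_ , K∌x , _) → ∋-∌-contradiction K∋x K∌x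

          -- On faces without y, ∂ r is -x ∧ k, so K ∪ {x} is in its support too. With `face-y`,
          -- every vertex of K is a common neighbour of x and y.
          face-x : ¬ ¬ (∃[ w ] K ∌ w × w ≢ x × w ≢ y × NonZero (r (add w (add x K))))
          face-x = do
            w , ∌w , nz′ ← ∂-nonzero r (add x K) b≢0
            let w≢x = λ e → ∋-∌-≢ (add-self x K) ∌w (sym e)
                w≢y = λ e → nz′ (lift-∋∋ (add-∋ w (add-self x K)) (subst (λ z → add w (add x K) ∋ z) e (add-self w _)))
            return (w , add-∌⁻ ∌w , w≢x , w≢y , nz′)
            where
            b≢0 : NonZero (b (add x K))
            b≢0 z = nz (subst (λ H → k H ≈ 𝟘) (del-add K∌x) (wedge-zero⁻ x {k} (add-self x K) (begin
              wedge x k (add x K) ≈⟨ ⊝-involutive _ ⟨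
              ⊝ ⊝ wedge x k (add x K) ≈⟨ ⊝-zero (begin
                ⊝ wedge x k (add x K) ≈⟨ ⊕-identityˡ _ ⟨
                𝟘 ⊕ ⊝ wedge x k (add x K) ≈⟨ ⊕-congʳ (wedge-∌ y k (add-∌ (x≢y ∘ sym) K∌y)) ⟨
                wedge y k (add x K) ⊕ ⊝ wedge x k (add x K) ≈⟨ b-eq (add x K) ⟨
                b (add x K) ≈⟨ z ⟩
                𝟘 ∎) ⟩
              𝟘 ∎)))

  -- Minimal cycles and decompositions

  Subchain : ∀ {n} → Ch n → Ch n → Set ℓ
  Subchain b c = ∀ F → NonZero (b F) → b F ≈ c F

  Minimal : ∀ {n} → Ch n → Set (g ⊔ ℓ)
  Minimal c = ∀ b → Subchain b c → Cycle b → ¬ (b ≐ 𝕆) → b ≐ c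

  ≐-stable : ∀ {n} {b c : Ch n} → ¬ ¬ (b ≐ c) → b ≐ c
  ≐-stable h F = stable (λ k → h (λ e → k (e F)))

  ¬≐ : ∀ {n} {b c : Ch n} → ¬ (b ≐ c) → ¬ ¬ (∃[ F ] ¬ b F ≈ c F)
  ¬≐ h k = h λ F → stable λ ne → k (F , ne)

  subchain-trans : ∀ {n} {a b c : Ch n} → Subchain a b → Subchain b c → Subchain a c
  subchain-trans s u F nz = ≈-trans (s F nz) (u F λ z → nz (≈-trans (s F nz) z))

  _≟ₛ_ : ∀ {n} (F H : Subset n) → Dec (F ≡ H)
  _≟ₛ_ = Vec.≡-dec Bool._≟_

  Supported : ∀ {n} → List (Subset n) → Ch n → Set ℓ
  Supported L c = ∀ F → NonZero (c F) → F ∈ L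

  cycle-⊞ : ∀ {n} {b c : Ch n} → Cycle b → Cycle c → Cycle (b ⊞ c)
  cycle-⊞ {b = b} {c} B C F = ≈-trans (L-⊞ ∂-linear b c F) (⊕-zero (B F) (C F))

  cycle-⊟ : ∀ {n} {c : Ch n} → Cycle c → Cycle (⊟ c)
  cycle-⊟ {c = c} C F = ≈-trans (L-⊟ ∂-linear c F) (⊝-zero (C F))

  -- A cycle is a sum of minimal subcycles.
  module _ {n} {p} (P : Ch n → Set p) (P-resp : ∀ {b c} → b ≐ c → P b → P c) (P-⊞ : ∀ {b c} → P b → P c → P (b ⊞ c)) where

    minimal-induction : ∀ N (L : List (Subset n)) → List.length L ≤ N → ∀ c → Cycle c → Supported L c →
      (∀ D → Subchain D c → Cycle D → Minimal D → P D) → ¬ ¬ P c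
    minimal-induction N L h c cyc supp base = do
      no ¬min ← em (Minimal c)
        where yes min → return (base c (λ _ _ → ≈-refl) cyc min)
      (b , sub , b-cyc , b≢0 , b≢c) ← λ k → ¬min λ b sub b-cyc b≢0 → ≐-stable λ b≢c → k (b , sub , b-cyc , b≢0 , b≢c)
      (F₀ , bF₀≢) ← ¬≐ b≢c
      (F₁ , bF₁≢0) ← ¬≐ b≢0
      -- The subcycle `b` misses `F₀` and its complement `b′` misses `F₁`, so both are supported on
      -- a shorter list.
      let b′ = c ⊞ ⊟ b
          bF₀≈0 = stable (λ nz → bF₀≢ (sub F₀ nz))
          cF₀≢0 = λ z → bF₀≢ (≈-trans bF₀≈0 (≈-sym z))
          cF₁≢0 = λ z → bF₁≢0 (≈-trans (sub F₁ bF₁≢0) z)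
          vanish : ∀ F → NonZero (b F) → b′ F ≈ 𝟘
          vanish F nz = ≈-trans (⊕-congˡ (⊝-cong (sub F nz))) (⊝-inverseʳ (c F))
          sub′ : Subchain b′ c
          sub′ F nz = ≈-trans (⊕-congˡ (⊝-zero (stable λ bF≢0 → nz (vanish F bF≢0)))) (⊕-identityʳ (c F))
      Pb ← smaller F₀ cF₀≢0 b b-cyc sub λ F nz F≡F₀ → nz (subst (λ H → b H ≈ 𝟘) (sym F≡F₀) bF₀≈0)
      Pb′ ← smaller F₁ cF₁≢0 b′ (cycle-⊞ cyc (cycle-⊟ b-cyc)) sub′ λ F nz F≡F₁ → nz (subst (λ H → b′ H ≈ 𝟘) (sym F≡F₁) (vanish F₁ bF₁≢0))
      return (P-resp (λ F → restore (b F) (c F)) (P-⊞ Pb Pb′))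
      where
      restore : ∀ u v → u ⊕ (v ⊕ ⊝ u) ≈ v
      restore u v = begin
        u ⊕ (v ⊕ ⊝ u) ≈⟨ ⊕-congˡ (⊕-comm v (⊝ u)) ⟩
        u ⊕ (⊝ u ⊕ v) ≈⟨ ⊕-assoc u (⊝ u) v ⟨
        (u ⊕ ⊝ u) ⊕ v ≈⟨ ⊕-congʳ (⊝-inverseʳ u) ⟩
        𝟘 ⊕ v ≈⟨ ⊕-identityˡ v ⟩
        v ∎
      smaller : ∀ F₀ → NonZero (c F₀) → ∀ b → Cycle b → Subchain b c → (∀ F → NonZero (b F) → F ≢ F₀) → ¬ ¬ P b
      smaller F₀ cF₀≢0 b b-cyc sub avoid = go N (ℕ.≤-trans shorter h)
        where
        L′ = List.filter (λ F → ¬? (F ≟ₛ F₀)) L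
        shorter : List.length L′ ℕ.< List.length L
        shorter = List.filter-notAll (λ F → ¬? (F ≟ₛ F₀)) L (lose (supp F₀ cF₀≢0) (λ ne → ne refl))
        supp′ : Supported L′ b
        supp′ F nz = List.∈-filter⁺ (λ F → ¬? (F ≟ₛ F₀)) (supp F λ z → nz (≈-trans (sub F nz) z)) (avoid F nz)
        go : ∀ N → List.length L′ ℕ.< N → ¬ ¬ P b
        go (suc N′) lt = minimal-induction N′ L′ (ℕ.s≤s⁻¹ lt) b b-cyc supp′
          λ D D-sub → base D (subchain-trans D-sub sub)

  all-subsets : ∀ n → List (Subset n)
  all-subsets zero = [] ∷ []
  all-subsets (suc n) = List.cartesianProductWith _∷_ (true ∷ false ∷ []) (all-subsets n)

  ∈-all-subsets : ∀ {n} (F : Subset n) → F ∈ all-subsets n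
  ∈-all-subsets [] = here refl
  ∈-all-subsets (true ∷ F) = List.∈-cartesianProductWith⁺ _∷_ {xs = true ∷ false ∷ []} (here refl) (∈-all-subsets F)
  ∈-all-subsets (false ∷ F) = List.∈-cartesianProductWith⁺ _∷_ {xs = true ∷ false ∷ []} (there (here refl)) (∈-all-subsets F)

  hook-zero⁻ : ∀ {n} (v : Fin n) {c F} → F ∌ v → hook v c F ≈ 𝟘 → c (add v F) ≈ 𝟘
  hook-zero⁻ zero {F = false ∷ F} _ e = e
  hook-zero⁻ (suc v) {F = false ∷ F} ∌⟨ p ⟩ e = hook-zero⁻ v ∌⟨ p ⟩ e
  hook-zero⁻ (suc v) {F = true ∷ F} ∌⟨ p ⟩ e = hook-zero⁻ v ∌⟨ p ⟩ (⊝-zero⁻ e)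

  -- A star is a cone: by exchange, a face of c through x would have a neighbour in c without x.
  star-cycle-zero : ∀ {n} (x : Fin n) c → Cycle c → (∀ F → F ∌ x → c F ≈ 𝟘) → c ≐ 𝕆
  star-cycle-zero x c cyc h F with ∋⊎∌ F x
  ... | inj₂ F∌x = h F F∌x
  ... | inj₁ F∋x = stable λ nz → cycle-exchange c cyc F∋x nz λ (w , w≢x , _ , nz′) →
    nz′ (h (add w (del x F)) (add-∌ (w≢x ∘ sym) (del-self x F)))

  constant-restrict : ∀ {n} (Q : Subset n → Bool) c → Cycle c →
    (∀ {F H} → NonZero (c F) → NonZero (c H) → Q F ≡ Q H) → Cycle (restrict Q c)
  constant-restrict Q c cyc same F = stable do
    yes (H , nz , e) ← em (∃[ H ] NonZero (c H) × Q H ≡ true)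
      where no none → return (L-𝕆 ∂-linear (λ H → stable λ nz → case true-or-false (Q H) of λ where
                         (inj₁ e) → none (H , (λ z → nz (≈-trans (restrict-true Q c e) z)) , e)
                         (inj₂ e) → nz (restrict-false Q c e)) F)
    return (≈-trans (L-cong ∂-linear {c = c} (λ H′ → stable λ ne → case true-or-false (Q H′) of λ where
        (inj₁ e′) → ne (restrict-true Q c e′)
        (inj₂ e′) → ne (≈-trans (restrict-false Q c e′) (≈-sym (stable λ nz′ →
          case trans (sym e) (trans (same nz nz′) e′) of λ ())))) F)
      (cyc F))

  restrict-⊞ : ∀ {n} (Q : Subset n → Bool) b c → restrict Q (b ⊞ c) ≐ restrict Q b ⊞ restrict Q c
  restrict-⊞ Q b c F with Q F
  ... | true = ≈-refl
  ... | false = ≈-sym 𝟘⊕𝟘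

  restrict-cong : ∀ {n} (Q : Subset n → Bool) {b c} → b ≐ c → restrict Q b ≐ restrict Q c
  restrict-cong Q e F with Q F
  ... | true = e F
  ... | false = ≈-refl

  -- Restriction is additive, and of each minimal summand it keeps all or nothing.
  restrict-cycle : ∀ {n} (Q : Subset n → Bool) c → Cycle c →
    (∀ D → Subchain D c → Cycle D → Minimal D → ∀ {F H} → NonZero (D F) → NonZero (D H) → Q F ≡ Q H) →
    Cycle (restrict Q c)
  restrict-cycle {n} Q c cyc same F = stable do
    res ← minimal-induction (λ b → Cycle (restrict Q b))
      (λ e C F → ≈-trans (L-cong ∂-linear (restrict-cong Q (λ H → ≈-sym (e H))) F) (C F))
      (λ {b} {b′} B B′ F → ≈-trans (L-cong ∂-linear (restrict-⊞ Q b b′) F) (cycle-⊞ B B′ F))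
      _ (all-subsets n) ℕ.≤-refl c cyc (λ F _ → ∈-all-subsets F)
      (λ D sub D-cyc D-min → constant-restrict Q D D-cyc (same D sub D-cyc D-min))
    return (res F)

  -- A coefficient that is nonzero in a sum is nonzero in a summand.
  minimal-through : ∀ {n} (c : Ch n) → Cycle c → ∀ F → NonZero (c F) →
    ¬ ¬ (∃[ D ] Subchain D c × Cycle D × Minimal D × NonZero (D F))
  minimal-through {n} c cyc F nz = do
    res ← minimal-induction {n} P (λ e p nz → p (λ z → nz (≈-trans (≈-sym (e F)) z)))
      (λ {b} {b′} p p′ nz → do
        no bF≢0 ← em (b F ≈ 𝟘)
          where yes bF≈0 → p′ (λ z → nz (⊕-zero bF≈0 z))
        p bF≢0)
      _ (all-subsets n) ℕ.≤-refl c cyc (λ F _ → ∈-all-subsets F)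
      (λ D sub D-cyc D-min nz → return (D , sub , D-cyc , D-min , nz))
    res nz
    where
    P : Ch n → Set _
    P b = NonZero (b F) → ¬ ¬ (∃[ D ] Subchain D c × Cycle D × Minimal D × NonZero (D F))

  module _ {n} {x y : Fin n} (x≢y : x ≢ y) where

    push-cycle : ∀ {c} → Cycle c → Cycle (push x y c)
    push-cycle {c} cyc F = ≈-trans (∂-push x y c F)
      (⊕-zero (cyc F) (⊕-zero (L-𝕆 (wedge-linear x) (L-𝕆 (hook-linear y) cyc) F) (⊝-zero (L-𝕆 (wedge-linear y) (L-𝕆 (hook-linear y) cyc) F))))

    push-nonzero : ∀ {c F} → NonZero (push x y c F) → F ∌ y × ¬ ¬ (NonZero (c F) ⊎ (F ∋ x × NonZero (c (add y (del x F)))))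
    push-nonzero {c} {F} nz = F∌y , λ k → case ∋⊎∌ F x of λ where
        (inj₂ F∌x) → k (inj₁ λ z → nz (≈-trans (push-∌∌ x≢y c F∌y F∌x) z))
        (inj₁ F∋x) → nz (push-zero x≢y F∌y (stable (k ∘ inj₁)) (stable λ h → k (inj₂ (F∋x , h))))
      where
      F∌y : F ∌ y
      F∌y = ¬∋⇒∌ λ F∋y → nz (push-∋ x≢y c F∋y)

    -- A face of c that is lost in the contraction was cancelled by its partner with y in place of
    -- x. Such pairs lie in no piece and are treated separately.
    cancelled-∋x : ∀ {c F} → F ∌ y → F ∋ x → NonZero (c F) → push x y c F ≈ 𝟘 → NonZero (c (add y (del x F)))
    cancelled-∋x {c} {F} F∌y F∋x nz e z = nz (begin
      c F ≈⟨ ⊕-identityʳ _ ⟨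
      c F ⊕ 𝟘 ≈⟨ ⊕-congˡ (⊕-zero (wedge-zero x F (hook-zero y (del x F) z)) (⊝-zero (wedge-∌ y (hook y c) F∌y))) ⟨
      push x y c F ≈⟨ e ⟩
      𝟘 ∎)

    cancelled-∋y : ∀ {c F} → F ∌ x → F ∋ y → NonZero (c F) → push x y c (swap x≢y F) ≈ 𝟘 → NonZero (c (swap x≢y F))
    cancelled-∋y {c} {F} F∌x F∋y nz e z = nz (subst (λ H → c H ≈ 𝟘) (add-del F∋y)
      (hook-zero⁻ y (del-self y F) (subst (λ H → hook y c H ≈ 𝟘) (del-add (del-∌ y F∌x)) (wedge-zero⁻ x {hook y c} (add-self x (del y F)) (begin
        wedge x (hook y c) (swap x≢y F) ≈⟨ ⊕-identityʳ _ ⟨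
        wedge x (hook y c) (swap x≢y F) ⊕ 𝟘 ≈⟨ ⊕-congˡ (⊝-zero (wedge-∌ y (hook y c) (add-∌ (x≢y ∘ sym) (del-self y F)))) ⟨
        wedge x (hook y c) (swap x≢y F) ⊕ ⊝ wedge y (hook y c) (swap x≢y F) ≈⟨ ⊕-identityˡ _ ⟨
        𝟘 ⊕ (wedge x (hook y c) (swap x≢y F) ⊕ ⊝ wedge y (hook y c) (swap x≢y F)) ≈⟨ ⊕-congʳ z ⟨
        push x y c (swap x≢y F) ≈⟨ e ⟩
        𝟘 ∎)))))

    Away : Subset n → Set
    Away F = F ∌ x ⊎ F ∌ y

    away? : ∀ F → Away F ⊎ (F ∋ x × F ∋ y)
    away? F with ∋⊎∌ F x | ∋⊎∌ F y
    ... | inj₂ F∌x | _ = inj₁ (inj₁ F∌x)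
    ... | inj₁ _ | inj₂ F∌y = inj₁ (inj₂ F∌y)
    ... | inj₁ F∋x | inj₁ F∋y = inj₂ (F∋x , F∋y)

    wedge-wedge-away : ∀ k {F} → Away F → wedge x (wedge y k) F ≈ 𝟘
    wedge-wedge-away k (inj₁ F∌x) = wedge-∌ x (wedge y k) F∌x
    wedge-wedge-away k {F} (inj₂ F∌y) = wedge-zero x F (wedge-∌ y k (del-∌ x F∌y))

    lift-complement : ∀ Q c {F} → Away F → lift x≢y Q c F ⊕ lift x≢y (not ∘ Q) c F ≈ c F
    lift-complement Q c {F} away with ∋⊎∌ F y
    ... | inj₂ F∌y = ≈-trans (⊕-cong (lift-∌ x≢y Q c F∌y) (lift-∌ x≢y (not ∘ Q) c F∌y)) (both (Q F))
      where
      both : ∀ b → (if b then c F else 𝟘) ⊕ (if not b then c F else 𝟘) ≈ c F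
      both true = ⊕-identityʳ _
      both false = ⊕-identityˡ _
    ... | inj₁ F∋y = case away of λ where
        (inj₂ F∌y) → ∋-∌-contradiction F∋y F∌y
        (inj₁ F∌x) → case true-or-false (Q (swap x≢y F)) of λ where
          (inj₁ e) → ≈-trans (⊕-cong (lift-true x≢y Q c F∌x F∋y e) (lift-false x≢y (not ∘ Q) c F∌x F∋y (cong not e))) (⊕-identityʳ _)
          (inj₂ e) → ≈-trans (⊕-cong (lift-false x≢y Q c F∌x F∋y e) (lift-true x≢y (not ∘ Q) c F∌x F∋y (cong not e))) (⊕-identityˡ _)

    lift-subchain : ∀ Q c → Subchain (lift x≢y Q c) c
    lift-subchain Q c F nz with ∋⊎∌ F y
    ... | inj₂ F∌y = ≈-trans (lift-∌ x≢y Q c F∌y) (restrict-true Q c (proj₁ (lift-∌-nonzero x≢y Q c F∌y nz)))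
    ... | inj₁ F∋y = let F∌x , e , _ = lift-∋-nonzero x≢y Q c F∋y nz in lift-true x≢y Q c F∌x F∋y e

    module Halves (Q : Subset n → Bool) (c : Ch n) (c-cyc : Cycle c)
      (cyc₁ : Cycle (restrict Q (push x y c))) (cyc₂ : Cycle (restrict (not ∘ Q) (push x y c))) where
      module L₁ = Lifted x≢y Q c cyc₁
      module L₂ = Lifted x≢y (not ∘ Q) c cyc₂

      -- Away from xy the two lifts add up to c. The difference is therefore a cycle in the star of
      -- x, hence zero, and the sum is right on faces through xy too.
      halves : ∀ F → c F ≈ L₁.r⁺ F ⊕ L₂.r⁺ F
      halves F = begin
        c F ≈⟨ ⊝-unique (star-cycle-zero x z z-cyc (λ H H∌x → z-away (inj₁ H∌x)) F) ⟩
        ⊝ ⊝ (L₁.r⁺ F ⊕ L₂.r⁺ F) ≈⟨ ⊝-involutive _ ⟩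
        L₁.r⁺ F ⊕ L₂.r⁺ F ∎
        where
        z = c ⊞ ⊟ (L₁.r⁺ ⊞ L₂.r⁺)
        z-cyc : Cycle z
        z-cyc = cycle-⊞ c-cyc (cycle-⊟ (cycle-⊞ L₁.r⁺-cycle L₂.r⁺-cycle))
        trim : ∀ k {r H} → Away H → r ⊕ ⊝ wedge x (wedge y k) H ≈ r
        trim k away = ≈-trans (⊕-congˡ (⊝-zero (wedge-wedge-away k away))) (⊕-identityʳ _)
        z-away : ∀ {H} → Away H → z H ≈ 𝟘
        z-away {H} away = ≈-trans (⊕-congˡ (⊝-cong (≈-trans (⊕-cong (trim L₁.k away) (trim L₂.k away)) (lift-complement Q c away))))
          (⊝-inverseʳ (c H))

      -- On a face through xy each half is given by its link. If the links share no face, one half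
      -- vanishes there, and the other has the whole coefficient of c.
      halves-subchain : (∀ K → NonZero (L₁.k K) → ¬ NonZero (L₂.k K)) → Subchain L₁.r⁺ c
      halves-subchain apart F nz with away? F
      ... | inj₁ away = ≈-trans trim (lift-subchain Q c F λ z → nz (≈-trans trim z))
        where
        trim : L₁.r⁺ F ≈ L₁.r F
        trim = ≈-trans (⊕-congˡ (⊝-zero (wedge-wedge-away L₁.k away))) (⊕-identityʳ _)
      ... | inj₂ (F∋x , F∋y) = ≈-sym (≈-trans (halves F) (≈-trans (⊕-congˡ r₂⁺≈0) (⊕-identityʳ _)))
        where
        K = del y (del x F)
        vanish : ∀ k → k K ≈ 𝟘 → wedge x (wedge y k) F ≈ 𝟘
        vanish k z = wedge-zero x F (wedge-zero y (del x F) z)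
        k₁≢0 : NonZero (L₁.k K)
        k₁≢0 z = nz (⊕-zero (lift-∋∋ x≢y Q c F∋x F∋y) (⊝-zero (vanish L₁.k z)))
        r₂⁺≈0 : L₂.r⁺ F ≈ 𝟘
        r₂⁺≈0 = ⊕-zero (lift-∋∋ x≢y (not ∘ Q) c F∋x F∋y) (⊝-zero (vanish L₂.k (stable (apart K k₁≢0))))

-- Vertex splitting at the chosen placement

module Splitting {n m} (a : Vec ℕ m) (κ : Fin n → Fin m) (pl : Choice.Placement a κ) where
  open Choice a κ public
  open Position a κ public
  open Placement pl public

  t : Fin n → ℚ
  t = ι ∘ τ

  open Generic t τ-inj τ≢0 public

  record Typed (F : Subset n) : Set where
    field
      size : ∣ F ∣ ≡ d
      exact : ∀ i → cnt i F ≡ lookup a i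
  open Typed public

  typed-stable : ∀ {F} → ¬ ¬ Typed F → Typed F
  typed-stable {F} h = record
    { size = decidable-stable (∣ F ∣ ℕ.≟ d) λ k → h (k ∘ size)
    ; exact = λ i → decidable-stable (cnt i F ℕ.≟ lookup a i) λ k → h λ T → k (exact T i) }

  Fit : (Fin d → Row d) → Row d → Field → Fin n → Set
  Fit S s u v = ∀ k → u v k ≡ trivial p S s v k

  fit? : ∀ S s u v → Dec (Fit S s u v)
  fit? S s u v = Fin.all? λ k → u v k ℚ.≟ trivial p S s v k

  fit-stable : ∀ {S s u v} → ¬ ¬ Fit S s u v → Fit S s u v
  fit-stable {S} {s} {u} {v} = decidable-stable (fit? S s u v)

  Rides : ∀ {ℓ} → Field → (Fin n → Set ℓ) → Set ℓ
  Rides u P = Σ (Fin d → Row d) λ S → Σ (Row d) λ s → Skew S × (∀ v → P v → Fit S s u v)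

  typed-add : ∀ {F v} → Typed F → F ∌ v → Covers (add v F) × suc (lookup a (κ v)) ≤ cnt (κ v) (add v F)
  typed-add {F} {v} T F∌v = (λ i → ℕ.≤-trans (ℕ.≤-reflexive (sym (exact T i))) (cnt-add-≤ i F∌v))
    , ℕ.≤-reflexive (trans (cong suc (sym (exact T (κ v)))) (sym (cnt-add-≡ F∌v refl)))

  trivial-difference : ∀ S s S′ s′ v k → trivial p (λ k → S k ⊖ S′ k) (s ⊖ s′) v k ≡ trivial p S s v k - trivial p S′ s′ v k
  trivial-difference S s S′ s′ v k = trans (cong (_+ (s k - s′ k)) (app--ˡ (S k) (S′ k) (p v)))
    (eq (app (S k) (p v)) (app (S′ k) (p v)) (s k) (s′ k))
    where
    eq : ∀ a b c d → (a - b) + (c - d) ≡ (a + c) - (b + d)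
    eq = solve-∀ ℚ-ring

  -- Each coordinate of a trivial motion is an affine function of the point, and a typed set with
  -- one vertex more is affinely spanning.
  trivial-zero : ∀ {F x} → Typed F → F ∌ x → ∀ S s → (∀ v → add x F ∋ v → ∀ k → trivial p S s v k ≡ 0ℚ) →
                 ∀ v k → trivial p S s v k ≡ 0ℚ
  trivial-zero {F} {x} T F∌x S s z v k =
    let cov , more = typed-add T F∌x
        -s≡0 , S≡0 = affinely-spanning cov (κ x) more (S k) (- s k) λ w w∈ → eq (app (S k) (p w)) (s k) (z w w∈ k)
    in trans (cong₂ _+_ (app-zeroˡ (p v) S≡0) (neg-0 (s k) -s≡0)) refl
    where
    eq : ∀ a b → a + b ≡ 0ℚ → a ≡ - b
    eq a b e = p-q≡0⇒p≡q a (- b) (trans (cong (a +_) (neg-neg b)) e)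
      where
      neg-neg : ∀ b → - (- b) ≡ b
      neg-neg = solve-∀ ℚ-ring

  skew-⊖ : ∀ {S S′} → Skew S → Skew S′ → Skew {d} (λ k → S k ⊖ S′ k)
  skew-⊖ {S} {S′} skew skew′ k l = trans (cong₂ _-_ (skew k l) (skew′ k l)) (eq (S l k) (S′ l k))
    where
    eq : ∀ a b → (- a) - (- b) ≡ - (a - b)
    eq = solve-∀ ℚ-ring

  -- At w, the difference has a velocity orthogonal to p w - p v for all other v.
  trivial-glue : ∀ {F x w} → Typed F → F ∌ x → F ∋ w → ∀ {S s S′ s′} → Skew S → Skew S′ →
    (∀ v → add x F ∋ v → v ≢ w → ∀ k → trivial p S s v k ≡ trivial p S′ s′ v k) →
    ∀ v k → trivial p S s v k ≡ trivial p S′ s′ v k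
  trivial-glue {F} {x} {w} T F∌x F∋w {S} {s} {S′} {s′} skew skew′ agree v k =
    p-q≡0⇒p≡q _ _ (trans (sym (trivial-difference S s S′ s′ v k)) (trivial-zero T F∌x S″ s″ on-T v k))
    where
    S″ = λ k → S k ⊖ S′ k
    s″ = s ⊖ s′
    e = trivial p S″ s″ w
    off-w : ∀ v → add x F ∋ v → v ≢ w → ∀ k → trivial p S″ s″ v k ≡ 0ℚ
    off-w v v∈ v≢w k = trans (trivial-difference S s S′ s′ v k) (p≡q⇒p-q≡0 (agree v v∈ v≢w k))
    level : ∀ v → add x F ∋ v → app e (p v) ≡ app e (p w)
    level v v∈ with v Fin.≟ w
    ... | yes refl = refl
    ... | no v≢w = sym (p-q≡0⇒p≡q _ _ (trans (sym (app--ʳ e (p w) (p v))) (trans (app-comm e (p w ⊖ p v))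
      (trans (app-congʳ (p w ⊖ p v) (λ k → trans (eq (e k)) (cong (λ z → e k - z) (sym (off-w v v∈ v≢w k)))))
        (trivial-motion p {S″} s″ (skew-⊖ skew skew′) w v)))))
      where
      eq : ∀ q → q ≡ q - 0ℚ
      eq = solve-∀ ℚ-ring
    e≡0 : ∀ k → e k ≡ 0ℚ
    e≡0 = let cov , more = typed-add T F∌x in proj₂ (affinely-spanning cov (κ x) more e (app e (p w)) level)
    on-T : ∀ v → add x F ∋ v → ∀ k → trivial p S″ s″ v k ≡ 0ℚ
    on-T v v∈ with v Fin.≟ w
    ... | yes refl = e≡0
    ... | no v≢w = off-w v v∈ v≢w

  trivial-unique : ∀ {F x} → Typed F → F ∌ x → ∀ {S s S′ s′} →
    (∀ v → add x F ∋ v → ∀ k → trivial p S s v k ≡ trivial p S′ s′ v k) → ∀ v k → trivial p S s v k ≡ trivial p S′ s′ v k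
  trivial-unique T F∌x {S} {s} {S′} {s′} agree v k = p-q≡0⇒p≡q _ _
    (trans (sym (trivial-difference S s S′ s′ v k)) (trivial-zero T F∌x (λ k → S k ⊖ S′ k) (s ⊖ s′)
      (λ v v∈ k → trans (trivial-difference S s S′ s′ v k) (p≡q⇒p-q≡0 (agree v v∈ k))) v k))

  -- The sparse form of vertex splitting: B is a typed set of vertices, C a set of
  -- common neighbours of x and y, and the contraction y → x is rigid.
  module Split (E : Adjacency) (U B C : Subset n) {x y : Fin n} (adm : Admissible E U B x y)
    (B-typed : Typed B) (B∌y : B ∌ y) (C∌x : C ∌ x) (C∌y : C ∌ y) (splits : Splits x C) (C⊆U : ∀ {w} → C ∋ w → U ∋ w)
    (C-x : ∀ {w} → C ∋ w → lookup E w ∋ x) (C-y : ∀ {w} → C ∋ w → lookup E w ∋ y)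
    (contracted : ∀ u → (∀ {v w} → U ∋ v → U ∋ w → lookup E v ∋ w → Stretch (move τ y (t x)) u v w ≡ 0ℚ) →
      (∀ k → u y k ≡ u x k) → ¬ ¬ Rides u (λ v → U ∋ v × v ≢ y)) where

    open Basis t τ-inj τ≢0 B (exact B-typed)

    x≢y : x ≢ y
    x≢y = Fin.<⇒≢ (before adm)

    limit : Limit τ E U B x y
    limit u sol along v k = decidable-stable (u v k ℚ.≟ 0ℚ) do
      (S , s , skew , fits) ← contracted u (edges sol) y-x
      let S≡0 , s≡0 = trivial-pinned {S} {s} skew λ {v} {w} B∋v B∋w v≤w → trans
            (app-cong {x = p w} (λ k → sym (fits v (pins⊆U adm B∋v , ∋-∌-≢ B∋v B∌y) k)) (λ _ → refl))
            (trans (cong (app (u v)) (sym (move-≢ τ (t x) (∋-∌-≢ B∋w B∌y)))) (pins sol B∋v B∋w v≤w))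
          zero-at : ∀ v → U ∋ v → v ≢ y → ∀ k → u v k ≡ 0ℚ
          zero-at v U∋v v≢y k = trans (fits v (U∋v , v≢y) k) (cong₂ _+_ (app-zeroˡ (p v) (S≡0 k)) (s≡0 k))
      return (case ∋⊎∌ U v of λ where
        (inj₂ U∌v) → support sol U∌v k
        (inj₁ U∋v) → case v Fin.≟ y of λ where
          (no v≢y) → zero-at v U∋v v≢y k
          (yes refl) → trans (y-x k) (zero-at x (x∈U adm) x≢y k))
      where
      e = u y ⊖ u x
      y-at-x : move τ y (t x) y ≡ p x
      y-at-x = trans (move-≡ τ y (t x)) (cong (λ i → μ i (t x)) (sym (same-colour adm)))
      at : ∀ {v} → v ≢ y → move τ y (t x) v ≡ p v
      at = move-≢ τ (t x)
      -- w is joined to x and to y, both located at p x; the difference of the two edge equations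
      -- makes u y - u x orthogonal to p w - p x.
      level : ∀ w → C ∋ w → app e (p w) ≡ app e (p x)
      level w C∋w = p-q≡0⇒p≡q _ _ (begin
        app e (p w) - app e (p x) ≡⟨ app--ʳ e (p w) (p x) ⟨
        app e (p w ⊖ p x) ≡⟨ app-comm e (p w ⊖ p x) ⟩
        app (p w ⊖ p x) e ≡⟨ app-congʳ (p w ⊖ p x) (λ k → eq (u y k) (u x k) (u w k)) ⟩
        app (p w ⊖ p x) ((u w ⊖ u x) ⊖ (u w ⊖ u y)) ≡⟨ app--ʳ (p w ⊖ p x) (u w ⊖ u x) (u w ⊖ u y) ⟩
        app (p w ⊖ p x) (u w ⊖ u x) - app (p w ⊖ p x) (u w ⊖ u y)
          ≡⟨ cong₂ _-_ (trans (sym (cong₂ (λ q r → app (q ⊖ r) (u w ⊖ u x)) (at w≢y) (at x≢y))) (edges sol (C⊆U C∋w) (x∈U adm) (C-x C∋w)))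
                       (trans (sym (cong₂ (λ q r → app (q ⊖ r) (u w ⊖ u y)) (at w≢y) y-at-x)) (edges sol (C⊆U C∋w) (y∈U adm) (C-y C∋w))) ⟩
        0ℚ ∎)
        where
        open ≡-Reasoning
        w≢y = ∋-∌-≢ C∋w C∌y
        eq : ∀ y x w → y - x ≡ (w - x) - (w - y)
        eq = solve-∀ ℚ-ring
      -- The tangent constraint `along` is the equation still missing beside those of the
      -- neighbours; now the field is a motion of the contraction.
      y-x : ∀ k → u y k ≡ u x k
      y-x k = p-q≡0⇒p≡q _ _ (splits-vanishes C∌x splits e
        (trans (app-comm e (η (κ x) (t x) (t x))) (trans (cong (λ i → app (η i (t x) (t x)) e) (same-colour adm)) along)) level k)

    -- Pinned by subtracting a trivial motion and cut off outside U, the field solves a system that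
    -- has only the zero solution because the limit is determined.
    split-rides : ∀ u → (∀ {v w} → U ∋ v → U ∋ w → lookup E v ∋ w → Stretch p u v w ≡ 0ℚ) → Rides u (U ∋_)
    split-rides u motion = rotation u , shift u , rotation-skew u , λ v U∋v k →
      p-q≡0⇒p≡q _ _ (trans (sym (inside v U∋v k)) (open-at y E U B x adm limit u′ sol v k))
      where
      u′ : Field
      u′ v with ∋⊎∌ U v
      ... | inj₁ _ = adjusted u v
      ... | inj₂ _ = λ _ → 0ℚ
      inside : ∀ v → U ∋ v → ∀ k → u′ v k ≡ adjusted u v k
      inside v U∋v k with ∋⊎∌ U v
      ... | inj₁ _ = refl
      ... | inj₂ U∌v = ∋-∌-contradiction U∋v U∌v
      outside : ∀ v → U ∌ v → ∀ k → u′ v k ≡ 0ℚ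
      outside v U∌v k with ∋⊎∌ U v
      ... | inj₁ U∋v = ∋-∌-contradiction U∋v U∌v
      ... | inj₂ _ = refl
      sol : Solves E U B p u′
      sol = record
        { edges = λ {v} {w} U∋v U∋w e → trans
            (app-congʳ (p v ⊖ p w) (λ k → cong₂ _-_ (inside v U∋v k) (inside w U∋w k)))
            (trans (stretch-mod-trivial p u (shift u) (rotation-skew u) v w) (motion U∋v U∋w e))
        ; pins = λ {v} {w} B∋v B∋w v≤w → trans
            (app-cong {x = p w} (inside v (pins⊆U adm B∋v)) (λ _ → refl)) (adjusted-pinned u B∋v B∋w v≤w)
        ; support = λ {v} → outside v }

-- The induction on the largest vertex

module Induction {g ℓ} (Γ : AbelianGroup g ℓ)
  (stable : ∀ {x y} → ¬ ¬ AbelianGroup._≈_ Γ x y → AbelianGroup._≈_ Γ x y)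
  {n m} (a : Vec ℕ m) (κ : Fin n → Fin m) (pl : Choice.Placement a κ)
  (2≤a : ∀ i → 2 ≤ lookup a i) (3≤d : 3 ≤ sum a) where
  open StableChains Γ stable hiding (_⊕_)
  open Splitting a κ pl

  In : Ch n → Fin n → Set ℓ
  In c v = ∃[ F ] NonZero (c F) × F ∋ v

  Adjacent : Ch n → Fin n → Fin n → Set ℓ
  Adjacent c v w = ∃[ F ] NonZero (c F) × F ∋ v × F ∋ w

  Motion : Ch n → Field → Set ℓ
  Motion c u = ∀ {F v w} → NonZero (c F) → F ∋ v → F ∋ w → Stretch p u v w ≡ 0ℚ

  TypedChain : Ch n → Set ℓ
  TypedChain c = ∀ {F} → NonZero (c F) → Typed F

  Below : ℕ → Ch n → Set ℓ
  Below k c = ∀ {F v} → NonZero (c F) → F ∋ v → toℕ v ℕ.< k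

  RigidBelow : ℕ → Set (g ⊔ ℓ)
  RigidBelow k = ∀ c → Cycle c → Minimal c → ¬ (c ≐ 𝕆) → TypedChain c → Below k c →
    ∀ u → Motion c u → ¬ ¬ Rides u (In c)

  typed-swap : ∀ {B x y} → B ∌ x → B ∌ y → κ x ≡ κ y → Typed (add y B) → Typed (add x B)
  typed-swap {B} {x} {y} B∌x B∌y same T = record
    { size = trans (trans (∣add∣ B x B∌x) (sym (∣add∣ B y B∌y))) (size T)
    ; exact = λ i → trans (trans (cnt-add i B∌x) (trans (cong (λ j → 𝟙 (does (j Fin.≟ i)) ℕ.+ cnt i B) same) (sym (cnt-add i B∌y)))) (exact T i) }

  module Step {k} (IH : RigidBelow k) (c : Ch n) (cyc : Cycle c) (min : Minimal c) (typed : TypedChain c)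
    (below : Below (suc k) c) {F⋆} {x y : Fin n} (F⋆≢0 : NonZero (c F⋆)) (F⋆∋x : F⋆ ∋ x) (F⋆∋y : F⋆ ∋ y)
    (x≢y : x ≢ y) (same : κ x ≡ κ y) (y≡k : toℕ y ≡ k) (u : Field) (motion : Motion c u)
    (E : Adjacency) (E-reflects : ∀ v w → Reflects (lookup (lookup E v) w) (Adjacent c v w)) where

    face-edge : ∀ {F v w} → NonZero (c F) → F ∋ v → F ∋ w → lookup E v ∋ w
    face-edge {F} {v} {w} nz p q = ∋⟨ proj₂ (E-reflects v w) (F , nz , p , q) ⟩

    E-motion : ∀ {v w} → lookup E v ∋ w → Stretch p u v w ≡ 0ℚ
    E-motion {v} {w} e = let F , nz , q , r = proj₁ (E-reflects v w) (∋-eq e) in motion nz q r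

    x<y : x Fin.< y
    x<y = Fin.≤∧≢⇒< (subst (toℕ x ≤_) (sym y≡k) (ℕ.s≤s⁻¹ (below F⋆≢0 F⋆∋x))) x≢y

    c≤y : ∀ {F v} → NonZero (c F) → F ∋ v → v Fin.≤ y
    c≤y nz q = subst (_ ≤_) (sym y≡k) (ℕ.s≤s⁻¹ (below nz q))

    c′ : Ch n
    c′ = push x y c

    c′-cyc : Cycle c′
    c′-cyc = push-cycle x≢y cyc

    c′-∌y : ∀ {F} → NonZero (c′ F) → F ∌ y
    c′-∌y nz = proj₁ (push-nonzero x≢y nz)

    c′-typed : TypedChain c′
    c′-typed {F} nz = typed-stable do
      inj₂ (F∋x , nz′) ← proj₂ (push-nonzero x≢y nz)
        where inj₁ nz′ → return (typed nz′)
      return (subst Typed (add-del F∋x) (typed-swap (del-self x F) (del-∌ x (c′-∌y nz)) same (typed nz′)))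

    c′-below : Below k c′
    c′-below {F} {v} nz F∋v = decidable-stable (toℕ v ℕ.<? k) do
      v≤y ← (proj₂ (push-nonzero x≢y nz) >>= λ where
        (inj₁ nz′) → return (c≤y nz′ F∋v)
        (inj₂ (F∋x , nz′)) → case v Fin.≟ x of λ where
          (yes refl) → return (ℕ.<⇒≤ x<y)
          (no v≢x) → return (c≤y nz′ (add-∋ y (del-∋ v≢x F∋v))))
      return (subst (toℕ v ℕ.<_) y≡k (Fin.≤∧≢⇒< v≤y (∋-∌-≢ F∋v (c′-∌y nz))))

    admissible : ∀ U B → U ∋ x → U ∋ y → (∀ {v} → U ∋ v → v Fin.≤ y) → (∀ {v} → B ∋ v → U ∋ v) → Admissible E U B x y
    admissible U B x∈ y∈ bnd sub = record
      { same-colour = same ; before = x<y ; x∈U = x∈ ; y∈U = y∈ ; joined = face-edge F⋆≢0 F⋆∋y F⋆∋x ; bounded = bnd ; pins⊆U = sub }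

    -- Links of xy in a lifted piece

    LinkFace : Subset n → Set
    LinkFace K = K ∌ x × K ∌ y × ∃[ w ] (K ∌ w × w ≢ y × Typed (add w (add y K)))

    link-count : ∀ {K w} → K ∌ y → K ∌ w → w ≢ y → Typed (add w (add y K)) →
      ∀ i → lookup a i ≡ 𝟙 (does (κ w Fin.≟ i)) ℕ.+ (𝟙 (does (κ x Fin.≟ i)) ℕ.+ cnt i K)
    link-count {K} {w} K∌y K∌w w≢y T i = trans (sym (exact T i)) (trans (cnt-add i (add-∌ w≢y K∌w))
      (cong (𝟙 (does (κ w Fin.≟ i)) ℕ.+_) (trans (cnt-add i K∌y) (cong (λ j → 𝟙 (does (j Fin.≟ i)) ℕ.+ cnt i K) (sym same)))))

    𝟙-≡ : ∀ {i j : Fin m} → i ≡ j → 𝟙 (does (i Fin.≟ j)) ≡ 1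
    𝟙-≡ {i} {j} e = cong 𝟙 (dec-true (i Fin.≟ j) e)

    𝟙-≢ : ∀ {i j : Fin m} → i ≢ j → 𝟙 (does (i Fin.≟ j)) ≡ 0
    𝟙-≢ {i} {j} ne = cong 𝟙 (dec-false (i Fin.≟ j) ne)

    𝟙≤1 : ∀ b → 𝟙 b ≤ 1
    𝟙≤1 true = ℕ.≤-refl
    𝟙≤1 false = ℕ.z≤n

    -- K has d - 2 vertices, one short of full type in the colour of x and one in that of w. A
    -- neighbouring link face K′ supplies one vertex more. If the two colours agree, any new vertex
    -- gives `tight` or `crossing`. Otherwise the new vertex must have the colour of w, which is
    -- enforced by exchanging a vertex of that colour.
    common-neighbours : ∀ (l : Ch n) → Cycle l → (∀ {K} → NonZero (l K) → ¬ ¬ LinkFace K) → ∀ {K} → NonZero (l K) →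
      ¬ ¬ (∃[ K′ ] ∃[ w′ ] NonZero (l K′) × K′ ∋ w′ × K ∌ w′ × Splits x (add w′ K))
    common-neighbours l l-cyc link {K} nz = do
      (K∌x , K∌y , w , K∌w , w≢y , T) ← link nz
      let count = link-count K∌y K∌w w≢y T
      case κ w Fin.≟ κ x of λ where
        (yes j≡i) → do
          let K-size : d ≡ 2 ℕ.+ ∣ K ∣
              K-size = trans (sym (size T)) (trans (∣add∣ (add y K) w (add-∌ w≢y K∌w)) (cong suc (∣add∣ K y K∌y)))
              -- d ≥ 3 makes K nonempty, so there is a vertex to exchange.
              w₀ , K∋w₀ = ∣∣>0⇒∋ K (ℕ.s≤s⁻¹ (ℕ.s≤s⁻¹ (subst (3 ≤_) K-size 3≤d)))
              rest : ∀ {i} → i ≢ κ x → lookup a i ≡ cnt i K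
              rest i≢ = trans (count _) (cong₂ (λ p q → p ℕ.+ (q ℕ.+ cnt _ K)) (𝟙-≢ (i≢ ∘ sym ∘ trans (sym j≡i))) (𝟙-≢ (i≢ ∘ sym)))
              own : lookup a (κ x) ≡ 2 ℕ.+ cnt (κ x) K
              own = trans (count _) (cong₂ (λ p q → p ℕ.+ (q ℕ.+ cnt _ K)) (𝟙-≡ j≡i) (𝟙-≡ {κ x} refl))
          (w′ , w′≢w₀ , K∌w′ , nz′) ← cycle-exchange l l-cyc K∋w₀ nz
          let cover : ∀ i → i ≢ κ x → lookup a i ≤ cnt i (add w′ K)
              cover i i≢ = ℕ.≤-trans (ℕ.≤-reflexive (rest i≢)) (cnt-add-≤ i K∌w′)
          return (add w′ (del w₀ K) , w′ , nz′ , add-self w′ _ , K∌w′ , (case κ w′ Fin.≟ κ x of λ where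
            (yes e) → tight cover (ℕ.≤-reflexive (trans own (cong suc (sym (cnt-add-≡ K∌w′ e)))))
            (no ne) → crossing (κ w′) ne (ℕ.≤-reflexive (trans (cong suc (rest ne)) (sym (cnt-add-≡ K∌w′ refl))))
                        cover (ℕ.≤-trans (ℕ.≤-reflexive own) (ℕ.+-monoʳ-≤ 2 (cnt-add-≤ (κ x) K∌w′)))))
        (no j≢i) → do
          let j = κ w
              deficient : lookup a j ≡ suc (cnt j K)
              deficient = trans (count j) (cong₂ (λ p q → p ℕ.+ (q ℕ.+ cnt j K)) (𝟙-≡ {j} refl) (𝟙-≢ (j≢i ∘ sym)))
              own : lookup a (κ x) ≡ suc (cnt (κ x) K)
              own = trans (count _) (cong₂ (λ p q → p ℕ.+ (q ℕ.+ cnt _ K)) (𝟙-≢ j≢i) (𝟙-≡ {κ x} refl))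
              -- By a_j ≥ 2, the deficient colour j still has a vertex in K.
              w₀ , q = ∣∣>0⇒∋ (colour j K) (ℕ.s≤s⁻¹ (subst (2 ≤_) deficient (2≤a j)))
              K∋w₀ , κw₀≡j = colour-∋⁻ q
          (w′ , w′≢w₀ , K∌w′ , nz′) ← cycle-exchange l l-cyc K∋w₀ nz
          case κ w′ Fin.≟ j of λ where
            (yes e) → return (add w′ (del w₀ K) , w′ , nz′ , add-self w′ _ , K∌w′ , tight
              (λ i i≢ → case i Fin.≟ j of λ where
                (yes refl) → ℕ.≤-reflexive (trans deficient (sym (cnt-add-≡ K∌w′ e)))
                (no i≢j) → ℕ.≤-trans (ℕ.≤-reflexive (trans (count i) (cong₂ (λ p q → p ℕ.+ (q ℕ.+ cnt i K)) (𝟙-≢ (i≢j ∘ sym)) (𝟙-≢ (i≢ ∘ sym))))) (cnt-add-≤ i K∌w′))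
              (ℕ.≤-trans (ℕ.≤-reflexive own) (ℕ.s≤s (cnt-add-≤ (κ x) K∌w′))))
            -- A link face has at least a j - 1 vertices of every colour j other than κ x,
            -- so replacing a vertex of colour j by one of another colour is impossible here.
            (no ne) → λ _ → link nz′ λ (_ , K′∌y , w″ , K′∌w″ , w″≢y , T′) →
              let K′ = add w′ (del w₀ K)
                  lost : cnt j K ≡ suc (cnt j K′)
                  lost = trans (cong (cnt j) (sym (add-del K∋w₀))) (trans (cnt-add-≡ (del-self w₀ K) κw₀≡j)
                    (cong suc (sym (cnt-add-≢ (del-∌ w₀ K∌w′) ne))))
                  few : lookup a j ≤ suc (cnt j K′)
                  few = ℕ.≤-trans (ℕ.≤-reflexive (trans (link-count K′∌y K′∌w″ w″≢y T′ j)
                          (cong (λ q → 𝟙 (does (κ w″ Fin.≟ j)) ℕ.+ (q ℕ.+ cnt j K′)) (𝟙-≢ (j≢i ∘ sym)))))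
                        (ℕ.+-monoˡ-≤ (cnt j K′) (𝟙≤1 (does (κ w″ Fin.≟ j))))
              in ℕ.<-irrefl refl (ℕ.≤-trans (ℕ.≤-reflexive (trans (cong suc (sym lost)) (sym deficient))) few)

    -- Minimal subcycles of the contracted cycle

    module Piece (D : Ch n) (D-sub : Subchain D c′) (D-cyc : Cycle D) (D-min : Minimal D) {G₀} (G₀≢0 : NonZero (D G₀)) where

      D⇒c′ : ∀ {F} → NonZero (D F) → NonZero (c′ F)
      D⇒c′ {F} nz z = nz (≈-trans (D-sub F nz) z)

      Hull : Fin n → Set ℓ
      Hull v = In D v ⊎ v ≡ y

      module _ (Q : Subset n → Bool) (Q-reflects : ∀ F → Reflects (Q F) (NonZero (D F)))
               (U : Subset n) (U-reflects : ∀ v → Reflects (lookup U v) (Hull v)) where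

        U-In : ∀ {F v} → NonZero (D F) → F ∋ v → U ∋ v
        U-In {F} {v} nz q = ∋⟨ proj₂ (U-reflects v) (inj₁ (F , nz , q)) ⟩

        U∋y : U ∋ y
        U∋y = ∋⟨ proj₂ (U-reflects y) (inj₂ refl) ⟩

        restricted : restrict Q c′ ≐ D
        restricted F with true-or-false (Q F)
        ... | inj₁ e = ≈-trans (restrict-true Q c′ e) (≈-sym (D-sub F (proj₁ (Q-reflects F) e)))
        ... | inj₂ e = ≈-trans (restrict-false Q c′ e) (≈-sym (stable λ nz → case trans (sym (proj₂ (Q-reflects F) nz)) e of λ ()))

        open Lifted x≢y Q c (λ F → ≈-trans (Linear.L-cong ∂-linear restricted F) (D-cyc F)) renaming (k to l; k-cycle to l-cycle)

        -- If the link were zero, the lift r would be a nonzero subcycle of c and equal to c by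
        -- minimality; but r omits the face `F⋆` through xy.
        l≢0 : ¬ (l ≐ 𝕆)
        l≢0 l≐𝕆 = F⋆≢0 (≈-trans (≈-sym (r≐c F⋆)) (lift-∋∋ x≢y Q c F⋆∋x F⋆∋y))
          where
          b≐𝕆 : b ≐ 𝕆
          b≐𝕆 F = ≈-trans (b-eq F) (⊕-zero (Linear.L-𝕆 (wedge-linear y) l≐𝕆 F) (⊝-zero (Linear.L-𝕆 (wedge-linear x) l≐𝕆 F)))
          r≢𝕆 : ¬ (r ≐ 𝕆)
          r≢𝕆 r≐𝕆 = G₀≢0 (≈-trans (≈-sym (restricted G₀)) (≈-trans (≈-sym (push-lift x≢y Q c G₀))
            (push-zero x≢y (c′-∌y (D⇒c′ G₀≢0)) (r≐𝕆 G₀) (r≐𝕆 (add y (del x G₀))))))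
          r≐c : r ≐ c
          r≐c = min r (lift-subchain x≢y Q c) b≐𝕆 r≢𝕆

        r⇒c : ∀ {F} → NonZero (r F) → NonZero (c F)
        r⇒c {F} nz z = nz (≈-trans (lift-subchain x≢y Q c F nz) z)

        swap-D : ∀ {F} → F ∋ y → NonZero (r F) → NonZero (D (swap x≢y F))
        swap-D F∋y nz = proj₁ (Q-reflects _) (proj₁ (proj₂ (lift-∋-nonzero x≢y Q c F∋y nz)))

        link : ∀ {K} → NonZero (l K) → ¬ ¬ LinkFace K
        link {K} nz = do
          (w , K∌x , K∌w , _ , w≢y , nz′) ← face-y nz
          return (K∌x , K∌y nz , w , K∌w , w≢y , typed (r⇒c nz′))

        link-vertex : ∀ {K v} → NonZero (l K) → K ∋ v → ¬ ¬ (U ∋ v × lookup E v ∋ x × lookup E v ∋ y)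
        link-vertex {K} {v} nz K∋v = do
          (w , _ , _ , _ , _ , nz₁) ← face-y nz
          (w₂ , _ , _ , _ , nz₂) ← face-x nz
          let F∋v = add-∋ w (add-∋ y K∋v)
          return ( U-In (swap-D (add-∋ w (add-self y K)) nz₁) (add-∋ x (del-∋ (∋-∌-≢ K∋v (K∌y nz)) F∋v))
                 , face-edge (r⇒c nz₂) (add-∋ w₂ (add-∋ x K∋v)) (add-∋ w₂ (add-self x K))
                 , face-edge (r⇒c nz₁) F∋v (add-∋ w (add-self y K)))

        U≤y : ∀ {v} → U ∋ v → v Fin.≤ y
        U≤y {v} q with proj₁ (U-reflects v) (∋-eq q)
        ... | inj₁ (F , nz , F∋v) = subst (toℕ v ≤_) (sym y≡k) (ℕ.<⇒≤ (c′-below (D⇒c′ nz) F∋v))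
        ... | inj₂ refl = ℕ.≤-refl

        -- D avoids y, so the induction hypothesis applies to it at the unchanged placement; its
        -- edges are edges of c, up to writing y for x.
        contracted : ∀ u → (∀ {v w} → U ∋ v → U ∋ w → lookup E v ∋ w → Stretch (move τ y (t x)) u v w ≡ 0ℚ) → U ∋ x →
          (∀ k → u y k ≡ u x k) → ¬ ¬ Rides u (λ v → U ∋ v × v ≢ y)
        contracted u′ edges U∋x y-x = do
          (S , s , skew , fits) ← IH D D-cyc D-min (λ z → G₀≢0 (z G₀)) (c′-typed ∘ D⇒c′) (c′-below ∘ D⇒c′) u′ D-motion
          return (S , s , skew , λ v (U∋v , v≢y) → case proj₁ (U-reflects v) (∋-eq U∋v) of λ where
            (inj₁ inD) → fits v inD
            (inj₂ v≡y) → contradiction v≡y v≢y)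
          where
          -- The vertex x is replaced by y, which the limit motion identifies with it.
          φ : Fin n → Fin n
          φ v = if does (v Fin.≟ x) then y else v
          φ-face : ∀ {F v} → F ∋ v → add y (del x F) ∋ φ v
          φ-face {F} {v} F∋v with v Fin.≟ x
          ... | yes _ = add-self y (del x F)
          ... | no v≢x = add-∋ y (del-∋ v≢x F∋v)
          φ-move : ∀ {v} → v ≢ y → move τ y (t x) (φ v) ≡ p v
          φ-move {v} v≢y with v Fin.≟ x
          ... | yes refl = trans (move-≡ τ y (t x)) (cong (λ i → μ i (t x)) (sym same))
          ... | no _ = move-≢ τ (t x) v≢y
          φ-u : ∀ v k → u′ (φ v) k ≡ u′ v k
          φ-u v k with v Fin.≟ x
          ... | yes refl = y-x k
          ... | no _ = refl
          φ-U : ∀ {F v} → NonZero (D F) → F ∋ v → U ∋ φ v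
          φ-U {F} {v} nz F∋v with v Fin.≟ x
          ... | yes _ = U∋y
          ... | no _ = U-In nz F∋v
          D-motion : Motion D u′
          D-motion {F} {v} {w} nz F∋v F∋w = decidable-stable (Stretch p u′ v w ℚ.≟ 0ℚ) do
            let F∌y = c′-∌y (D⇒c′ nz)
                v≢y = ∋-∌-≢ F∋v F∌y
                w≢y = ∋-∌-≢ F∋w F∌y
            inj₂ (F∋x , nz′) ← proj₂ (push-nonzero x≢y (D⇒c′ nz))
              where inj₁ nz′ → return (trans (sym (cong₂ (λ q r → app (q ⊖ r) (u′ v ⊖ u′ w)) (move-≢ τ (t x) v≢y) (move-≢ τ (t x) w≢y)))
                                 (edges (U-In nz F∋v) (U-In nz F∋w) (face-edge nz′ F∋v F∋w)))
            return (trans (sym (cong₂ (λ q r → app (q ⊖ r) (u′ v ⊖ u′ w)) (φ-move v≢y) (φ-move w≢y)))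
              (trans (app-congʳ (move τ y (t x) (φ v) ⊖ move τ y (t x) (φ w)) (λ k → sym (cong₂ _-_ (φ-u v k) (φ-u w k))))
                (edges (φ-U nz F∋v) (φ-U nz F∋w) (face-edge nz′ (φ-face F∋v) (φ-face F∋w)))))

        rides : ¬ ¬ Rides u (λ v → In D v ⊎ v ≡ x ⊎ v ≡ y)
        rides = do
          (K , nz) ← ¬≐ l≢0
          (K′ , w′ , nz′ , K′∋w′ , K∌w′ , splits) ← common-neighbours l l-cycle link nz
          (K∌x , _) ← link nz
          (K′∌x , _) ← link nz′
          (w , _ , _ , _ , _ , nz₁) ← face-y nz
          let C = add w′ K
              U∋x = U-In (swap-D (add-∋ w (add-self y K)) nz₁) (add-self x (del y (add w (add y K))))
              neighbour : ∀ v → C ∋ v → ¬ ¬ (U ∋ v × lookup E v ∋ x × lookup E v ∋ y)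
              neighbour v C∋v = case v Fin.≟ w′ of λ where
                (yes refl) → link-vertex nz′ K′∋w′
                (no v≢w′) → link-vertex nz (add-∋⁻ v≢w′ C∋v)
          N ← ¬¬-Π-Fin (λ v → (em (C ∋ v) >>= λ where
                (yes C∋v) → (neighbour v C∋v >>= λ q → return (λ _ → q))
                (no ∌) → return (λ C∋v → contradiction C∋v ∌)))
          -- The pins are carried by `G₀`, a face of the piece: it is typed and avoids y.
          let S , s , skew , fits = Split.split-rides E U G₀ C
                (admissible U G₀ U∋x U∋y U≤y (U-In G₀≢0)) (c′-typed (D⇒c′ G₀≢0)) (c′-∌y (D⇒c′ G₀≢0))
                (add-∌ (∋-∌-≢ K′∋w′ K′∌x ∘ sym) K∌x) (add-∌ (∋-∌-≢ K′∋w′ (K∌y nz′) ∘ sym) (K∌y nz)) splits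
                (λ {v} q → proj₁ (N v q)) (λ {v} q → proj₁ (proj₂ (N v q))) (λ {v} q → proj₂ (proj₂ (N v q)))
                (λ u′ edges y-x → contracted u′ edges U∋x y-x)
                u (λ _ _ e → E-motion e)
          return (S , s , skew , λ v → λ where
            (inj₁ (F , nz , F∋v)) → fits v (U-In nz F∋v)
            (inj₂ (inj₁ refl)) → fits x U∋x
            (inj₂ (inj₂ refl)) → fits y U∋y)

      piece-rides : ¬ ¬ Rides u (λ v → In D v ⊎ v ≡ x ⊎ v ≡ y)
      piece-rides = do
        Q ← ¬¬-Π-Subset (λ F → ¬¬-reflects (NonZero (D F)))
        (U , U-reflects) ← ¬¬-comprehension Hull
        rides (proj₁ ∘ Q) (proj₂ ∘ Q) U U-reflects

    -- Every piece carries x and y along. Labelling each face together with both gives two pieces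
    -- that meet in a link face K the d common points K ∪ {x, y}.
    Near : Subset n → Fin n → Set
    Near F v = F ∋ v ⊎ v ≡ x ⊎ v ≡ y

    -- A cancelling pair is the simplex B ∪ {x} split at x, with the d - 1 vertices of B as common
    -- neighbours; the contraction is rigid as a simplex.
    cancelled-rides : ∀ {B} → B ∌ x → B ∌ y → NonZero (c (add x B)) → NonZero (c (add y B)) →
      Rides u (add y (add x B) ∋_)
    cancelled-rides {B} B∌x B∌y nzx nzy = Split.split-rides E U (add x B) B
      (admissible U (add x B) (add-∋ y (add-self x B)) (add-self y (add x B)) U≤y (add-∋ y))
      (typed nzx) (add-∌ (x≢y ∘ sym) B∌y) B∌x B∌y
      (tight (λ i i≢ → ℕ.≤-reflexive (trans (sym (exact (typed nzx) i)) (cnt-add-≢ B∌x (i≢ ∘ sym))))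
             (ℕ.≤-reflexive (trans (sym (exact (typed nzx) (κ x))) (cnt-add-≡ B∌x refl))))
      (add-∋ y ∘ add-∋ x) (λ q → face-edge nzx (add-∋ x q) (add-self x B)) (λ q → face-edge nzy (add-∋ y q) (add-self y B))
      contracted u (λ _ _ e → E-motion e)
      where
      U = add y (add x B)
      U≤y : ∀ {v} → U ∋ v → v Fin.≤ y
      U≤y {v} q with v Fin.≟ y
      ... | yes refl = ℕ.≤-refl
      ... | no v≢y = c≤y nzx (add-∋⁻ v≢y q)
      contracted : ∀ u → (∀ {v w} → U ∋ v → U ∋ w → lookup E v ∋ w → Stretch (move τ y (t x)) u v w ≡ 0ℚ) →
        (∀ k → u y k ≡ u x k) → ¬ ¬ Rides u (λ v → U ∋ v × v ≢ y)
      contracted u′ edges _ = return (rotation u′ , shift u′ , rotation-skew u′ , λ v (U∋v , v≢y) →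
        simplex-rigid u′ (λ v w p q → trans
          (sym (cong₂ (λ r s → app (r ⊖ s) (u′ v ⊖ u′ w)) (move-≢ τ (t x) (avoid p)) (move-≢ τ (t x) (avoid q))))
          (edges (add-∋ y p) (add-∋ y q) (face-edge nzx p q))) v (add-∋⁻ v≢y U∋v))
        where
        open Basis t τ-inj τ≢0 (add x B) (exact (typed nzx))
        avoid : ∀ {v} → add x B ∋ v → v ≢ y
        avoid q = ∋-∌-≢ q (add-∌ (x≢y ∘ sym) B∌y)

    rides-⊆ : ∀ {ℓ₁ ℓ₂} {P : Fin n → Set ℓ₁} {P′ : Fin n → Set ℓ₂} → (∀ {v} → P′ v → P v) → Rides u P → Rides u P′
    rides-⊆ sub (S , s , skew , fits) = S , s , skew , λ v q → fits v (sub q)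

    piece-through : ∀ {F} → NonZero (c′ F) → ¬ ¬ Rides u (Near F)
    piece-through {F} nz = do
      (D , sub , D-cyc , D-min , nzD) ← minimal-through c′ c′-cyc F nz
      R ← Piece.piece-rides D sub D-cyc D-min nzD
      return (rides-⊆ (λ { (inj₁ q) → inj₁ (F , nzD , q) ; (inj₂ e) → inj₂ e }) R)

    near-pair : ∀ {B} → ∀ {v} → Near (add x B) v → add y (add x B) ∋ v
    near-pair (inj₁ q) = add-∋ y q
    near-pair (inj₂ (inj₁ refl)) = add-∋ y (add-self x _)
    near-pair (inj₂ (inj₂ refl)) = add-self y _

    near-swap : ∀ {F v} → Near F v → Near (swap x≢y F) v
    near-swap {F} {v} (inj₂ e) = inj₂ e
    near-swap {F} {v} (inj₁ q) with v Fin.≟ y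
    ... | yes e = inj₂ (inj₂ e)
    ... | no v≢y = inj₁ (add-∋ x (del-∋ v≢y q))

    near-swap⁻ : ∀ {F v} → Near (swap x≢y F) v → Near F v
    near-swap⁻ {F} {v} (inj₂ e) = inj₂ e
    near-swap⁻ {F} {v} (inj₁ q) with v Fin.≟ x
    ... | yes e = inj₂ (inj₁ e)
    ... | no v≢x = inj₁ (proj₂ (del-∋⁻ (add-∋⁻ v≢x q)))

    label : ∀ {F} → Away x≢y F → NonZero (c F) → ¬ ¬ Rides u (Near F)
    label {F} away nz with ∋⊎∌ F y
    ... | inj₁ F∋y = do
      let F∌x = case away of λ { (inj₁ q) → q ; (inj₂ F∌y) → ∋-∌-contradiction F∋y F∌y }
      R ← (em (c′ (swap x≢y F) ≈ 𝟘) >>= λ where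
        (no nz′) → piece-through nz′
        (yes z) → return (rides-⊆ near-pair (cancelled-rides (del-∌ y F∌x) (del-self y F)
          (cancelled-∋y x≢y F∌x F∋y nz z) (subst (NonZero ∘ c) (sym (add-del F∋y)) nz))))
      return (rides-⊆ near-swap R)
    ... | inj₂ F∌y with ∋⊎∌ F x
    ... | inj₂ F∌x = piece-through λ z → nz (≈-trans (≈-sym (push-∌∌ x≢y c F∌y F∌x)) z)
    ... | inj₁ F∋x = em (c′ F ≈ 𝟘) >>= λ where
      (no nz′) → piece-through nz′
      (yes z) → return (rides-⊆ (λ {v} q → near-pair (subst (λ H → Near H v) (sym (add-del F∋x)) q))
        (cancelled-rides (del-self x F) (del-∌ x F∌y) (subst (NonZero ∘ c) (sym (add-del F∋x)) nz) (cancelled-∋x x≢y F∌y F∋x nz z)))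

    module Labelled {F₀} (F₀∌x : F₀ ∌ x) (F₀≢0 : NonZero (c F₀)) (S₀ : Fin d → Row d) (s₀ : Row d) (skew₀ : Skew S₀)
      (fits₀ : ∀ v → Near F₀ v → Fit S₀ s₀ u v)
      (Q : Subset n → Bool) (Q-reflects : ∀ F → Reflects (Q F) (∀ v → Near F v → Fit S₀ s₀ u v)) where

      same-label : ∀ {T z S s} → Typed T → T ∌ z → (∀ v → add z T ∋ v → Fit S₀ s₀ u v) → (∀ v → add z T ∋ v → Fit S s u v) →
        ∀ v → Fit S s u v → Fit S₀ s₀ u v
      same-label {S = S} {s} T T∌z f₀ f v fit k = trans (fit k)
        (trivial-unique T T∌z {S} {s} {S₀} {s₀} (λ v q k → trans (sym (f v q k)) (f₀ v q k)) v k)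

      near-add-y : ∀ {F v} → add y F ∋ v → Near F v
      near-add-y {F} {v} q with v Fin.≟ y
      ... | yes e = inj₂ (inj₂ e)
      ... | no v≢y = inj₁ (add-∋⁻ v≢y q)

      near-add-x : ∀ {F v} → add x F ∋ v → Near F v
      near-add-x {F} {v} q with v Fin.≟ x
      ... | yes e = inj₂ (inj₁ e)
      ... | no v≢x = inj₁ (add-∋⁻ v≢x q)

      -- A piece rides a single trivial motion, and F ∪ {y}, which is affinely spanning, identifies
      -- it with the chosen one.
      Q-clash : ∀ D → Subchain D c′ → Cycle D → Minimal D → ∀ {F H} → NonZero (D F) → NonZero (D H) → Q F ≡ true → Q H ≡ false → ⊥
      Q-clash D sub D-cyc D-min {F} {H} nzF nzH e e′ = Piece.piece-rides D sub D-cyc D-min nzF λ (S , s , skew , fits) →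
        let nz′ = Piece.D⇒c′ D sub D-cyc D-min nzF nzF
            in-piece : ∀ {F v} → NonZero (D F) → Near F v → In D v ⊎ v ≡ x ⊎ v ≡ y
            in-piece nz = λ { (inj₁ q) → inj₁ (_ , nz , q) ; (inj₂ q) → inj₂ q }
            good = proj₂ (Q-reflects H) λ v near → same-label {S = S} {s} (c′-typed nz′) (c′-∌y nz′)
              (λ v q → proj₁ (Q-reflects F) e v (near-add-y q)) (λ v q → fits v (in-piece nzF (near-add-y q)))
              v (fits v (in-piece nzH near))
        in case trans (sym good) e′ of λ ()

      Q-constant : ∀ D → Subchain D c′ → Cycle D → Minimal D → ∀ {F H} → NonZero (D F) → NonZero (D H) → Q F ≡ Q H
      Q-constant D sub D-cyc D-min {F} {H} nzF nzH with true-or-false (Q F) | true-or-false (Q H)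
      ... | inj₁ e | inj₁ e′ = trans e (sym e′)
      ... | inj₂ e | inj₂ e′ = trans e (sym e′)
      ... | inj₁ e | inj₂ e′ = ⊥-elim (Q-clash D sub D-cyc D-min nzF nzH e e′)
      ... | inj₂ e | inj₁ e′ = ⊥-elim (Q-clash D sub D-cyc D-min nzH nzF e′ e)

      cyc₁ : Cycle (restrict Q c′)
      cyc₁ = restrict-cycle Q c′ c′-cyc Q-constant

      cyc₂ : Cycle (restrict (not ∘ Q) c′)
      cyc₂ = restrict-cycle (not ∘ Q) c′ c′-cyc λ D sub D-cyc D-min nzF nzH → cong not (Q-constant D sub D-cyc D-min nzF nzH)

      open Halves x≢y Q c cyc cyc₁ cyc₂

      lift-label : ∀ {F} → NonZero (lift x≢y Q c F) → ∀ v → Near F v → Fit S₀ s₀ u v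
      lift-label {F} nz v near with ∋⊎∌ F y
      ... | inj₂ F∌y = proj₁ (Q-reflects F) (proj₁ (lift-∌-nonzero x≢y Q c F∌y nz)) v near
      ... | inj₁ F∋y = proj₁ (Q-reflects (swap x≢y F)) (proj₁ (proj₂ (lift-∋-nonzero x≢y Q c F∋y nz))) v (near-swap near)

      -- The halves provide faces K ∪ {y, w} and K ∪ {y, w′} whose motions agree on K ∪ {x, y}.
      -- These d points span only a hyperplane, so the step to full agreement needs the skewness
      -- used in `trivial-glue`.
      apart : ∀ K → NonZero (L₁.k K) → ¬ NonZero (L₂.k K)
      apart K nz₁ nz₂ = L₁.face-y nz₁ λ (w , K∌x , K∌w , w≢x , w≢y , f₁) → L₂.face-y nz₂ λ (w′ , _ , K∌w′ , w′≢x , w′≢y , f₂) →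
        let F = add w (add y K)
            F′ = add w′ (add y K)
            F′∋y = add-∋ w′ (add-self y K)
            F′∌x , Q-false , cF′≢0 = lift-∋-nonzero x≢y (not ∘ Q) c F′∋y f₂
            T = typed cF′≢0
            fits-K : ∀ v → add x F′ ∋ v → v ≢ w′ → Fit S₀ s₀ u v
            fits-K v q v≢w′ = lift-label f₁ v (case v Fin.≟ x of λ where
              (yes e) → inj₂ (inj₁ e)
              (no v≢x) → inj₁ (add-∋ w (add-∋⁻ v≢w′ (add-∋⁻ v≢x q))))
        in label (inj₁ F′∌x) cF′≢0 λ (S , s , skew , fits) →
          let agree = trivial-glue T F′∌x (add-self w′ (add y K)) {S} {s} {S₀} {s₀} skew skew₀
                (λ v q v≢w′ k → trans (sym (fits v (near-add-x q) k)) (fits-K v q v≢w′ k))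
              good = proj₂ (Q-reflects (swap x≢y F′)) λ v near k → trans (fits v (near-swap⁻ near) k) (agree v k)
          in case trans (sym (cong not good)) Q-false of λ ()

      r⁺≐c : L₁.r⁺ ≐ c
      r⁺≐c = min L₁.r⁺ (halves-subchain apart) L₁.r⁺-cycle λ z → F₀≢0 (≈-trans (≈-sym at-F₀) (z F₀))
        where
        lifted-F₀ : lift x≢y Q c F₀ ≈ c F₀
        lifted-F₀ with ∋⊎∌ F₀ y
        ... | inj₂ F₀∌y = ≈-trans (lift-∌ x≢y Q c F₀∌y) (restrict-true Q c (proj₂ (Q-reflects F₀) fits₀))
        ... | inj₁ F₀∋y = lift-true x≢y Q c F₀∌x F₀∋y (proj₂ (Q-reflects (swap x≢y F₀)) λ v → fits₀ v ∘ near-swap⁻)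
        at-F₀ : L₁.r⁺ F₀ ≈ c F₀
        at-F₀ = ≈-trans (⊕-cong lifted-F₀ (⊝-zero (wedge-wedge-away x≢y L₁.k (inj₁ F₀∌x)))) (⊕-identityʳ _)

      away-fits : ∀ {F} → Away x≢y F → NonZero (c F) → ∀ v → Near F v → Fit S₀ s₀ u v
      away-fits {F} away nz = lift-label λ z → nz (≈-trans (≈-sym (r⁺≐c F))
        (⊕-zero z (⊝-zero (wedge-wedge-away x≢y L₁.k away))))

      all-fit : ∀ v → In c v → Fit S₀ s₀ u v
      all-fit v (F , nz , F∋v) with away? x≢y F
      ... | inj₁ away = away-fits away nz v (inj₁ F∋v)
      ... | inj₂ (F∋x , F∋y) with v Fin.≟ x
      ... | yes e = fits₀ v (inj₂ (inj₁ e))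
      -- A face through both x and y is compared with an adjacent face that omits x and keeps v.
      ... | no v≢x = fit-stable {S₀} {s₀} {u} {v} do
        (w , w≢x , _ , nz′) ← cycle-exchange c cyc F∋x nz
        return (away-fits (inj₁ (add-∌ (w≢x ∘ sym) (del-self x F))) nz′ v (inj₁ (add-∋ w (del-∋ v≢x F∋v))))

    conclude : ¬ ¬ Rides u (In c)
    conclude = do
      (w , w≢x , _ , nz) ← cycle-exchange c cyc F⋆∋x F⋆≢0
      let F₀∌x = add-∌ (w≢x ∘ sym) (del-self x F⋆)
      (S , s , skew , fits) ← label (inj₁ F₀∌x) nz
      Q ← ¬¬-Π-Subset (λ F → ¬¬-reflects (∀ v → Near F v → Fit S s u v))
      return (S , s , skew , Labelled.all-fit F₀∌x nz S s skew fits (proj₁ ∘ Q) (proj₂ ∘ Q))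

  rigid-below : ∀ k → RigidBelow k
  rigid-below zero c cyc min c≢𝕆 typed below u motion = do
    (F , nz) ← ¬≐ c≢𝕆
    let v , F∋v = ∣∣>0⇒∋ F (subst (1 ≤_) (sym (size (typed nz))) (ℕ.≤-trans (ℕ.s≤s ℕ.z≤n) 3≤d))
    contradiction (below nz F∋v) λ ()
  rigid-below (suc k) c cyc min c≢𝕆 typed below u motion = do
    yes (F , y , nz , F∋y , y≡k) ← em (∃[ F ] ∃[ y ] NonZero (c F) × F ∋ y × toℕ y ≡ k)
      where no none → rigid-below k c cyc min c≢𝕆 typed
                        (λ {F} {v} nz F∋v → ℕ.≤∧≢⇒< (ℕ.s≤s⁻¹ (below nz F∋v)) λ e → none (F , v , nz , F∋v , e)) u motion
    E ← ¬¬-Π-Fin (λ v → ¬¬-comprehension (Adjacent c v))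
    let y∈colour = colour-∋ {κ y} refl F∋y
        x , q = ∣∣>0⇒∋ (del y (colour (κ y) F)) (ℕ.s≤s⁻¹ (subst (2 ≤_) (trans (sym (exact (typed nz) (κ y))) (∣del∣ y∈colour)) (2≤a (κ y))))
        x≢y , x∈colour = del-∋⁻ q
        F∋x , κx≡κy = colour-∋⁻ x∈colour
    Step.conclude (rigid-below k) c cyc min typed below nz F∋x F∋y x≢y κx≡κy y≡k u motion
      (Vec.tabulate (proj₁ ∘ E)) λ v w → subst (λ A → Reflects (lookup A w) (Adjacent c v w)) (sym (Vec.lookup∘tabulate (proj₁ ∘ E) v)) (proj₂ (E v) w)

-- From rational to real motions

Null : (ℕ → ℚ) → Set
Null f = ∀ ε → .{{Positive ε}} → ∃[ N ] ∀ {n} → N ≤ n → ℚ.∣ f n ∣ ℚ.< ε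

null-0 : Null (λ _ → 0ℚ)
null-0 ε = 0 , λ _ → ℚ.positive⁻¹ ε

null-cong : ∀ {f h} → (∀ n → f n ≡ h n) → Null f → Null h
null-cong e nf ε = let N , b = nf ε in N , λ {n} q → subst (λ z → ℚ.∣ z ∣ ℚ.< ε) (e n) (b q)

null-+ : ∀ {f h} → Null f → Null h → Null (λ n → f n + h n)
null-+ {f} {h} nf nh ε =
  let instance _ = ℚ.pos*pos⇒pos ½ ε
      N , bf = nf (½ * ε)
      M , bh = nh (½ * ε)
  in N ℕ.⊔ M , λ {n} q → ℚ.≤-<-trans (ℚ.∣p+q∣≤∣p∣+∣q∣ (f n) (h n))
       (subst (ℚ.∣ f n ∣ + ℚ.∣ h n ∣ ℚ.<_) (trans (sym (ℚ.*-distribʳ-+ ε ½ ½)) (ℚ.*-identityˡ ε))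
         (ℚ.+-mono-< (bf (ℕ.m⊔n≤o⇒m≤o N M q)) (bh (ℕ.m⊔n≤o⇒n≤o N M q))))

null-* : ∀ q {f} → Null f → Null (λ n → q * f n)
null-* q {f} nf ε =
  let C = 1ℚ + ℚ.∣ q ∣
      instance
        _ = ℚ.pos+nonNeg⇒pos 1ℚ ℚ.∣ q ∣ {{ℚ.∣-∣-nonNeg q}}
        _ = ℚ.pos⇒nonZero C
        _ = ℚ.1/pos⇒pos C
        _ = ℚ.pos*pos⇒pos (ℚ.1/ C) ε
      N , b = nf (ℚ.1/ C * ε)
  in N , λ {n} h → begin-strict
    ℚ.∣ q * f n ∣ ≡⟨ ℚ.∣p*q∣≡∣p∣*∣q∣ q (f n) ⟩
    ℚ.∣ q ∣ * ℚ.∣ f n ∣ ≤⟨ ℚ.*-monoʳ-≤-nonNeg ℚ.∣ f n ∣ {{ℚ.∣-∣-nonNeg (f n)}} (p≤1+p ℚ.∣ q ∣) ⟩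
    C * ℚ.∣ f n ∣ <⟨ ℚ.*-monoʳ-<-pos C (b h) ⟩
    C * (ℚ.1/ C * ε) ≡⟨ ℚ.*-assoc C (ℚ.1/ C) ε ⟨
    (C * ℚ.1/ C) * ε ≡⟨ cong (_* ε) (ℚ.*-inverseʳ C) ⟩
    1ℚ * ε ≡⟨ ℚ.*-identityˡ ε ⟩
    ε ∎
  where
  open ℚ.≤-Reasoning
  p≤1+p : ∀ p → p ℚ.≤ 1ℚ + p
  p≤1+p p = subst (ℚ._≤ 1ℚ + p) (ℚ.+-identityˡ p) (ℚ.+-monoˡ-≤ p (ℚ.nonNegative⁻¹ 1ℚ))

null-smallness : IsSmallness Null
null-smallness = record { small-0 = null-0 ; small-+ = null-+ ; small-* = null-* ; small-cong = null-cong }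

≡⇒≈ℝ : ∀ {x y} → (∀ n → approx x n ≡ approx y n) → x ≈ℝ y
≡⇒≈ℝ {x} {y} e = null-cong (λ n → sym (p≡q⇒p-q≡0 (e n))) null-0

approx-sumℝ : ∀ {k} (f : Fin k → ℝ) n → approx (sumℝ f) n ≡ ∑ λ j → approx (f j) n
approx-sumℝ {zero} f n = refl
approx-sumℝ {suc k} f n = cong (approx (f zero) n +_) (approx-sumℝ (f ∘ suc) n)

cauchy-cong : ∀ {f h} → (∀ n → f n ≡ h n) → IsCauchy f → IsCauchy h
cauchy-cong e cf ε = let N , b = cf ε in N , λ {m} {n} p q → subst₂ (λ y z → ℚ.∣ y - z ∣ ℚ.< ε) (e m) (e n) (b p q)

-- Term by term, the sequence approximates a real linear combination with rational coefficients.
linear-cauchy : ∀ {N} {φ : (Fin N → ℚ) → ℚ} → PolyLin (λ _ → φ) → (x : Fin N → ℝ) →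
  IsCauchy (λ n → φ (λ j → approx (x j) n))
linear-cauchy ((α , _) , eq) x = cauchy-cong
  -- The functional does not depend on the polynomial variable; 0 is an arbitrary value for it.
  (λ n → trans (approx-sumℝ (λ j → fromℚ (α j 0ℚ) *ℝ x j) n) (eq 0ℚ (λ j → approx (x j) n)))
  (cauchy (sumℝ λ j → fromℚ (α j 0ℚ) *ℝ x j))

lin-cong : ∀ {N} {φ ψ : ℚ → (Fin N → ℚ) → ℚ} → (∀ t x → φ t x ≡ ψ t x) → PolyLin φ → PolyLin ψ
lin-cong e (r , p) = r , λ t x → trans (p t x) (e t x)

neg-lin : ∀ {N} {φ : ℚ → (Fin N → ℚ) → ℚ} → PolyLin φ → PolyLin (λ t x → - φ t x)
neg-lin {φ = φ} Φ = lin-cong (λ t x → ℚ.+-identityˡ (- φ t x)) (sub-lin zero-lin Φ)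

scaleʳ-lin : ∀ {N} {φ : ℚ → (Fin N → ℚ) → ℚ} q → PolyLin φ → PolyLin (λ t x → φ t x * q)
scaleʳ-lin {φ = φ} q Φ = lin-cong (λ t x → ℚ.*-comm q (φ t x)) (scale-lin (const-poly q) Φ)

module RealRigidity {n m} (a : Vec ℕ m) (κ : Fin n → Fin m) (pl : Choice.Placement a κ)
  (B : Subset n) (B-typed : Splitting.Typed a κ pl B) where
  open Splitting a κ pl
  open Basis t τ-inj τ≢0 B (exact B-typed)

  appʳ-lin : ∀ {φ : Fin d → ℚ → (Fin (n ℕ.* d) → ℚ) → ℚ} (e : Row d) → (∀ k → PolyLin (φ k)) → PolyLin (λ t x → app (λ k → φ k t x) e)
  appʳ-lin e Φ = ∑-lin λ k → scaleʳ-lin (e k) (Φ k)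

  shift-lin : ∀ k → PolyLin (λ _ x → shift (unflatten x) k)
  shift-lin k = ∑-lin λ v → scaleʳ-lin (w v k) (appʳ-lin (p v) (field-lin v))

  pairing-lin : ∀ v v′ → PolyLin (λ _ x → pairing (unflatten x) v v′)
  pairing-lin v v′ = appʳ-lin (p v′) λ k → sub-lin (field-lin v k) (shift-lin k)

  torque-lin : ∀ v v′ → PolyLin (λ _ x → torque (unflatten x) v v′)
  torque-lin v v′ = if-lin (does (v Fin.<? v′)) (pairing-lin v v′) (if-lin (does (v′ Fin.<? v)) (neg-lin (pairing-lin v′ v)) zero-lin)
    where
    if-lin : ∀ b {φ ψ : ℚ → (Fin (n ℕ.* d) → ℚ) → ℚ} → PolyLin φ → PolyLin ψ → PolyLin (λ t x → if b then φ t x else ψ t x)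
    if-lin true Φ Ψ = Φ
    if-lin false Φ Ψ = Ψ

  rotation-lin : ∀ k l → PolyLin (λ _ x → rotation (unflatten x) k l)
  rotation-lin k l = ∑-lin λ v → ∑-lin λ v′ → scaleʳ-lin (w v l) (scaleʳ-lin (w v′ k) (torque-lin v v′))

  full : Subset n
  full = Vec.replicate n true

  ∋-full : ∀ v → full ∋ v
  ∋-full v = ∋⟨ Vec.lookup-replicate v true ⟩

  real-p : Configuration n d
  real-p v k = fromℚ (p v k)

  module _ (E : Adjacency) (det : Determined E full B p) (ṗ : Configuration n d)
    (ṗ-motion : ∀ v w → v ≢ w → lookup E v ∋ w → (real-p v -ᵖ real-p w) · (ṗ v -ᵖ ṗ w) ≈ℝ 0ℝ) where

    flat : Fin (n ℕ.* d) → ℝ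
    flat j = ṗ (proj₁ (remQuot {n} d j)) (proj₂ (remQuot {n} d j))

    at : ℕ → Field
    at i = unflatten (λ j → approx (flat j) i)

    at-≡ : ∀ i v k → at i v k ≡ approx (ṗ v k) i
    at-≡ i v k = cong (λ z → approx (ṗ (proj₁ z) (proj₂ z)) i) (Fin.remQuot-combine {n} v k)

    -- The adjusting trivial motion depends linearly on the field, so those of the rational
    -- approximations form Cauchy sequences.
    Sℝ : Fin d → Fin d → ℝ
    Sℝ k l = mkℝ (λ i → rotation (at i) k l) (linear-cauchy (rotation-lin k l) flat)

    sℝ : Point d
    sℝ k = mkℝ (λ i → shift (at i) k) (linear-cauchy (shift-lin k) flat)

    approx-trivial : ∀ v k i → approx ((Sℝ k · real-p v) +ℝ sℝ k) i ≡ trivial p (rotation (at i)) (shift (at i)) v k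
    approx-trivial v k i = cong (_+ shift (at i) k) (approx-sumℝ (λ l → Sℝ k l *ℝ real-p v l) i)

    real-stretch : Fin n → Fin n → ℝ
    real-stretch v w = (real-p v -ᵖ real-p w) · (ṗ v -ᵖ ṗ w)

    approx-stretch : ∀ v w i → approx (real-stretch v w) i - 0ℚ ≡ Stretch p (at i) v w
    approx-stretch v w i = trans (eq (approx (real-stretch v w) i))
      (trans (approx-sumℝ (λ k → (real-p v -ᵖ real-p w) k *ℝ (ṗ v -ᵖ ṗ w) k) i)
        (app-congʳ (p v ⊖ p w) λ k → sym (cong₂ _-_ (at-≡ i v k) (at-≡ i w k))))
      where
      eq : ∀ q → q - 0ℚ ≡ q
      eq = solve-∀ ℚ-ring

    stretch-null : ∀ v w → Dec (v ≡ w) → lookup E v ∋ w → Null (λ i → Stretch p (at i) v w)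
    -- `E` may contain loops, about which the motion says nothing; their stretch is 0.
    stretch-null v w (yes refl) e = null-cong {λ _ → 0ℚ} {λ i → Stretch p (at i) v v}
      (λ i → sym (app-zeroˡ (at i v ⊖ at i v) (λ k → ℚ.+-inverseʳ (p v k)))) null-0
    stretch-null v w (no v≢w) e = null-cong {λ i → approx (real-stretch v w) i - 0ℚ} {λ i → Stretch p (at i) v w}
      (approx-stretch v w) (ṗ-motion v w v≢w e)

    flat-adjusted : ℕ → Fin (n ℕ.* d) → ℚ
    flat-adjusted i = flatten (adjusted (at i))

    flat-stretch : ∀ i v w → Stretch p (at i) v w ≡ Stretch p (unflatten (flat-adjusted i)) v w
    flat-stretch i v w = sym (trans
      (app-congʳ (p v ⊖ p w)
        (λ k → cong₂ _-_ (unflatten-flatten (adjusted (at i)) v k) (unflatten-flatten (adjusted (at i)) w k)))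
      (stretch-mod-trivial p (at i) (shift (at i)) (rotation-skew (at i)) v w))

    flat-pinned : ∀ i {v w} → B ∋ v → B ∋ w → v Fin.≤ w → 0ℚ ≡ app (p w) (unflatten (flat-adjusted i) v)
    flat-pinned i {v} {w} B∋v B∋w v≤w = sym (trans
      (app-congʳ (p w) (unflatten-flatten (adjusted (at i)) v))
      (trans (app-comm (p w) (adjusted (at i) v)) (adjusted-pinned (at i) B∋v B∋w v≤w)))

    open Rows E full B {λ _ → p} (λ v k → const-poly (p v k))

    rows-injective : Inj (List.map (_at 0ℚ) rows)
    rows-injective x h = flatten-zero (det (unflatten x) (rows-sound 0ℚ x h))

    NullAlong : ((Fin (n ℕ.* d) → ℚ) → ℚ) → Set
    NullAlong φ = Null (λ i → φ (flat-adjusted i))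

    solved : Solved NullAlong 0ℚ
    solved =
        (λ {v} {w} _ _ e → null-cong {λ i → Stretch p (at i) v w} {λ i → Stretch p (unflatten (flat-adjusted i)) v w}
          (λ i → flat-stretch i v w) (stretch-null v w (v Fin.≟ w) e))
      , (λ {v} {w} B∋v B∋w v≤w → null-cong {λ _ → 0ℚ} {λ i → app (p w) (unflatten (flat-adjusted i) v)}
          (λ i → flat-pinned i B∋v B∋w v≤w) null-0)
      , (λ {v} ∌v k → ∋-∌-contradiction (∋-full v) ∌v)

    rows-null : All (λ r → NullAlong (app r)) (List.map (_at 0ℚ) rows)
    rows-null = rows-complete NullAlong
      (λ {φ} {ψ} e → null-cong {λ i → φ (flat-adjusted i)} {λ i → ψ (flat-adjusted i)} (λ i → e (flat-adjusted i))) null-0 0ℚ solved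

    -- The pins hold exactly and the edge equations up to null sequences; elimination passes nullity
    -- from the equations to the unknowns.
    adjusted-null : ∀ v k → Null (λ i → adjusted (at i) v k)
    adjusted-null v k = null-cong {λ i → flat-adjusted i (combine v k)} {λ i → adjusted (at i) v k}
      (λ i → unflatten-flatten (adjusted (at i)) v k)
      (small-transfer null-smallness (List.map (_at 0ℚ) rows) rows-injective (λ j i → flat-adjusted i j) rows-null (combine v k))

    real-trivial : IsTrivial real-p ṗ
    real-trivial = Sℝ , sℝ , (λ k l → ≡⇒≈ℝ {Sℝ k l} { -ℝ Sℝ l k} λ i → rotation-skew (at i) k l) ,
      λ v k → null-cong {λ i → adjusted (at i) v k} {λ i → approx (ṗ v k) i - approx ((Sℝ k · real-p v) +ℝ sℝ k) i}
        (λ i → cong₂ _-_ (at-≡ i v k) (sym (approx-trivial v k i))) (adjusted-null v k)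

-- Coefficients with equality weakened to its double negation

¬¬-group : ∀ {g ℓ} → AbelianGroup g ℓ → AbelianGroup g ℓ
¬¬-group Γ = record
  { Carrier = Carrier ; _≈_ = λ x y → ¬ ¬ (x ≈ y) ; _∙_ = _∙_ ; ε = ε ; _⁻¹ = _⁻¹
  ; isAbelianGroup = record
    { isGroup = record
      { isMonoid = record
        { isSemigroup = record
          { isMagma = record
            { isEquivalence = record
              { refl = return Γ.refl
              ; sym = λ p k → p (k ∘ Γ.sym)
              ; trans = λ p q k → p λ e → q λ f → k (Γ.trans e f) }
            ; ∙-cong = λ p q k → p λ e → q λ f → k (Γ.∙-cong e f) }
          ; assoc = λ x y z → return (Γ.assoc x y z) }
        ; identity = (λ x → return (Γ.identityˡ x)) , λ x → return (Γ.identityʳ x) }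
      ; inverse = (λ x → return (Γ.inverseˡ x)) , λ x → return (Γ.inverseʳ x)
      ; ⁻¹-cong = λ p k → p (k ∘ Γ.⁻¹-cong) }
    ; comm = λ x y → return (Γ.comm x y) } }
  where
  open AbelianGroup Γ using (Carrier; _≈_; _∙_; ε; _⁻¹)
  module Γ = AbelianGroup Γ

module Bridge {g ℓ} (Γ : AbelianGroup g ℓ) where
  open ChainAlgebra Γ
  open Chains Γ using (Chain; coeff; signed; position; IsCycle; IsMinimalCycle; homogeneous) renaming (∂ to ∂ᴰ; IsZero to IsZeroᴰ)
  open AbelianGroup Γ using (rawMonoid; monoid)
  open import Relation.Binary.Reasoning.Setoid (AbelianGroup.setoid Γ)
  open import Algebra.Properties.Monoid.Sum monoid using () renaming (sum to Sum; sum-cong-≋ to Sum-cong)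

  term : ∀ {n} → Ch n → Subset n → Fin n → G
  term c F x = if lookup F x then 𝟘 else signed (position (F ∪ ⁅ x ⁆) x) (c (F ∪ ⁅ x ⁆))

  Sum-⊝ : ∀ {n} (f : Fin n → G) → Sum (λ i → ⊝ f i) ≈ ⊝ Sum f
  Sum-⊝ {zero} f = ≈-sym ⊝𝟘≈𝟘
  Sum-⊝ {suc n} f = ≈-trans (⊕-congˡ (Sum-⊝ (f ∘ suc))) (⊝-⊕-comm _ _)

  below-suc : ∀ {n} (y x : Fin n) → does (suc y Fin.≤? suc x) ≡ does (y Fin.≤? x)
  below-suc zero x = refl
  below-suc (suc y) x = refl

  position-zero : ∀ {n} (F : Subset n) → position (true ∷ F) zero ≡ 1
  position-zero F = cong suc (∣∩false∣ F)
    where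
    ∣∩false∣ : ∀ {n} (F : Subset n) → ∣ F ∩ Vec.tabulate (λ _ → false) ∣ ≡ 0
    ∣∩false∣ [] = refl
    ∣∩false∣ (true ∷ F) = ∣∩false∣ F
    ∣∩false∣ (false ∷ F) = ∣∩false∣ F

  position-suc : ∀ {n} s (F : Subset n) x → position (s ∷ F) (suc x) ≡ 𝟙 s ℕ.+ position F x
  position-suc true F x = cong (λ V → suc ∣ F ∩ V ∣) (Vec.tabulate-cong λ y → below-suc y x)
  position-suc false F x = cong (λ V → ∣ F ∩ V ∣) (Vec.tabulate-cong λ y → below-suc y x)

  term-suc : ∀ {n} (c : Ch (suc n)) s F x → term c (s ∷ F) (suc x) ≈ signed (𝟙 s) (term (λ H → c (s ∷ H)) F x)
  term-suc c true F x with lookup F x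
  ... | true = ≈-sym ⊝𝟘≈𝟘
  ... | false = ≈-reflexive (cong (λ j → signed j (c (true ∷ (F ∪ ⁅ x ⁆)))) (position-suc true (F ∪ ⁅ x ⁆) x))
  term-suc c false F x with lookup F x
  ... | true = ≈-refl
  ... | false = ≈-reflexive (cong (λ j → signed j (c (false ∷ (F ∪ ⁅ x ⁆)))) (position-suc false (F ∪ ⁅ x ⁆) x))

  term-zero : ∀ {n} (c : Ch (suc n)) F → term c (false ∷ F) zero ≈ ⊝ c (true ∷ F)
  term-zero {n} c F = ≈-trans
    (≈-reflexive (cong (λ j → signed j (c (true ∷ (F ∪ Vec.replicate n false)))) (position-zero (F ∪ Vec.replicate n false))))
    (⊝-cong (≈-reflexive (cong (λ H → c (true ∷ H)) (Subset.∪-identityʳ F))))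

  -- Positions are counted from 1, so each vertex contributes with the sign opposite to that of its
  -- hook; the cycles are the same.
  Sum-term : ∀ {n} (c : Ch n) F → Sum (term c F) ≈ ⊝ ∂ c F
  Sum-term c [] = ≈-sym ⊝𝟘≈𝟘
  Sum-term c (false ∷ F) = begin
    term c (false ∷ F) zero ⊕ Sum (λ x → term c (false ∷ F) (suc x))
      ≈⟨ ⊕-cong (term-zero c F) (Sum-cong (term-suc c false F)) ⟩
    ⊝ c (true ∷ F) ⊕ Sum (term (out c) F)
      ≈⟨ ⊕-congˡ (Sum-term (out c) F) ⟩
    ⊝ c (true ∷ F) ⊕ ⊝ ∂ (out c) F
      ≈⟨ ⊕-comm _ _ ⟩
    ⊝ ∂ (out c) F ⊕ ⊝ c (true ∷ F)
      ≈⟨ ⊝-⊕-comm _ _ ⟩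
    ⊝ ∂ c (false ∷ F) ∎
  Sum-term c (true ∷ F) = begin
    𝟘 ⊕ Sum (λ x → term c (true ∷ F) (suc x)) ≈⟨ ⊕-identityˡ _ ⟩
    Sum (λ x → term c (true ∷ F) (suc x)) ≈⟨ Sum-cong (term-suc c true F) ⟩
    Sum (λ x → ⊝ term (inn c) F x) ≈⟨ Sum-⊝ (term (inn c) F) ⟩
    ⊝ Sum (term (inn c) F) ≈⟨ ⊝-cong (Sum-term (inn c) F) ⟩
    ⊝ ⊝ ∂ (inn c) F ∎

  summand : ∀ {n} (total : G) {f : Fin n → G} → total ≡ Sum f → Fin n → G
  summand _ {f} _ = f

  ∂ᴰ≈⊝∂ : ∀ {n k} (a : Chain n k) F → ∂ᴰ a F ≈ ⊝ ∂ (coeff a) F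
  ∂ᴰ≈⊝∂ a F = ≈-trans (Sum-cong pointwise) (Sum-term (coeff a) F)
    where
    -- The summands of ∂ᴰ are local to its definition.
    pointwise : ∀ x → summand (∂ᴰ a F) refl x ≈ term (coeff a) F x
    pointwise x with x Subset.∈? F
    ... | yes x∈F rewrite Vec.[]=⇒lookup x∈F = ≈-refl
    ... | no x∉F with ∋⊎∌ F x
    ... | inj₁ ∋⟨ e ⟩ = contradiction (Vec.lookup⇒[]= x F e) x∉F
    ... | inj₂ ∌⟨ e ⟩ rewrite e = ≈-refl

∂-¬¬ : ∀ {g ℓ} (Γ : AbelianGroup g ℓ) {n} (c : ChainAlgebra.Ch Γ n) F →
  ChainAlgebra.∂ (¬¬-group Γ) c F ≡ ChainAlgebra.∂ Γ c F
∂-¬¬ Γ c [] = refl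
∂-¬¬ Γ c (false ∷ F) = cong (λ z → AbelianGroup._∙_ Γ z (c (true ∷ F))) (∂-¬¬ Γ (λ H → c (false ∷ H)) F)
∂-¬¬ Γ c (true ∷ F) = cong (AbelianGroup._⁻¹ Γ) (∂-¬¬ Γ (λ H → c (true ∷ H)) F)

module StableMinimal {g ℓ} (Γ : AbelianGroup g ℓ) where
  open Bridge Γ
  open Chains Γ using (Chain; coeff; homogeneous; IsMinimalCycle; IsCycle; IsZero) renaming (Subchain to Subchainᴰ; _≋_ to _≋ᴰ_; ∂ to ∂ᴰ)
  open AbelianGroup Γ using (_≈_; ε) renaming (sym to ≈-sym; trans to ≈-trans; ⁻¹-cong to ⊝-cong)
  open ChainAlgebra Γ using (⊝-zero; ⊝-zero⁻; ∂)

  ¬¬-stable : ∀ {x y} → ¬ ¬ (¬ ¬ x ≈ y) → ¬ ¬ x ≈ y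
  ¬¬-stable h k = h λ e → e k

  open StableChains (¬¬-group Γ) (λ {x} {y} → ¬¬-stable {x} {y}) public
    using (Cycle; Minimal; _≐_; 𝕆) renaming (Subchain to Subchain¬¬)

  ¬¬-cycle : ∀ {n k} {a : Chain n k} → IsCycle a → Cycle (coeff a)
  ¬¬-cycle {a = a} cyc F = subst (λ z → ¬ ¬ z ≈ ε) (sym (∂-¬¬ Γ (coeff a) F))
    (return (⊝-zero⁻ (≈-trans (≈-sym (∂ᴰ≈⊝∂ a F)) (cyc F))))

  -- The claim at each face is a negation, so the finitely many decisions whether a coefficient of b
  -- vanishes may be taken. They make b a subchain in the strict sense, homogeneous because a is.
  ¬¬-minimal : ∀ {n k} {a : Chain n k} → IsMinimalCycle a → Minimal (coeff a)
  ¬¬-minimal {n} {k} {a} (cyc , min) b sub b-cyc b≢0 F contra = ¬¬-Π-Subset classify λ cases →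
    ¬¬-Π-Subset (λ H → subst (λ z → ¬ ¬ z ≈ ε) (∂-¬¬ Γ b H) (b-cyc H)) λ b-cyc′ →
    let β : Chain n k
        β = record { coeff = b ; homogeneous = λ H ne → case cases H of λ where
              (inj₁ z) → z
              (inj₂ e) → ≈-trans e (homogeneous a H ne) }
    in case min β cases (λ H → ≈-trans (∂ᴰ≈⊝∂ β H) (⊝-zero (b-cyc′ H))) of λ where
      (inj₁ same) → contra (same F)
      (inj₂ vanishing) → b≢0 (λ H → return (vanishing H))
    where
    classify : ∀ H → ¬ ¬ (b H ≈ ε ⊎ b H ≈ coeff a H)
    classify H = do
      no nz ← em (b H ≈ ε)
        where yes z → return (inj₁ z)
      e ← sub H (λ z → z nz)
      return (inj₂ e)

-- Colours of facets and the conclusion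

total : ∀ {m} → (Fin m → ℕ) → ℕ
total f = sum (Vec.tabulate f)

total-+ : ∀ {m} (f g : Fin m → ℕ) → total (λ i → f i ℕ.+ g i) ≡ total f ℕ.+ total g
total-+ {zero} f g = refl
total-+ {suc m} f g = trans (cong (f zero ℕ.+ g zero ℕ.+_) (total-+ (f ∘ suc) (g ∘ suc)))
  (ℕ-interchange (f zero) (g zero) (total (f ∘ suc)) (total (g ∘ suc)))
  where open CommutativeSemigroupProperties ℕ.+-commutativeSemigroup using () renaming (interchange to ℕ-interchange)

total-0 : ∀ m → total {m} (λ _ → 0) ≡ 0
total-0 zero = refl
total-0 (suc m) = total-0 m

total-indicator : ∀ {m} (j : Fin m) → total (λ i → 𝟙 (does (j Fin.≟ i))) ≡ 1
total-indicator {suc m} zero = cong suc (total-0 m)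
total-indicator (suc j) = total-indicator j

∣∣≡total : ∀ {n m} (κ : Fin n → Fin m) F → ∣ F ∣ ≡ total (λ i → ∣ F ∩ fibre κ i ∣)
∣∣≡total {m = m} κ [] = sym (total-0 m)
∣∣≡total κ (false ∷ F) = ∣∣≡total (κ ∘ suc) F
∣∣≡total κ (true ∷ F) = trans (cong₂ ℕ._+_ (sym (total-indicator (κ zero))) (∣∣≡total (κ ∘ suc) F))
  (trans (sym (total-+ (λ i → 𝟙 (does (κ zero Fin.≟ i))) (λ i → ∣ F ∩ fibre (κ ∘ suc) i ∣)))
    (cong sum (Vec.tabulate-cong λ i → sym (head (does (κ zero Fin.≟ i)) (fibre (κ ∘ suc) i)))))
  where
  head : ∀ b Q → ∣ (true ∷ F) ∩ (b ∷ Q) ∣ ≡ 𝟙 b ℕ.+ ∣ F ∩ Q ∣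
  head true Q = refl
  head false Q = refl

total-≤ : ∀ {m} (a : Vec ℕ m) (f : Fin m → ℕ) → (∀ i → f i ≤ lookup a i) → total f ≤ sum a
total-≤ [] f h = ℕ.z≤n
total-≤ (k ∷ a) f h = ℕ.+-mono-≤ (h zero) (total-≤ a (f ∘ suc) (h ∘ suc))

-- Bounds whose sum is attained leave no slack. For a facet this turns the bounds of the colouring
-- into equalities.
total-tight : ∀ {m} (a : Vec ℕ m) (f : Fin m → ℕ) → (∀ i → f i ≤ lookup a i) → total f ≡ sum a → ∀ i → f i ≡ lookup a i
total-tight (k ∷ a) f h e zero = ℕ.≤-antisym (h zero) (ℕ.+-cancelʳ-≤ (total (f ∘ suc)) k (f zero)
  (ℕ.≤-trans (ℕ.+-monoʳ-≤ k (total-≤ a (f ∘ suc) (h ∘ suc))) (ℕ.≤-reflexive (sym e))))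
total-tight (k ∷ a) f h e (suc i) = total-tight a (f ∘ suc) (h ∘ suc)
  (ℕ.+-cancelˡ-≡ k _ _ (trans (cong (ℕ._+ total (f ∘ suc)) (sym (total-tight (k ∷ a) f h e zero))) e)) i

module _ {n : ℕ} where
  ⊆⇒∋ : ∀ {F} {v : Fin n} → ⁅ v ⁆ ⊆ F → F ∋ v
  ⊆⇒∋ {F} {v} sub = ∋⟨ Vec.[]=⇒lookup (sub (Subset.x∈⁅x⁆ v)) ⟩

  ∋⇒⊆ : ∀ {F : Subset n} {v w} → F ∋ v → F ∋ w → (⁅ v ⁆ ∪ ⁅ w ⁆) ⊆ F
  ∋⇒⊆ {F} {v} {w} ∋⟨ p ⟩ ∋⟨ q ⟩ z∈ = case Subset.x∈p∪q⁻ ⁅ v ⁆ ⁅ w ⁆ z∈ of λ where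
    (inj₁ z∈v) → subst (Subset._∈ F) (sym (Subset.x∈⁅y⁆⇒x≡y v z∈v)) (Vec.lookup⇒[]= v F p)
    (inj₂ z∈w) → subst (Subset._∈ F) (sym (Subset.x∈⁅y⁆⇒x≡y w z∈w)) (Vec.lookup⇒[]= w F q)

module Rigidity {n m} (a : Vec ℕ m) (Δ : SimplicialComplex n) (κ : Fin n → Fin m) (col : IsColoring a Δ κ) where
  open Splitting a κ (Choice.placement a κ)

  facet-typed : ∀ F → Face Δ F → ∣ F ∣ ≡ d → Typed F
  facet-typed F face size = record
    { size = size
    ; exact = total-tight a (λ i → cnt i F) (col F face) (trans (sym (∣∣≡total κ F)) size) }

  E : Adjacency
  E = Vec.tabulate λ v → Vec.tabulate λ w → does (face? Δ (⁅ v ⁆ ∪ ⁅ w ⁆))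

  lookup-E : ∀ v w → lookup (lookup E v) w ≡ does (face? Δ (⁅ v ⁆ ∪ ⁅ w ⁆))
  lookup-E v w = trans (cong (λ A → lookup A w) (Vec.lookup∘tabulate _ v)) (Vec.lookup∘tabulate _ w)

  sparse : IsSparse κ a (λ v k → fromℚ (p v k))
  sparse v j out = ≡⇒≈ℝ {fromℚ (p v j)} {0ℝ} λ _ → in-block-outside a (κ v) (moment (lookup a (κ v)) (t v)) j out

  -- The pins on B reduce a double-negated rational statement to the vanishing of a rational vector,
  -- where the double negation can be removed; elimination then reaches the reals.
  rigid : ∀ {B} → Typed B → (∀ u → (∀ {v w} → Face Δ (⁅ v ⁆ ∪ ⁅ w ⁆) → Stretch p u v w ≡ 0ℚ) → ¬ ¬ Rides u (λ _ → ⊤)) →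
    SparseRigid κ a (skeleton Δ)
  rigid {B} B-typed rides = real-p , sparse , λ ṗ motion → real-trivial E determined ṗ λ v w v≢w e →
      motion v w (v≢w , does-true (face? Δ (⁅ v ⁆ ∪ ⁅ w ⁆)) (trans (sym (lookup-E v w)) (∋-eq e)))
    where
    open RealRigidity a κ placement B B-typed
    open Basis t τ-inj τ≢0 B (exact B-typed) using (trivial-pinned)
    determined : Determined E full B p
    determined u sol v k = decidable-stable (u v k ℚ.≟ 0ℚ) do
      (S , s , skew , fits) ← rides u λ {v} {w} face → edges sol (∋-full v) (∋-full w)
        ∋⟨ trans (lookup-E v w) (dec-true (face? Δ (⁅ v ⁆ ∪ ⁅ w ⁆)) face) ⟩
      let S≡0 , s≡0 = trivial-pinned {S} {s} skew λ {v} {w} B∋v B∋w v≤w →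
            trans (app-cong {x = p w} (λ k → sym (fits v tt k)) (λ _ → refl)) (pins sol B∋v B∋w v≤w)
      return (trans (fits v tt k) (cong₂ _+_ (app-zeroˡ (p v) (S≡0 k)) (s≡0 k)))

  simplex : ∀ F → ∣ F ∣ ≡ d → GeneratedBy Δ (_≡ F) → SparseRigid κ a (skeleton Δ)
  simplex F size gen = rigid F-typed λ u motion → return
    (rotation u , shift u , rotation-skew u , λ v _ → simplex-rigid u (λ v w F∋v F∋w → motion (face (∋⇒⊆ F∋v F∋w))) v (∋-all v))
    where
    face : ∀ {H} → H ⊆ F → Face Δ H
    face {H} sub = Equivalence.from (gen H) (F , refl , sub)
    F-typed = facet-typed F (face (λ q → q)) size
    open Basis t τ-inj τ≢0 F (exact F-typed)
    ∋-all : ∀ v → F ∋ v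
    ∋-all v with H , refl , sub ← Equivalence.to (gen ⁅ v ⁆) (vertices Δ v) = ⊆⇒∋ sub

  module _ {g ℓ} (Γ : AbelianGroup g ℓ) (2≤a : ∀ i → 2 ≤ lookup a i) (3≤d : 3 ≤ sum a) where
    open Chains Γ using (Chain; coeff; homogeneous; IsZero; IsMinimalCycle; supp)
    open AbelianGroup Γ using (_≈_; ε)
    open StableMinimal Γ
    open Induction (¬¬-group Γ) (λ {x} {y} → ¬¬-stable {x} {y}) a κ placement 2≤a 3≤d using (rigid-below)

    cycle : (c : Chain n (sum a)) → ¬ IsZero c → IsMinimalCycle c → GeneratedBy Δ (supp c) → ∀ F → supp c F → SparseRigid κ a (skeleton Δ)
    cycle c c≢0 c-min gen F₀ F₀∈ = rigid (typed F₀∈) λ u motion → do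
      (S , s , skew , fits) ← rigid-below n (coeff c) (¬¬-cycle {a = c} (proj₁ c-min)) (¬¬-minimal {a = c} c-min)
        (λ z → z F₀ F₀∈) (λ nz → typed (λ e → nz (return e))) (λ {F} {v} _ _ → Fin.toℕ<n v)
        u (λ {F} nz F∋v F∋w → motion (face (λ e → nz (return e)) (∋⇒⊆ F∋v F∋w)))
      return (S , s , skew , λ v _ → let F , F∈ , sub = Equivalence.to (gen ⁅ v ⁆) (vertices Δ v) in
        fits v (F , (λ z → z F∈) , ⊆⇒∋ sub))
      where
      face : ∀ {F H} → supp c F → H ⊆ F → Face Δ H
      face {F} {H} F∈ sub = Equivalence.from (gen H) (F , F∈ , sub)
      typed : ∀ {F} → supp c F → Typed F
      typed {F} F∈ = facet-typed F (face F∈ (λ q → q)) (decidable-stable (∣ F ∣ ℕ.≟ d) λ ne → F∈ (homogeneous c F ne))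

theorem6p1 : ∀ {c ℓ} (Γ : AbelianGroup c ℓ) {n m : ℕ} (a : Vec ℕ m) →
    (∀ i → 2 ≤ lookup a i) → 3 ≤ sum a →
    (Δ : SimplicialComplex n) → IsMinimalCycleComplex Γ (sum a) Δ →
    (κ : Fin n → Fin m) → IsColoring a Δ κ →
    SparseRigid κ a (skeleton Δ)
theorem6p1 Γ a 2≤a 3≤d Δ (_ , inj₁ (F , size , gen)) κ col = Rigidity.simplex a Δ κ col F size gen
theorem6p1 Γ a 2≤a 3≤d Δ (((F , face , size) , _) , inj₂ (c , c≢0 , c-min , gen)) κ col =
  -- The pins need an actual face of the support, outside any double negation; the given facet of Δ
  -- lies in one.
  let F₀ , F₀∈ , _ = Equivalence.to (gen F) face
  in Rigidity.cycle a Δ κ col Γ 2≤a 3≤d c c≢0 c-min gen F₀ F₀∈
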